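{- Let $p$ be an odd prime, let $F/\mathbb{Q}$ be a cyclic extension of degree $p$, let $\zeta_p$ be a primitive $p$-th root of unity, $K=\mathbb{Q}(\zeta_p)$ and $L=FK$. Let $\bar\tau$ be a generator of $\mathrm{Gal}(L/F)$, $e$ a primitive root modulo $p$, and $\Phi:L^*\to L^*$, $\Phi(x)=x^{e^{p-2}}\,\bar\tau(x)^{e^{p-3}}\cdots\bar\tau^{p-2}(x)$. Say that $x\in L^*$ induces an $\mathbb{H}_{p^3}$-extension if $\Phi(\mathrm{Nr}_{L/K}(x))\notin L^{*p}$, and that $x$ induces a $C_{p^2}\rtimes C_p$-extension if $\Phi(\zeta_p\,\mathrm{Nr}_{L/K}(x))\notin L^{*p}$. Then: (a) If $L=\mathbb{Q}(\zeta_{p^2})$, then an element $x\in L^*$ induces an $\mathbb{H}_{p^3}$-extension if and only if it induces a $C_{p^2}\rtimes C_p$-extension. (b) If $L\neq\mathbb{Q}(\zeta_{p^2})$, then every $x\in L^*$ which does not induce an $\mathbb{H}_{p^3}$-extension induces a $C_{p^2}\rtimes C_p$-extension. (c) There are infinitely many $x\in L^*$ which induce both an $\mathbb{H}_{p^3}$-extension and a $C_{p^2}\rtimes C_p$-extension.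
   Context: $L^{*p}$ denotes the group of $p$-th powers of nonzero elements of $L$. $\mathbb{H}_{p^3}$ is the Heisenberg group of order $p^3$ and $C_{p^2}\rtimes C_p$ the other non-abelian group of order $p^3$; in the paper an element $x\in L^*$ "induces" such an extension of $\mathbb{Q}$ via an explicit Kummer-theoretic construction exactly when the stated non-$p$-th-power condition holds, and the claim is formulated directly in terms of these conditions.
   Formalization: The generator τ̄ and the primitive root e are assumed to be matched by τ̄(ζ_p) = ζ_p^e; without this Φ(ζ_p) = 1 and (b) fails for x = 1 when L ≠ ℚ(ζ_{p²}). -}

module Defs where

open import Level using (Level; 0ℓ; suc; _⊔_)
open import Algebra.Apartness.Bundles using (HeytingCommutativeRing; HeytingField)
open import Algebra.Bundles using (Semiring; Ring; CommutativeRing)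
open import Algebra.Morphism.Bundles using (RingHomomorphism)
open import Algebra.Morphism.Structures using (IsRingIsomorphism)
import Algebra.Definitions.RawSemiring as RawSemiringDefinitions
import Algebra.Morphism.Construct.Composition as Composition
open import Data.Fin.Base using (Fin; toℕ)
open import Data.Nat.Base as ℕ using (ℕ; _∸_; _<_)
open import Data.Nat.Coprimality using (Coprime)
open import Data.Nat.Divisibility using (_∣_)
open import Data.Nat.GeneralisedArithmetic using (fold)
open import Data.Product.Base using (Σ; Σ-syntax; ∃-syntax; _×_)
import Data.Rational.Properties as ℚ
open import Data.Vec.Functional using (Vector)
open import Function.Bundles using (Bijection)
open import Relation.Binary.Bundles using (Setoid)
open import Relation.Binary.Definitions using (Decidable)
open import Relation.Binary.PropositionalEquality renaming (setoid to ≡-setoid) using ()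
open import Relation.Nullary using (¬_)
open import Relation.Nullary.Decidable using (¬?)
open import Relation.Unary using (Pred)

private
  variable
    a b r a₁ a₂ b₁ b₂ r₁ r₂ s : Level

-- A Heyting field with decidable apartness: every element is zero or
-- invertible, so this is the field of classical algebra.
record Field c ℓ₁ ℓ₂ : Set (suc (c ⊔ ℓ₁ ⊔ ℓ₂)) where
  field
    heytingField : HeytingField c ℓ₁ ℓ₂

  open HeytingField heytingField public

  field
    _#?_ : Decidable _#_

  ring : Ring c ℓ₁
  ring = CommutativeRing.ring
    (HeytingCommutativeRing.commutativeRing heytingCommutativeRing)

  open Ring ring public using (rawRing; semiring)
  open RawSemiringDefinitions (Semiring.rawSemiring semiring) public using (sum; product; _^_)

ℚ-field : Field 0ℓ 0ℓ 0ℓ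
ℚ-field = record
  { heytingField = ℚ.heytingField
  ; _#?_         = λ x y → ¬? (x ℚ.≟ y)
  }

-- A homomorphism of fields is injective, so it is a field extension.
record Extension (k : Field a a₁ a₂) (E : Field b b₁ b₂) : Set (a ⊔ a₁ ⊔ b ⊔ b₁) where
  field
    homomorphism : RingHomomorphism (Field.rawRing k) (Field.rawRing E)

  open RingHomomorphism homomorphism public

_∘ₑ_ : {k : Field a a₁ a₂} {E : Field b b₁ b₂} {M : Field r r₁ r₂} →
       Extension E M → Extension k E → Extension k M
_∘ₑ_ {k = k} {E} {M} ψ φ = record
  { homomorphism = Composition.ringHomomorphism
      {M₁ = Field.ring k} {M₂ = Field.ring E} {M₃ = Field.ring M}
      (Extension.homomorphism φ) (Extension.homomorphism ψ)
  }

module _ (E : Field b b₁ b₂) where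
  open Field E

  IsPrimitiveRootOfUnity : ℕ → Carrier → Set b₁
  IsPrimitiveRootOfUnity n ω =
    ω ^ n ≈ 1# × (∀ m → 0 < m → m < n → ¬ (ω ^ m ≈ 1#))

  IsNonzeroPower : ℕ → Carrier → Set (b ⊔ b₁ ⊔ b₂)
  IsNonzeroPower n y = ∃[ z ] (z # 0#) × (y ≈ z ^ n)

module _ {k : Field a a₁ a₂} {E : Field b b₁ b₂} (φ : Extension k E) where
  private
    module k = Field k
    module φ = Extension φ
  open Field E

  Image : Pred Carrier (a ⊔ b₁)
  Image x = ∃[ c ] (φ.⟦ c ⟧ ≈ x)

  -- Membership in k(S), the subfield of E generated by k and S.
  data Adjoin (S : Pred Carrier s) : Pred Carrier (a ⊔ b ⊔ b₁ ⊔ s) where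
    base : ∀ c → Adjoin S φ.⟦ c ⟧
    gen  : ∀ {x} → S x → Adjoin S x
    add  : ∀ {x y} → Adjoin S x → Adjoin S y → Adjoin S (x + y)
    neg  : ∀ {x} → Adjoin S x → Adjoin S (- x)
    mul  : ∀ {x y} → Adjoin S x → Adjoin S y → Adjoin S (x * y)
    inv  : ∀ {x y} → Adjoin S x → x * y ≈ 1# → Adjoin S y
    resp : ∀ {x y} → x ≈ y → Adjoin S x → Adjoin S y

  GeneratedBy : Pred Carrier s → Set (a ⊔ b ⊔ b₁ ⊔ s)
  GeneratedBy S = ∀ x → Adjoin S x

  IsCyclotomic : ℕ → Set (a ⊔ b ⊔ b₁)
  IsCyclotomic n = ∃[ ω ] IsPrimitiveRootOfUnity E n ω × GeneratedBy (ω ≈_)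

  record Basis (n : ℕ) : Set (a ⊔ a₁ ⊔ b ⊔ b₁) where
    field
      basis       : Vector Carrier n
      spanning    : ∀ x → Σ[ c ∈ Vector k.Carrier n ]
                      x ≈ sum (λ i → φ.⟦ c i ⟧ * basis i)
      independent : ∀ (c : Vector k.Carrier n) →
                      sum (λ i → φ.⟦ c i ⟧ * basis i) ≈ 0# →
                      ∀ i → c i k.≈ k.0#

  record Gal : Set (a ⊔ b ⊔ b₁) where
    field
      ⟦_⟧               : Carrier → Carrier
      isRingIsomorphism : IsRingIsomorphism rawRing rawRing ⟦_⟧
      fixes             : ∀ c → ⟦ φ.⟦ c ⟧ ⟧ ≈ φ.⟦ c ⟧

  galSetoid : Setoid (a ⊔ b ⊔ b₁) (b ⊔ b₁)
  galSetoid = record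
    { Carrier       = Gal
    ; _≈_           = λ σ τ → ∀ x → Gal.⟦ σ ⟧ x ≈ Gal.⟦ τ ⟧ x
    ; isEquivalence = record
      { refl  = λ x → refl
      ; sym   = λ p x → sym (p x)
      ; trans = λ p q x → trans (p x) (q x)
      }
    }

  -- Only finite Galois groups occur, so the powers with exponent in ℕ are all
  -- the powers.
  IsGenerator : Gal → Set (a ⊔ b ⊔ b₁)
  IsGenerator σ = ∀ (ρ : Gal) → ∃[ n ] ∀ x → Gal.⟦ ρ ⟧ x ≈ fold x Gal.⟦ σ ⟧ n

  -- Finite of degree n, Galois (k is the fixed field of Gal), with cyclic group.
  record IsCyclicOfDegree (n : ℕ) : Set (a ⊔ a₁ ⊔ b ⊔ b₁) where
    field
      degree     : Basis n
      fixedField : ∀ x → (∀ (ρ : Gal) → Gal.⟦ ρ ⟧ x ≈ x) → Image x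
      cyclic     : ∃[ σ ] IsGenerator σ

  -- N is the norm of x over k, for E/k finite Galois: the product of ρ(x) over
  -- the distinct elements ρ of the Galois group. As a relation, it needs no
  -- enumeration of the group to be supplied beforehand.
  IsNorm : Carrier → Carrier → Set (a ⊔ b ⊔ b₁)
  IsNorm x N = ∃[ n ] Σ[ G ∈ Bijection (≡-setoid (Fin n)) galSetoid ]
    N ≈ product (λ i → Gal.⟦ Bijection.to G i ⟧ x)

IsPrimitiveRootModulo : ℕ → ℕ → Set
IsPrimitiveRootModulo p e =
  Coprime e p × (∀ m → Coprime m p → ∃[ n ] p ∣ ℕ.∣ e ℕ.^ n - m ∣)

-- Φ is the Kummer-theoretic operator when τ(ζ) = ζ^e. For a generator τ and a
-- primitive root e not matched in this way, Φ(ζ) = 1.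
module Induced {F : Field a a₁ a₂} {K : Field r r₁ r₂} {L : Field b b₁ b₂}
  (γ : Extension F L) (κ : Extension K L)
  (p e : ℕ) (ζ : Field.Carrier K) (τ : Gal γ) where
  private
    module κ = Extension κ
  open Field L

  Φ : Carrier → Carrier
  Φ x = product {p ∸ 1} λ i →
    fold x Gal.⟦ τ ⟧ (toℕ i) ^ (e ℕ.^ (p ∸ 2 ∸ toℕ i))

  InducesHeisenberg : Carrier → Set (b ⊔ r ⊔ b₁ ⊔ b₂)
  InducesHeisenberg x =
    ∃[ N ] IsNorm κ x N × ¬ IsNonzeroPower L p (Φ N)

  InducesSemidirect : Carrier → Set (b ⊔ r ⊔ b₁ ⊔ b₂)
  InducesSemidirect x =
    ∃[ N ] IsNorm κ x N × ¬ IsNonzeroPower L p (Φ (κ.⟦ ζ ⟧ * N))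

{-# OPTIONS --safe #-}
module Submission where

-- Since τ(ζ) = ζᵉ with e a primitive root, L = F(ζ) has degree p - 1 over F, and the automorphisms of F extend to
-- L over K; with the extension σ of a generator, Gal(L/K) = {1, σ, …, σᵖ⁻¹}.
--
-- (a), (b) By multiplicativity of Φ everything depends on whether Φ(ζ) is a p-th power, that is, on whether ζ = ωᵖ
-- for some ω ∈ L. Then σ(ω) ≠ ω, as K contains no primitive p²-th root of unity (p is associate to aᵖ in ℤ[ω] for
-- a = Nr_{K/ℚ}(1 - ω)), so the Lagrange resolvents of σ show L = ℚ(ω).
--
-- (c) Let ξ generate L over ℚ. A prime q dividing Nr(1 - nξ), where n is divisible by all differences of conjugates
-- of ξ, splits completely in L, and either x = 1 - nξ or x = 1 - nξ + q has valuation 1 at the prime (q, x), while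
-- its conjugates are units there. So Φ(ζᵃ Nr x) has valuation eᵖ⁻², prime to p, for all a; the same holds for x gᵖ.

open import Defs
open import Level using (_⊔_) renaming (suc to lsuc)
open import Algebra.Apartness.Bundles using (HeytingCommutativeRing)
import Algebra.Apartness.Properties.HeytingCommutativeRing as HeytingProperties
open import Algebra.Bundles using (CommutativeMonoid; CommutativeRing)
import Algebra.Morphism.Construct.Identity as Identity
open import Algebra.Morphism.Structures using (IsRingIsomorphism)
import Algebra.Properties.CommutativeMonoid.Sum as CommutativeMonoidSum
import Algebra.Properties.CommutativeSemiring.Exp as Exp
import Algebra.Properties.Ring as RingProperties
import Algebra.Properties.Semiring.Sum as SemiringSum
import Algebra.Solver.Ring as RingSolver
open import Algebra.Solver.Ring.AlmostCommutativeRing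
  using (AlmostCommutativeRing; fromCommutativeRing; _-Raw-AlmostCommutative⟶_; Induced-equivalence)
open import Data.Bool.Base using (T)
open import Data.Empty using (⊥)
open import Data.Fin.Base as Fin using (Fin; toℕ; punchIn)
import Data.Fin.Properties as Fin
open import Data.Integer.Base as ℤ using (ℤ; +_; -[1+_])
import Data.Integer.Properties as ℤ
open import Data.List.Base using ([]; _∷_)
open import Data.List.Relation.Unary.All using (_∷_)
open import Data.Maybe as Maybe using (is-just; to-witness-T)
open import Data.Nat.Base as ℕ using (ℕ; zero; suc; _∸_; _<_; _≤_; z≤n; s≤s)
open import Data.Nat.Coprimality as Coprimality using (Coprime; prime⇒coprime)
open import Data.Nat.Divisibility
  using (_∣_; _∤_; divides; _∣?_; m%n≡0⇒n∣m; ∣-trans; ∣⇒≤; *-pres-∣; m∣m*n; ∣m⇒∣m*n; ∣m+n∣m⇒∣n; *-cancelʳ-∣)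
open import Data.Nat.DivMod using (_%_; _/_; m≡m%n+[m/n]*n; m%n<n)
open import Data.Nat.GCD using (module Bézout)
open import Data.Nat.GeneralisedArithmetic using (fold)
open import Data.Nat.Primality using (Prime; prime⇒nonZero; prime⇒nonTrivial; euclidsLemma; prime⇒irreducible)
open import Data.Nat.Primality.Factorisation using (PrimeFactorisation; factorise)
import Data.Nat.Properties as ℕ
open import Data.Product.Base using (Σ-syntax; ∃-syntax; _×_; _,_; proj₁; proj₂)
open import Data.Rational.Base as ℚ using (ℚ; mkℚ)
import Data.Rational.Properties as ℚ
import Data.Rational.Unnormalised.Base as ℚᵘ
import Data.Rational.Unnormalised.Properties as ℚᵘ
open import Data.Sum.Base using (_⊎_; inj₁; inj₂)
import Data.Vec.Base as Vec
open import Data.Vec.Functional using (Vector; insertAt)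
import Data.Vec.Functional.Properties as Vector
open import Data.Vec.N-ary using (N-ary; Eq; curryⁿ; curryⁿ-cong; _$ⁿ_)
open import Function.Base using (_∘_)
open import Function.Bundles using (_⇔_; mk⇔)
open import Function.Definitions using (Injective)
open import Relation.Binary.Definitions as Tri using (Decidable; WeaklyDecidable)
open import Relation.Binary.PropositionalEquality as ≡ using (_≡_)
import Relation.Binary.Reasoning.Setoid as SetoidReasoning
open import Relation.Nullary using (¬_; Dec; yes; no)
open import Relation.Nullary.Decidable using (map′; ¬?; dec⇒maybe)
open import Relation.Nullary.Negation using (contradiction)

-- Integrality is handled by traces instead of minimal polynomials. Let P be closed under
-- multiplication and let M Tr(y) be an integer for every y in P, the trace being taken from L to ℚ.
-- If x in P is rational, then M [L:ℚ] xᵏ is an integer for all k, so x is an integer. This is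
-- applied to ℤ[ω], and in (c) to an order of L made from an arbitrary ℚ-basis of F and the powers
-- of ζ. That order need not be maximal, so factorization of ideals is not at hand, and the
-- valuation at J = (q, x) is built from norms. Let x′ be the product of the other conjugates of x.
-- Then y x′ is congruent modulo x to its trace, an integer, and x′ is a unit modulo J, so the
-- residue field is 𝔽_q. If moreover Nr x = q z with z prime to q, then z J is contained in (x): an
-- element of J can be divided by x after multiplication by z, and the power of q in its norm bounds
-- the number of divisions. The choice between 1 - nξ and 1 - nξ + q secures this condition on z.

fromℤ : ℤ → ℚ
fromℤ i = mkℚ i 0 (Coprimality.sym (Coprimality.1-coprimeTo _))

fromℤ-+ : ∀ i j → fromℤ i ℚ.+ fromℤ j ≡ fromℤ (i ℤ.+ j)
fromℤ-+ i j = ≡.trans (ℚ./-cong (≡.cong₂ ℤ._+_ (ℤ.*-identityʳ i) (ℤ.*-identityʳ j)) ≡.refl)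
                      (ℚ.↥p/↧p≡p (fromℤ (i ℤ.+ j)))

fromℤ-* : ∀ i j → fromℤ i ℚ.* fromℤ j ≡ fromℤ (i ℤ.* j)
fromℤ-* i j = ℚ.↥p/↧p≡p (fromℤ (i ℤ.* j))

fromℤ-neg : ∀ i → ℚ.- fromℤ i ≡ fromℤ (ℤ.- i)
fromℤ-neg (+ zero)   = ≡.refl
fromℤ-neg (+ suc n)  = ≡.refl
fromℤ-neg (-[1+ n ]) = ≡.refl

fromℤ-injective : ∀ {i j} → fromℤ i ≡ fromℤ j → i ≡ j
fromℤ-injective ≡.refl = ≡.refl

↧*≡↥ : ∀ r → fromℤ (ℚ.↧ r) ℚ.* r ≡ fromℤ (ℚ.↥ r)
↧*≡↥ r@record{} = ℚ.toℚᵘ-injective (ℚᵘ.≃-trans (ℚ.toℚᵘ-homo-* (fromℤ (ℚ.↧ r)) r) (ℚᵘ.*≡* eq))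
  where
  eq : (ℚ.↧ r ℤ.* ℚ.↥ r) ℤ.* ℤ.1ℤ ≡ ℚ.↥ r ℤ.* (+ (1 ℕ.* ℚ.↧ₙ r))
  eq = ≡.trans (ℤ.*-identityʳ _)
         (≡.trans (ℤ.*-comm (ℚ.↧ r) (ℚ.↥ r)) (≡.cong (λ d → ℚ.↥ r ℤ.* (+ d)) (≡.sym (ℕ.*-identityˡ (ℚ.↧ₙ r)))))

-- Finite sums and products over initial segments of ℕ.

module BigOperator {a ℓ} (M : CommutativeMonoid a ℓ) where
  open CommutativeMonoid M
  open CommutativeMonoidSum M using (sum; ∑-distrib-+)
  open SetoidReasoning setoid

  -- A family on all of ℕ can be shifted with `suc`, and the length can be rewritten along equations
  -- such as `1+m≡p`, without transporting indices in `Fin`. The sums and products of the statement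
  -- are reached through `⨁≡sum`.
  ⨁ : ℕ → (ℕ → Carrier) → Carrier
  ⨁ zero    f = ε
  ⨁ (suc n) f = f 0 ∙ ⨁ n (f ∘ suc)

  ⨁≡sum : ∀ n (f : ℕ → Carrier) → ⨁ n f ≡ sum {n} (λ i → f (toℕ i))
  ⨁≡sum zero    f = ≡.refl
  ⨁≡sum (suc n) f = ≡.cong (f 0 ∙_) (⨁≡sum n (f ∘ suc))

  ⨁-cong : ∀ n {f g : ℕ → Carrier} → (∀ i → i < n → f i ≈ g i) → ⨁ n f ≈ ⨁ n g
  ⨁-cong zero    eq = refl
  ⨁-cong (suc n) eq = ∙-cong (eq 0 (s≤s z≤n)) (⨁-cong n λ i i<n → eq (suc i) (s≤s i<n))

  ⨁-cong′ : ∀ n {f g : ℕ → Carrier} → (∀ i → f i ≈ g i) → ⨁ n f ≈ ⨁ n g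
  ⨁-cong′ n eq = ⨁-cong n (λ i _ → eq i)

  ⨁-ε : ∀ n {f : ℕ → Carrier} → (∀ i → i < n → f i ≈ ε) → ⨁ n f ≈ ε
  ⨁-ε zero    eq = refl
  ⨁-ε (suc n) eq = trans (∙-cong (eq 0 (s≤s z≤n)) (⨁-ε n λ i i<n → eq (suc i) (s≤s i<n))) (identityˡ ε)

  ⨁-distrib : ∀ n (f g : ℕ → Carrier) → ⨁ n (λ i → f i ∙ g i) ≈ ⨁ n f ∙ ⨁ n g
  ⨁-distrib n f g = begin
    ⨁ n (λ i → f i ∙ g i)                              ≡⟨ ⨁≡sum n _ ⟩
    sum {n} (λ i → f (toℕ i) ∙ g (toℕ i))              ≈⟨ ∑-distrib-+ {n} (f ∘ toℕ) (g ∘ toℕ) ⟩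
    sum {n} (f ∘ toℕ) ∙ sum {n} (g ∘ toℕ)              ≡⟨ ≡.cong₂ _∙_ (⨁≡sum n f) (⨁≡sum n g) ⟨
    ⨁ n f ∙ ⨁ n g                                      ∎

  ⨁-comm : ∀ m n (f : ℕ → ℕ → Carrier) → ⨁ m (λ i → ⨁ n (f i)) ≈ ⨁ n (λ j → ⨁ m (λ i → f i j))
  ⨁-comm zero    n f = sym (⨁-ε n λ _ _ → refl)
  ⨁-comm (suc m) n f = trans (∙-congˡ (⨁-comm m n (f ∘ suc))) (sym (⨁-distrib n (f 0) _))

  ⨁-last : ∀ n (f : ℕ → Carrier) → ⨁ (suc n) f ≈ ⨁ n f ∙ f n
  ⨁-last zero    f = comm (f 0) ε
  ⨁-last (suc n) f = trans (∙-congˡ (⨁-last n (f ∘ suc))) (sym (assoc _ _ _))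

  -- The source of the invariance of traces and norms: for f i = σⁱ(x) with σⁿ(x) = x, the shift is
  -- the application of σ.
  ⨁-cycle : ∀ n (f : ℕ → Carrier) → f n ≈ f 0 → ⨁ n (f ∘ suc) ≈ ⨁ n f
  ⨁-cycle zero    f eq = refl
  ⨁-cycle (suc n) f eq = begin
    ⨁ (suc n) (f ∘ suc)           ≈⟨ ⨁-last n (f ∘ suc) ⟩
    ⨁ n (f ∘ suc) ∙ f (suc n)     ≈⟨ ∙-congˡ eq ⟩
    ⨁ n (f ∘ suc) ∙ f 0           ≈⟨ comm _ _ ⟩
    ⨁ (suc n) f                   ∎

  ⨁-only : ∀ n (f : ℕ → Carrier) k → k < n → (∀ i → i < n → ¬ (i ≡ k) → f i ≈ ε) → ⨁ n f ≈ f k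
  ⨁-only (suc n) f zero    _         eq =
    trans (∙-congˡ (⨁-ε n λ i i<n → eq (suc i) (s≤s i<n) λ ())) (identityʳ _)
  ⨁-only (suc n) f (suc k) (s≤s k<n) eq =
    trans (∙-cong (eq 0 (s≤s z≤n) λ ())
            (⨁-only n (f ∘ suc) k k<n λ i i<n i≢k → eq (suc i) (s≤s i<n) (i≢k ∘ ℕ.suc-injective)))
          (identityˡ _)

-- Fields of characteristic zero.

module FieldProperties {c ℓ₁ ℓ₂} (E : Field c ℓ₁ ℓ₂) (ι : Extension ℚ-field E) where
  open Field E public hiding (zero)
  private module ι = Extension ι
  open HeytingProperties heytingCommutativeRing public using (1#0; x#0y#0→xy#0)

  commutativeRing : CommutativeRing c ℓ₁
  commutativeRing = HeytingCommutativeRing.commutativeRing heytingCommutativeRing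
  open CommutativeRing commutativeRing public using (+-commutativeMonoid; *-commutativeMonoid; commutativeSemiring)
  open RingProperties ring public using (-0#≈0#)
  open Exp commutativeSemiring public using (^-congˡ; ^-homo-*; ^-assocʳ; ^-distrib-*)
  open SetoidReasoning setoid public
  open BigOperator +-commutativeMonoid public using () renaming
    (⨁ to ∑; ⨁≡sum to ∑≡sum; ⨁-cong to ∑-cong; ⨁-cong′ to ∑-cong′; ⨁-ε to ∑-zero; ⨁-distrib to ∑-+; ⨁-comm to ∑-comm;
     ⨁-last to ∑-last; ⨁-cycle to ∑-cycle; ⨁-only to ∑-only)
  open BigOperator *-commutativeMonoid public using () renaming
    (⨁ to ∏; ⨁≡sum to ∏≡product; ⨁-cong to ∏-cong; ⨁-cong′ to ∏-cong′; ⨁-ε to ∏-one; ⨁-distrib to ∏-*; ⨁-cycle to ∏-cycle)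

  infix 4 _≉_ _≟_
  _≉_ : Carrier → Carrier → Set ℓ₁
  x ≉ y = ¬ (x ≈ y)

  #⇒≉ : ∀ {x y} → x # y → x ≉ y
  #⇒≉ x#y x≈y = proj₂ (tight _ _) x≈y x#y

  _≟_ : Decidable _≈_
  x ≟ y with x #? y
  ... | yes x#y = no (#⇒≉ x#y)
  ... | no ¬x#y = yes (proj₁ (tight x y) ¬x#y)

  ≉⇒# : ∀ {x y} → x ≉ y → x # y
  ≉⇒# {x} {y} x≉y with x #? y
  ... | yes x#y = x#y
  ... | no ¬x#y = contradiction (proj₁ (tight x y) ¬x#y) x≉y

  1≉0 : 1# ≉ 0#
  1≉0 = #⇒≉ 1#0

  inverse : ∀ {x} → x ≉ 0# → ∃[ y ] x * y ≈ 1#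
  inverse {x} x≉0 with #⇒invertible (≉⇒# x≉0)
  ... | y , _ , eq = y , trans (*-congʳ (sym (trans (+-congˡ -0#≈0#) (+-identityʳ x)))) eq

  x-0≈x : ∀ x → x - 0# ≈ x
  x-0≈x x = trans (+-congˡ -0#≈0#) (+-identityʳ x)

  invertible⇒≉0 : ∀ {x y} → x * y ≈ 1# → x ≉ 0#
  invertible⇒≉0 {x} {y} eq x≈0 = 1≉0 (trans (sym eq) (trans (*-congʳ x≈0) (zeroˡ y)))

  *-≉0 : ∀ {x y} → x ≉ 0# → y ≉ 0# → x * y ≉ 0#
  *-≉0 x≉0 y≉0 = #⇒≉ (x#0y#0→xy#0 (≉⇒# x≉0) (≉⇒# y≉0))

  *-cancelˡ : ∀ {x y z} → x ≉ 0# → x * y ≈ x * z → y ≈ z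
  *-cancelˡ {x} {y} {z} x≉0 eq with inverse x≉0
  ... | w , xw≈1 = begin
    y           ≈⟨ lemma y ⟨
    w * (x * y) ≈⟨ *-congˡ eq ⟩
    w * (x * z) ≈⟨ lemma z ⟩
    z           ∎
    where
    lemma : ∀ v → w * (x * v) ≈ v
    lemma v = trans (sym (*-assoc w x v)) (trans (*-congʳ (trans (*-comm w x) xw≈1)) (*-identityˡ v))

  *≈0⇒≈0 : ∀ {x y} → x ≉ 0# → x * y ≈ 0# → y ≈ 0#
  *≈0⇒≈0 x≉0 eq = *-cancelˡ x≉0 (trans eq (sym (zeroʳ _)))

  ^-≉0 : ∀ {x} n → x ≉ 0# → x ^ n ≉ 0#
  ^-≉0 zero    x≉0 = 1≉0
  ^-≉0 (suc n) x≉0 = *-≉0 x≉0 (^-≉0 n x≉0)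

  x-y≈0⇒x≈y : ∀ {x y} → x - y ≈ 0# → x ≈ y
  x-y≈0⇒x≈y {x} {y} eq = begin
    x             ≈⟨ +-identityʳ x ⟨
    x + 0#        ≈⟨ +-congˡ (-‿inverseˡ y) ⟨
    x + (- y + y) ≈⟨ +-assoc x (- y) y ⟨
    x - y + y     ≈⟨ +-congʳ eq ⟩
    0# + y        ≈⟨ +-identityˡ y ⟩
    y             ∎

  x≈y⇒x-y≈0 : ∀ {x y} → x ≈ y → x - y ≈ 0#
  x≈y⇒x-y≈0 eq = trans (+-congʳ eq) (-‿inverseʳ _)

  int : ℤ → Carrier
  int i = ι.⟦ fromℤ i ⟧

  nat : ℕ → Carrier
  nat n = int (+ n)

  int-+ : ∀ i j → int (i ℤ.+ j) ≈ int i + int j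
  int-+ i j = trans (ι.⟦⟧-cong (≡.sym (fromℤ-+ i j))) (ι.+-homo _ _)

  int-* : ∀ i j → int (i ℤ.* j) ≈ int i * int j
  int-* i j = trans (ι.⟦⟧-cong (≡.sym (fromℤ-* i j))) (ι.*-homo _ _)

  int-neg : ∀ i → int (ℤ.- i) ≈ - int i
  int-neg i = trans (ι.⟦⟧-cong (≡.sym (fromℤ-neg i))) (ι.-‿homo _)

  int-0 : int (+ 0) ≈ 0#
  int-0 = trans (ι.⟦⟧-cong ≡.refl) ι.0#-homo

  int-1 : int (+ 1) ≈ 1#
  int-1 = trans (ι.⟦⟧-cong ≡.refl) ι.1#-homo

  nat-suc : ∀ n → nat (suc n) ≈ 1# + nat n
  nat-suc n = trans (int-+ (+ 1) (+ n)) (+-congʳ int-1)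

  nat-* : ∀ m n → nat (m ℕ.* n) ≈ nat m * nat n
  nat-* m n = trans (reflexive (≡.cong int (ℤ.pos-* m n))) (int-* (+ m) (+ n))

  nat-^ : ∀ m n → nat (m ℕ.^ n) ≈ nat m ^ n
  nat-^ m zero    = int-1
  nat-^ m (suc n) = trans (nat-* m (m ℕ.^ n)) (*-congˡ (nat-^ m n))

  ι-inverse : ∀ r → ¬ (r ≡ ℚ.0ℚ) → ∃[ s ] ι.⟦ r ⟧ * ι.⟦ s ⟧ ≈ 1#
  ι-inverse r r≢0 = ℚ.1/ r , trans (sym (ι.*-homo r (ℚ.1/ r))) (trans (ι.⟦⟧-cong (ℚ.*-inverseʳ r)) ι.1#-homo)
    where instance _ = ℚ.≢-nonZero r≢0

  ι-injective-0 : ∀ {r} → ι.⟦ r ⟧ ≈ 0# → r ≡ ℚ.0ℚ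
  ι-injective-0 {r} eq with r ℚ.≟ ℚ.0ℚ
  ... | yes r≡0 = r≡0
  ... | no  r≢0 = contradiction eq (invertible⇒≉0 (proj₂ (ι-inverse r r≢0)))

  int-injective-0 : ∀ {i} → int i ≈ 0# → i ≡ + 0
  int-injective-0 = fromℤ-injective ∘ ι-injective-0

  int-injective : ∀ {i j} → int i ≈ int j → i ≡ j
  int-injective {i} {j} eq = ℤ.i-j≡0⇒i≡j i j (int-injective-0
    (trans (int-+ i (ℤ.- j)) (trans (+-congˡ (int-neg j)) (x≈y⇒x-y≈0 eq))))

  nat-injective : ∀ {i j} → nat i ≈ nat j → i ≡ j
  nat-injective = ℤ.+-injective ∘ int-injective

  nat≉0 : ∀ n → 0 < n → nat n ≉ 0#
  nat≉0 (suc n) _ eq with int-injective-0 eq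
  ... | ()

  -- int, but computing to 0# and 1#, as the constants of the solver should.
  coefficient : ℤ → Carrier
  coefficient (+ 0) = 0#
  coefficient (+ 1) = 1#
  coefficient i     = int i

  coefficient≈int : ∀ i → coefficient i ≈ int i
  coefficient≈int (+ 0)           = sym int-0
  coefficient≈int (+ 1)           = sym int-1
  coefficient≈int (+ suc (suc _)) = refl
  coefficient≈int -[1+ _ ]        = refl

  private
    almostCommutativeRing : AlmostCommutativeRing c ℓ₁
    almostCommutativeRing = fromCommutativeRing commutativeRing

    morphism : ℤ.+-*-rawRing -Raw-AlmostCommutative⟶ almostCommutativeRing
    morphism = record
      { ⟦_⟧    = coefficient
      ; +-homo = λ i j → trans (coefficient≈int _) (trans (int-+ i j)
                   (sym (+-cong (coefficient≈int i) (coefficient≈int j))))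
      ; *-homo = λ i j → trans (coefficient≈int _) (trans (int-* i j)
                   (sym (*-cong (coefficient≈int i) (coefficient≈int j))))
      ; -‿homo = λ i → trans (coefficient≈int _) (trans (int-neg i) (sym (-‿cong (coefficient≈int i))))
      ; 0-homo = refl
      ; 1-homo = refl
      }

    _≟-coefficient_ : WeaklyDecidable (Induced-equivalence morphism)
    i ≟-coefficient j = Maybe.map (λ eq → reflexive (≡.cong coefficient eq)) (dec⇒maybe (i ℤ.≟ j))

    module Solver = RingSolver ℤ.+-*-rawRing almostCommutativeRing morphism _≟-coefficient_
  open Solver public using (con; _:+_; _:*_; _:-_; :-_)

  infix 4 _:=_
  _:=_ : ∀ {n} → Solver.Polynomial n → Solver.Polynomial n → Solver.Polynomial n × Solver.Polynomial n
  _:=_ = _,_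

  -- The syntactic normal forms are compared: unlike the semantic ones in the solver of the library, they stay small.
  solve : ∀ n (f : N-ary n (Solver.Polynomial n) (Solver.Polynomial n × Solver.Polynomial n)) →
          let e = f $ⁿ Vec.map Solver.var (Vec.allFin n) in
          {_ : T (is-just (Solver.normalise (proj₁ e) Solver.≟N Solver.normalise (proj₂ e)))} →
          Eq n _≈_ (curryⁿ Solver.⟦ proj₁ e ⟧) (curryⁿ Solver.⟦ proj₂ e ⟧)
  solve n f {same} = curryⁿ-cong _≈_ Solver.⟦ proj₁ e ⟧ Solver.⟦ proj₂ e ⟧ λ ρ →
    trans (sym (Solver.correct (proj₁ e) ρ))
      (trans (Solver.⟦ to-witness-T _ same ⟧N-cong ρ) (Solver.correct (proj₂ e) ρ))
    where e = f $ⁿ Vec.map Solver.var (Vec.allFin n)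

  nat-inverse : ∀ n → 0 < n → ∃[ s ] nat n * ι.⟦ s ⟧ ≈ 1#
  nat-inverse n 0<n = ι-inverse (fromℤ (+ n)) λ eq → ℕ.<⇒≢ 0<n (≡.sym (ℤ.+-injective (fromℤ-injective eq)))

  *-∑ : ∀ n x (f : ℕ → Carrier) → x * ∑ n f ≈ ∑ n (λ i → x * f i)
  *-∑ zero    x f = zeroʳ x
  *-∑ (suc n) x f = trans (distribˡ x (f 0) _) (+-congˡ (*-∑ n x (f ∘ suc)))

  ∑-const : ∀ n x → ∑ n (λ _ → x) ≈ nat n * x
  ∑-const zero    x = sym (trans (*-congʳ int-0) (zeroˡ x))
  ∑-const (suc n) x = begin
    x + ∑ n (λ _ → x)      ≈⟨ +-cong (sym (*-identityˡ x)) (∑-const n x) ⟩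
    1# * x + nat n * x     ≈⟨ distribʳ x 1# (nat n) ⟨
    (1# + nat n) * x       ≈⟨ *-congʳ (nat-suc n) ⟨
    nat (suc n) * x        ∎

  1^n≈1 : ∀ n → 1# ^ n ≈ 1#
  1^n≈1 zero    = refl
  1^n≈1 (suc n) = trans (*-identityˡ _) (1^n≈1 n)

  ∏-^ : ∀ n k (f : ℕ → Carrier) → ∏ n f ^ k ≈ ∏ n (λ i → f i ^ k)
  ∏-^ zero    k f = 1^n≈1 k
  ∏-^ (suc n) k f = trans (^-distrib-* (f 0) _ k) (*-congˡ (∏-^ n k (f ∘ suc)))

  ∏-const : ∀ n x → ∏ n (λ _ → x) ≈ x ^ n
  ∏-const zero    x = refl
  ∏-const (suc n) x = *-congˡ (∏-const n x)

  ∏-≉0 : ∀ n {f : ℕ → Carrier} → (∀ i → i < n → f i ≉ 0#) → ∏ n f ≉ 0#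
  ∏-≉0 zero    f≉0 = 1≉0
  ∏-≉0 (suc n) f≉0 = *-≉0 (f≉0 0 (s≤s z≤n)) (∏-≉0 n λ i i<n → f≉0 (suc i) (s≤s i<n))

  ^-comm : ∀ x m n → (x ^ m) ^ n ≈ (x ^ n) ^ m
  ^-comm x m n = begin
    (x ^ m) ^ n    ≈⟨ ^-assocʳ x m n ⟩
    x ^ (m ℕ.* n)  ≡⟨ ≡.cong (x ^_) (ℕ.*-comm m n) ⟩
    x ^ (n ℕ.* m)  ≈⟨ ^-assocʳ x n m ⟨
    (x ^ n) ^ m    ∎

  geometric : ∀ x n → (1# - x) * ∑ n (x ^_) ≈ 1# - x ^ n
  geometric x zero    = trans (zeroʳ _) (sym (-‿inverseʳ 1#))
  geometric x (suc n) = begin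
    (1# - x) * (1# + ∑ n (λ i → x * x ^ i))   ≈⟨ *-congˡ (+-congˡ (*-∑ n x (x ^_))) ⟨
    (1# - x) * (1# + x * ∑ n (x ^_))          ≈⟨ solve 2 (λ x s → (con (+ 1) :- x) :* (con (+ 1) :+ x :* s) :=
                                                   (con (+ 1) :- x) :+ x :* ((con (+ 1) :- x) :* s)) x _ ⟩
    (1# - x) + x * ((1# - x) * ∑ n (x ^_))    ≈⟨ +-congˡ (*-congˡ (geometric x n)) ⟩
    (1# - x) + x * (1# - x ^ n)               ≈⟨ solve 2 (λ x s → (con (+ 1) :- x) :+ x :* (con (+ 1) :- s) :=
                                                   con (+ 1) :- x :* s) x _ ⟩
    1# - x * x ^ n                            ∎

  geometric-zero : ∀ {x} n → x ^ n ≈ 1# → x ≉ 1# → ∑ n (x ^_) ≈ 0#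
  geometric-zero {x} n xⁿ≈1 x≉1 = *≈0⇒≈0 (λ eq → x≉1 (sym (x-y≈0⇒x≈y eq)))
    (trans (geometric x n) (x≈y⇒x-y≈0 (sym xⁿ≈1)))

find< : ∀ {ℓ} {P : ℕ → Set ℓ} → (∀ i → Dec (P i)) → ∀ n →
        (∃[ i ] i < n × P i) ⊎ (∀ i → i < n → ¬ P i)
find< P? zero = inj₂ λ _ ()
find< P? (suc n) with find< P? n
... | inj₁ (i , i<n , Pi) = inj₁ (i , ℕ.m<n⇒m<1+n i<n , Pi)
... | inj₂ none with P? n
...   | yes Pn = inj₁ (n , ℕ.≤-refl , Pn)
...   | no ¬Pn = inj₂ λ i i<1+n Pi → case-≤ (ℕ.m<1+n⇒m<n∨m≡n i<1+n) Pi
  where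
  case-≤ : ∀ {i} → i < n ⊎ i ≡ n → ¬ _
  case-≤ (inj₁ i<n)    = none _ i<n
  case-≤ (inj₂ ≡.refl) = ¬Pn

-- Roots of unity and polynomial functions.

module _ {c ℓ₁ ℓ₂} (E : Field c ℓ₁ ℓ₂) (ι : Extension ℚ-field E) where
  open FieldProperties E ι
  private module ι = Extension ι

  module FieldTools where

    ∏-zero : ∀ n {f : ℕ → Carrier} k → k < n → f k ≈ 0# → ∏ n f ≈ 0#
    ∏-zero (suc n) zero    _         eq = trans (*-congʳ eq) (zeroˡ _)
    ∏-zero (suc n) (suc k) (s≤s k<n) eq = trans (*-congˡ (∏-zero n k k<n eq)) (zeroʳ _)

    ^-+ : ∀ x m n → x ^ m * x ^ n ≈ x ^ (m ℕ.+ n)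
    ^-+ x m n = sym (^-homo-* x m n)

    module RootOfUnity {n ζ} (isPrimitive : IsPrimitiveRootOfUnity E n ζ) (0<n : 0 < n) where
      ζⁿ≈1 : ζ ^ n ≈ 1#
      ζⁿ≈1 = proj₁ isPrimitive

      ζ^i≉1 : ∀ {i} → 0 < i → i < n → ζ ^ i ≉ 1#
      ζ^i≉1 = proj₂ isPrimitive _

      [ζ^i]ⁿ≈1 : ∀ i → (ζ ^ i) ^ n ≈ 1#
      [ζ^i]ⁿ≈1 i = trans (^-comm ζ i n) (trans (^-congˡ i ζⁿ≈1) (1^n≈1 i))

      ζ≉0 : ζ ≉ 0#
      ζ≉0 eq = 1≉0 (trans (sym ζⁿ≈1) (zero-power n 0<n))
        where
        zero-power : ∀ n → 0 < n → ζ ^ n ≈ 0#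
        zero-power (suc n) _ = trans (*-congʳ eq) (zeroˡ _)

      ζ^i≉ζ^j : ∀ {i j} → i < j → j < n → ζ ^ i ≉ ζ ^ j
      ζ^i≉ζ^j {i} {j} i<j j<n eq = ζ^i≉1 (ℕ.m<n⇒0<n∸m i<j) (ℕ.≤-<-trans (ℕ.m∸n≤m j i) j<n)
        (*-cancelˡ (^-≉0 i ζ≉0) (begin
          ζ ^ i * ζ ^ (j ∸ i)   ≈⟨ ^-+ ζ i (j ∸ i) ⟩
          ζ ^ (i ℕ.+ (j ∸ i))   ≡⟨ ≡.cong (ζ ^_) (ℕ.m+[n∸m]≡n (ℕ.<⇒≤ i<j)) ⟩
          ζ ^ j                 ≈⟨ eq ⟨
          ζ ^ i                 ≈⟨ *-identityʳ _ ⟨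
          ζ ^ i * 1#            ∎))

      -- Otherwise every ∑ₖ (η ζʲ)ᵏ vanishes, but their sum over j is n.
      root-inverse : ∀ {η} → η ^ n ≈ 1# → ∃[ j ] j < n × η * ζ ^ j ≈ 1#
      root-inverse {η} ηⁿ≈1 with find< (λ j → η * ζ ^ j ≟ 1#) n
      ... | inj₁ found = found
      ... | inj₂ none  = contradiction n≈0 (nat≉0 n 0<n)
        where
        n≈0 : nat n ≈ 0#
        n≈0 = begin
          nat n                                          ≈⟨ trans (*-identityʳ _) (*-identityʳ _) ⟨
          nat n * 1# * 1#                                ≈⟨ *-congʳ (∑-const n 1#) ⟨
          ∑ n (λ _ → 1#) * 1#                            ≈⟨ trans (*-comm _ _) (*-congˡ (∑-cong′ n λ j → sym (1^n≈1 j))) ⟩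
          η ^ 0 * ∑ n (λ j → (ζ ^ 0) ^ j)                ≈⟨ ∑-only n (λ k → η ^ k * ∑ n (λ j → (ζ ^ k) ^ j)) 0 0<n
                                                              (λ k k<n k≢0 → trans (*-congˡ (geometric-zero n ([ζ^i]ⁿ≈1 k)
                                                                (ζ^i≉1 (ℕ.n≢0⇒n>0 k≢0) k<n))) (zeroʳ _)) ⟨
          ∑ n (λ k → η ^ k * ∑ n (λ j → (ζ ^ k) ^ j))    ≈⟨ ∑-cong′ n (λ k → *-∑ n (η ^ k) (λ j → (ζ ^ k) ^ j)) ⟩
          ∑ n (λ k → ∑ n (λ j → η ^ k * (ζ ^ k) ^ j))    ≈⟨ ∑-cong′ n (λ k → ∑-cong′ n λ j →
                                                              trans (*-congˡ (^-comm ζ k j)) (sym (^-distrib-* η (ζ ^ j) k))) ⟩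
          ∑ n (λ k → ∑ n (λ j → (η * ζ ^ j) ^ k))        ≈⟨ ∑-comm n n (λ k j → (η * ζ ^ j) ^ k) ⟩
          ∑ n (λ j → ∑ n ((η * ζ ^ j) ^_))               ≈⟨ ∑-zero n (λ j j<n → geometric-zero n
                                                              (trans (^-distrib-* η (ζ ^ j) n)
                                                                (trans (*-cong ηⁿ≈1 ([ζ^i]ⁿ≈1 j)) (*-identityˡ 1#)))
                                                              (none j j<n)) ⟩
          0#                                             ∎

      root : ∀ {η} → η ^ n ≈ 1# → ∃[ j ] η ≈ ζ ^ j
      root {η} ηⁿ≈1 with root-inverse ηⁿ≈1
      ... | j , j<n , eq = n ∸ j , *-cancelˡ (^-≉0 j ζ≉0) (begin
        ζ ^ j * η             ≈⟨ *-comm _ _ ⟩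
        η * ζ ^ j             ≈⟨ eq ⟩
        1#                    ≈⟨ ζⁿ≈1 ⟨
        ζ ^ n                 ≡⟨ ≡.cong (ζ ^_) (ℕ.m+[n∸m]≡n (ℕ.<⇒≤ j<n)) ⟨
        ζ ^ (j ℕ.+ (n ∸ j))   ≈⟨ ^-+ ζ j (n ∸ j) ⟨
        ζ ^ j * ζ ^ (n ∸ j)   ∎)

    -- Inversion of Lagrange resolvents. Summing over k first leaves geometric sums in `s i θ̄ * θ`,
    -- an n-th root of unity, which vanish for 0 < i < m and give n for i = 0. The lengths m and n
    -- are independent because of the two uses: p - 1 powers of τ against the p powers of ζ, and p
    -- powers of σ against the p powers of ω.
    fourier : ∀ {n m} → 0 < m → (s : ℕ → Carrier → Carrier) →
              (∀ i {x y} → s i (x * y) ≈ s i x * s i y) → (∀ x → s 0 x ≈ x) → (∀ i → s i 1# ≈ 1#) →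
              ∀ {θ θ̄} → θ * θ̄ ≈ 1# →
              (∀ i → (s i θ̄ * θ) ^ n ≈ 1#) → (∀ i → 0 < i → i < m → s i θ̄ * θ ≉ 1#) →
              ∀ y → nat n * y ≈ ∑ n (λ k → ∑ m (λ i → s i (y * θ̄ ^ k)) * θ ^ k)
    fourier {n} {m} 0<m s s-* s-0 s-1 {θ} {θ̄} θθ̄≈1 root distinct y = sym (begin
      ∑ n (λ k → ∑ m (λ i → s i (y * θ̄ ^ k)) * θ ^ k)    ≈⟨ ∑-cong′ n (λ k → trans (*-comm _ _) (*-∑ m (θ ^ k) _)) ⟩
      ∑ n (λ k → ∑ m (λ i → θ ^ k * s i (y * θ̄ ^ k)))    ≈⟨ ∑-cong′ n (λ k → ∑-cong′ m (term k)) ⟩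
      ∑ n (λ k → ∑ m (λ i → s i y * (s i θ̄ * θ) ^ k))    ≈⟨ ∑-comm n m _ ⟩
      ∑ m (λ i → ∑ n (λ k → s i y * (s i θ̄ * θ) ^ k))    ≈⟨ ∑-cong′ m (λ i → *-∑ n (s i y) _) ⟨
      ∑ m (λ i → s i y * ∑ n ((s i θ̄ * θ) ^_))           ≈⟨ ∑-only m _ 0 0<m (λ i i<m i≢0 →
                                                              trans (*-congˡ (geometric-zero n (root i)
                                                                (distinct i (ℕ.n≢0⇒n>0 i≢0) i<m))) (zeroʳ _)) ⟩
      s 0 y * ∑ n ((s 0 θ̄ * θ) ^_)                       ≈⟨ *-cong (s-0 y) (trans (∑-cong′ n λ k →
                                                              trans (^-congˡ k (trans (*-congʳ (s-0 θ̄)) (trans (*-comm _ _) θθ̄≈1)))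
                                                                (1^n≈1 k)) (∑-const n 1#)) ⟩
      y * (nat n * 1#)                                   ≈⟨ trans (*-comm _ _) (*-congʳ (*-identityʳ _)) ⟩
      nat n * y                                          ∎)
      where
      s-^ : ∀ i x k → s i (x ^ k) ≈ s i x ^ k
      s-^ i x zero    = s-1 i
      s-^ i x (suc k) = trans (s-* i) (*-congˡ (s-^ i x k))
      term : ∀ k i → θ ^ k * s i (y * θ̄ ^ k) ≈ s i y * (s i θ̄ * θ) ^ k
      term k i = begin
        θ ^ k * s i (y * θ̄ ^ k)          ≈⟨ *-congˡ (trans (s-* i) (*-congˡ (s-^ i θ̄ k))) ⟩
        θ ^ k * (s i y * s i θ̄ ^ k)      ≈⟨ solve 3 (λ a b c → a :* (b :* c) := b :* (c :* a)) _ _ _ ⟩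
        s i y * (s i θ̄ ^ k * θ ^ k)      ≈⟨ *-congˡ (^-distrib-* (s i θ̄) θ k) ⟨
        s i y * (s i θ̄ * θ) ^ k          ∎

    -- f is a polynomial function of degree < n, written in Horner form.
    Poly : ℕ → (Carrier → Carrier) → Set (c ⊔ ℓ₁)
    Poly zero    f = ∀ t → f t ≈ 0#
    Poly (suc n) f = ∃[ a ] ∃[ g ] Poly n g × (∀ t → f t ≈ a + t * g t)

    poly-resp : ∀ n {f g} → (∀ t → f t ≈ g t) → Poly n f → Poly n g
    poly-resp zero    f≈g p               = λ t → trans (sym (f≈g t)) (p t)
    poly-resp (suc n) f≈g (a , h , p , q) = a , h , p , λ t → trans (sym (f≈g t)) (q t)

    poly-+ : ∀ n {f g} → Poly n f → Poly n g → Poly n (λ t → f t + g t)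
    poly-+ zero    p q = λ t → trans (+-cong (p t) (q t)) (+-identityˡ 0#)
    poly-+ (suc n) (a , f , p , eq) (b , g , q , eq′) = a + b , _ , poly-+ n p q , λ t → trans (+-cong (eq t) (eq′ t))
      (solve 5 (λ a b t f g → (a :+ t :* f) :+ (b :+ t :* g) := (a :+ b) :+ t :* (f :+ g)) a b t (f t) (g t))

    poly-*ˡ : ∀ n {f} b → Poly n f → Poly n (λ t → b * f t)
    poly-*ˡ zero    b p = λ t → trans (*-congˡ (p t)) (zeroʳ b)
    poly-*ˡ (suc n) b (a , f , p , eq) = b * a , _ , poly-*ˡ n b p , λ t → trans (*-congˡ (eq t))
      (solve 4 (λ a b t f → b :* (a :+ t :* f) := b :* a :+ t :* (b :* f)) a b t (f t))

    poly-shift : ∀ n {f} → Poly n f → Poly (suc n) (λ t → t * f t)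
    poly-shift n {f} p = 0# , f , p , λ t → sym (+-identityˡ _)

    poly-weaken : ∀ n {f} → Poly n f → Poly (suc n) f
    poly-weaken zero    {f} p = 0# , (λ _ → 0#) , (λ _ → refl) , λ t →
      trans (p t) (sym (trans (+-identityˡ _) (zeroʳ t)))
    poly-weaken (suc n) (a , f , p , eq) = a , f , poly-weaken n p , eq

    poly-constant : ∀ n a → Poly (suc n) (λ _ → a)
    poly-constant zero    a = a , (λ _ → 0#) , (λ _ → refl) , λ t → sym (trans (+-congˡ (zeroʳ t)) (+-identityʳ a))
    poly-constant (suc n) a = poly-weaken (suc n) (poly-constant n a)

    poly-- : ∀ n {f g} → Poly n f → Poly n g → Poly n (λ t → f t - g t)
    poly-- n {f} {g} p q = poly-resp n (λ t → solve 2 (λ f g → f :+ (:- con (+ 1)) :* g := f :- g) (f t) (g t))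
      (poly-+ n p (poly-*ˡ n (- 1#) q))

    poly-∏ : ∀ n (a : ℕ → Carrier) → Poly (suc n) (λ t → ∏ n (λ i → 1# - t * a i))
    poly-∏ zero    a = poly-constant 0 1#
    poly-∏ (suc n) a = poly-resp (suc (suc n))
      (λ t → solve 3 (λ t a f → f :- a :* (t :* f) := (con (+ 1) :- t :* a) :* f) t (a 0) _)
      (poly-- (suc (suc n)) (poly-weaken (suc n) p) (poly-*ˡ (suc (suc n)) (a 0) (poly-shift (suc n) p)))
      where p = poly-∏ n (a ∘ suc)

    poly-geometric : ∀ n → Poly n (λ t → ∑ n (t ^_))
    poly-geometric zero    = λ _ → refl
    poly-geometric (suc n) = 1# , _ , poly-geometric n , λ t → +-congˡ (sym (*-∑ n t (t ^_)))

    poly-^ : ∀ n → Poly (suc n) (_^ n)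
    poly-^ zero    = poly-constant 0 1#
    poly-^ (suc n) = poly-shift (suc n) (poly-^ n)

    poly-factor : ∀ n {f} → Poly (suc n) f → ∀ r → ∃[ g ] Poly n g × (∀ t → f t ≈ f r + (t - r) * g t)
    poly-factor zero {f} (a , g , p , eq) r = (λ _ → 0#) , (λ _ → refl) , λ t → begin
      f t                    ≈⟨ eq t ⟩
      a + t * g t            ≈⟨ +-congˡ (trans (*-congˡ (p t)) (trans (zeroʳ t) (sym (trans (*-congˡ (p r)) (zeroʳ r))))) ⟩
      a + r * g r            ≈⟨ eq r ⟨
      f r                    ≈⟨ trans (+-congˡ (zeroʳ _)) (+-identityʳ _) ⟨
      f r + (t - r) * 0#     ∎
    poly-factor (suc n) {f} (a , g , p , eq) r with poly-factor n p r
    ... | h , q , eq′ = _ , (g r , h , q , λ _ → refl) , λ t → begin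
      f t                                               ≈⟨ trans (eq t) (+-congˡ (*-congˡ (eq′ t))) ⟩
      a + t * (g r + (t - r) * h t)                     ≈⟨ solve 5 (λ a t r g h → a :+ t :* (g :+ (t :- r) :* h) :=
                                                             (a :+ r :* g) :+ (t :- r) :* (g :+ t :* h)) a t r (g r) (h t) ⟩
      (a + r * g r) + (t - r) * (g r + t * h t)         ≈⟨ +-congʳ (eq r) ⟨
      f r + (t - r) * (g r + t * h t)                   ∎

    poly-vanishes : ∀ n {f} → Poly n f → (r : ℕ → Carrier) → (∀ {i j} → i < j → j < n → r i ≉ r j) →
                    (∀ i → i < n → f (r i) ≈ 0#) → ∀ t → f t ≈ 0#
    poly-vanishes zero    p r distinct zeros t = p t
    poly-vanishes (suc n) {f} p r distinct zeros t with poly-factor n p (r 0)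
    ... | g , q , eq = trans (eq′ t) (trans (*-congˡ (g≈0 t)) (zeroʳ _))
      where
      eq′ : ∀ t → f t ≈ (t - r 0) * g t
      eq′ t = trans (eq t) (trans (+-congʳ (zeros 0 (s≤s z≤n))) (+-identityˡ _))
      g≈0 : ∀ t → g t ≈ 0#
      g≈0 = poly-vanishes n q (r ∘ suc) (λ i<j j<n → distinct (s≤s i<j) (s≤s j<n)) λ i i<n →
        *≈0⇒≈0 (λ e → distinct (s≤s z≤n) (s≤s i<n) (sym (x-y≈0⇒x≈y e)))
               (trans (sym (eq′ (r (suc i)))) (zeros (suc i) (s≤s i<n)))

    module Cyclotomic {n ζ} (isPrimitive : IsPrimitiveRootOfUnity E (suc n) ζ) where
      open RootOfUnity isPrimitive (s≤s z≤n)

      -- Both sides have degree at most n + 1 in t and agree at the n + 2 points 0, 1, ζ, ..., ζⁿ.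
      -- At t = ζⁱ the vanishing factor is the one whose exponent k completes i to a multiple of n +
      -- 1.
      ∏[1-tζᵏ] : ∀ t → ∏ (suc n) (λ k → 1# - t * ζ ^ k) ≈ 1# - t ^ suc n
      ∏[1-tζᵏ] t = x-y≈0⇒x≈y (poly-vanishes (suc (suc n))
        (poly-- (suc (suc n)) (poly-∏ (suc n) (ζ ^_)) (poly-- (suc (suc n)) (poly-constant (suc n) 1#) (poly-^ (suc n))))
        r distinct (λ i i≤n → x≈y⇒x-y≈0 (zeros i i≤n)) t)
        where
        r : ℕ → Carrier
        r zero    = 0#
        r (suc i) = ζ ^ i
        distinct : ∀ {i j} → i < j → j < suc (suc n) → r i ≉ r j
        distinct {zero}  {suc j} _         _         eq = ^-≉0 j ζ≉0 (sym eq)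
        distinct {suc i} {suc j} (s≤s i<j) (s≤s j<n) eq = ζ^i≉ζ^j i<j j<n eq
        factor : ∀ i j → i ℕ.+ j ≡ suc n → 1# - ζ ^ i * ζ ^ j ≈ 0#
        factor i j eq = x≈y⇒x-y≈0 (sym (trans (^-+ ζ i j) (trans (reflexive (≡.cong (ζ ^_) eq)) ζⁿ≈1)))
        zeros : ∀ i → i < suc (suc n) → ∏ (suc n) (λ k → 1# - r i * ζ ^ k) ≈ 1# - r i ^ suc n
        zeros zero _ = begin
          ∏ (suc n) (λ k → 1# - 0# * ζ ^ k)   ≈⟨ ∏-one (suc n) (λ k _ → trans (+-congˡ (-‿cong (zeroˡ (ζ ^ k)))) (x-0≈x 1#)) ⟩
          1#                                  ≈⟨ trans (+-congˡ (-‿cong (zeroˡ _))) (x-0≈x 1#) ⟨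
          1# - 0# * 0# ^ n                    ∎
        zeros (suc i) (s≤s i<1+n) = trans (vanish i i<1+n) (sym (x≈y⇒x-y≈0 (sym ([ζ^i]ⁿ≈1 i))))
          where
          vanish : ∀ i → i < suc n → ∏ (suc n) (λ k → 1# - ζ ^ i * ζ ^ k) ≈ 0#
          vanish zero    _     = ∏-zero (suc n) {λ k → 1# - 1# * ζ ^ k} 0 (s≤s z≤n) (x≈y⇒x-y≈0 (sym (*-identityˡ 1#)))
          vanish (suc i) i<1+n = ∏-zero (suc n) {λ k → 1# - ζ ^ suc i * ζ ^ k} (n ∸ i) (s≤s (ℕ.m∸n≤m n i))
            (factor (suc i) (n ∸ i) (≡.cong suc (ℕ.m+[n∸m]≡n (ℕ.≤-trans (ℕ.n≤1+n i) (ℕ.≤-pred i<1+n)))))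

      -- Both sides times 1 - t are 1 - t^(n+1), so they agree at n + 1 points t ≠ 1.
      ∏[1-ζᵏ] : ∏ n (λ k → 1# - ζ ^ suc k) ≈ nat (suc n)
      ∏[1-ζᵏ] = begin
        ∏ n (λ k → 1# - ζ ^ suc k)         ≈⟨ ∏-cong′ n (λ k → +-congˡ (-‿cong (*-identityˡ _))) ⟨
        ∏ n (λ k → 1# - 1# * ζ ^ suc k)    ≈⟨ x-y≈0⇒x≈y (poly-vanishes (suc n) (poly-- (suc n) (poly-∏ n ((ζ ^_) ∘ suc))
                                                (poly-geometric (suc n))) r distinct (λ i _ → x≈y⇒x-y≈0 (agree i)) 1#) ⟩
        ∑ (suc n) (1# ^_)                  ≈⟨ ∑-cong′ (suc n) 1^n≈1 ⟩
        ∑ (suc n) (λ _ → 1#)               ≈⟨ trans (∑-const (suc n) 1#) (*-identityʳ _) ⟩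
        nat (suc n)                        ∎
        where
        r : ℕ → Carrier
        r i = nat (suc (suc i))
        distinct : ∀ {i j} → i < j → j < suc n → r i ≉ r j
        distinct i<j _ eq = ℕ.<⇒≢ i<j (ℕ.suc-injective (ℕ.suc-injective (nat-injective eq)))
        agree : ∀ i → ∏ n (λ k → 1# - r i * ζ ^ suc k) ≈ ∑ (suc n) (r i ^_)
        agree i = *-cancelˡ (λ e → contradiction (nat-injective (trans (sym (x-y≈0⇒x≈y e)) (sym int-1))) λ ()) (begin
          (1# - r i) * ∏ n (λ k → 1# - r i * ζ ^ suc k)   ≈⟨ *-congʳ (+-congˡ (-‿cong (*-identityʳ _))) ⟨
          ∏ (suc n) (λ k → 1# - r i * ζ ^ k)              ≈⟨ ∏[1-tζᵏ] (r i) ⟩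
          1# - r i ^ suc n                                ≈⟨ geometric (r i) (suc n) ⟨
          (1# - r i) * ∑ (suc n) (r i ^_)                 ∎) 

  module Rationals where

    -- Clearing the denominator reduces this to integers. It identifies the copy of ℚ that L
    -- receives through K with the one received through F, which is the copy used everywhere.
    ℚ-embedding-unique : (ψ : Extension ℚ-field E) → ∀ r → Extension.⟦_⟧ ψ r ≈ ι.⟦ r ⟧
    ℚ-embedding-unique ψ r@record{} = *-cancelˡ (nat≉0 (ℚ.↧ₙ r) (s≤s z≤n)) (begin
      nat (ℚ.↧ₙ r) * ψ.⟦ r ⟧         ≈⟨ *-congʳ (ψ-int (ℚ.↧ r)) ⟨
      ψ.⟦ fromℤ (ℚ.↧ r) ⟧ * ψ.⟦ r ⟧  ≈⟨ ψ.*-homo _ _ ⟨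
      ψ.⟦ fromℤ (ℚ.↧ r) ℚ.* r ⟧      ≈⟨ ψ.⟦⟧-cong (↧*≡↥ r) ⟩
      ψ.⟦ fromℤ (ℚ.↥ r) ⟧            ≈⟨ ψ-int (ℚ.↥ r) ⟩
      ι.⟦ fromℤ (ℚ.↥ r) ⟧            ≈⟨ ι.⟦⟧-cong (↧*≡↥ r) ⟨
      ι.⟦ fromℤ (ℚ.↧ r) ℚ.* r ⟧      ≈⟨ ι.*-homo _ _ ⟩
      nat (ℚ.↧ₙ r) * ι.⟦ r ⟧         ∎)
      where
      module ψ = Extension ψ
      module Ψ = FieldProperties E ψ
      ψ-nat : ∀ n → Ψ.nat n ≈ nat n
      ψ-nat zero    = trans Ψ.int-0 (sym int-0)
      ψ-nat (suc n) = trans (Ψ.nat-suc n) (trans (+-congˡ (ψ-nat n)) (sym (nat-suc n)))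
      ψ-int : ∀ i → Ψ.int i ≈ int i
      ψ-int (+ n)    = ψ-nat n
      ψ-int -[1+ n ] = trans (Ψ.int-neg (+ suc n)) (trans (-‿cong (ψ-nat (suc n))) (sym (int-neg (+ suc n))))

  -- Linear equations and independence of characters.

  module LinearAlgebra where
    private module S = SemiringSum semiring

    -- Gaussian elimination: a nonzero entry of the first row eliminates its column.
    nontrivial-kernel : ∀ {m n} → m < n → (A : Fin m → Fin n → Carrier) →
      Σ[ x ∈ Vector Carrier n ] (∃[ j ] x j ≉ 0#) × (∀ i → sum (λ j → A i j * x j) ≈ 0#)
    nontrivial-kernel {zero}  {suc n} _ A = (λ _ → 1#) , (Fin.zero , 1≉0) , λ ()
    nontrivial-kernel {suc m} {suc n} (s≤s m<n) A with Fin.any? (λ j → ¬? (A Fin.zero j ≟ 0#))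
    ... | no zero-row with nontrivial-kernel {m} {suc n} (ℕ.m<n⇒m<1+n m<n) (A ∘ Fin.suc)
    ...   | x , x≉0 , eq = x , x≉0 , λ where
        Fin.zero    → trans (S.sum-cong-≋ λ j → trans (*-congʳ (row j)) (zeroˡ (x j))) (S.sum-replicate-zero (suc n))
        (Fin.suc i) → eq i
      where
      row : ∀ j → A Fin.zero j ≈ 0#
      row j with A Fin.zero j ≟ 0#
      ... | yes eq = eq
      ... | no  ≉0 = contradiction (j , ≉0) zero-row
    nontrivial-kernel {suc m} {suc n} (s≤s m<n) A | yes (k , pivot≉0) = solution
      where
      a⁻¹ : Carrier
      a⁻¹ = proj₁ (inverse pivot≉0)
      ratio : Fin n → Carrier
      ratio j = a⁻¹ * A Fin.zero (punchIn k j)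
      B : Fin m → Fin n → Carrier
      B i j = A (Fin.suc i) (punchIn k j) - A (Fin.suc i) k * ratio j
      module _ (y : Vector Carrier n) where
        v : Carrier
        v = - sum (λ j → ratio j * y j)
        x : Vector Carrier (suc n)
        x = insertAt y k v
        expand : ∀ i → sum (λ j → A i j * x j) ≈ A i k * v + sum (λ j → A i (punchIn k j) * y j)
        expand i = trans (S.sum-remove {i = k} (λ j → A i j * x j)) (+-cong
          (*-congˡ (reflexive (Vector.insertAt-lookup y k v)))
          (S.sum-cong-≋ λ j → *-congˡ (reflexive (Vector.insertAt-punchIn y k v j))))
        sum-- : ∀ (f g : Fin n → Carrier) → sum (λ j → f j - g j) ≈ sum f - sum g
        sum-- f g = trans (S.∑-distrib-+ f (λ j → - g j)) (+-congˡ
          (trans (S.sum-cong-≋ λ j → solve 1 (λ g → :- g := con (-[1+ 0 ]) :* g) (g j))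
          (trans (sym (S.*-distribˡ-sum _ g)) (solve 1 (λ g → con (-[1+ 0 ]) :* g := :- g) _))))
        first : sum (λ j → A Fin.zero j * x j) ≈ 0#
        first = begin
          sum (λ j → A Fin.zero j * x j)                              ≈⟨ expand Fin.zero ⟩
          A Fin.zero k * v + sum (λ j → A Fin.zero (punchIn k j) * y j)
            ≈⟨ +-congˡ (S.sum-cong-≋ λ j → trans (sym (*-identityˡ _)) (trans (*-congʳ (sym (proj₂ (inverse pivot≉0))))
                 (solve 4 (λ a b c y → (a :* b) :* (c :* y) := a :* ((b :* c) :* y)) (A Fin.zero k) a⁻¹ _ (y j)))) ⟩
          A Fin.zero k * v + sum (λ j → A Fin.zero k * (ratio j * y j)) ≈⟨ +-congˡ (sym (S.*-distribˡ-sum {n} _ (λ j → ratio j * y j))) ⟩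
          A Fin.zero k * v + A Fin.zero k * sum (λ j → ratio j * y j) ≈⟨ solve 2 (λ a s → a :* (:- s) :+ a :* s := con (+ 0)) _ _ ⟩
          0#                                                          ∎
        rest : ∀ i → sum (λ j → A (Fin.suc i) j * x j) ≈ sum (λ j → B i j * y j)
        rest i = begin
          sum (λ j → A (Fin.suc i) j * x j)                                      ≈⟨ expand (Fin.suc i) ⟩
          b * v + sum (λ j → A (Fin.suc i) (punchIn k j) * y j)                  ≈⟨ solve 3 (λ b s t → b :* (:- s) :+ t := t :- b :* s) _ _ _ ⟩
          sum (λ j → A (Fin.suc i) (punchIn k j) * y j) - b * sum (λ j → ratio j * y j)
            ≈⟨ +-congˡ (-‿cong (S.*-distribˡ-sum {n} b (λ j → ratio j * y j))) ⟩
          sum (λ j → A (Fin.suc i) (punchIn k j) * y j) - sum (λ j → b * (ratio j * y j))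
            ≈⟨ sum-- _ _ ⟨
          sum (λ j → A (Fin.suc i) (punchIn k j) * y j - b * (ratio j * y j))
            ≈⟨ S.sum-cong-≋ (λ j → solve 4 (λ a b r y → a :* y :- b :* (r :* y) := (a :- b :* r) :* y) _ b (ratio j) (y j)) ⟩
          sum (λ j → B i j * y j)                                                ∎
          where b = A (Fin.suc i) k
      solution : Σ[ x ∈ Vector Carrier (suc n) ] (∃[ j ] x j ≉ 0#) × (∀ i → sum (λ j → A i j * x j) ≈ 0#)
      solution with nontrivial-kernel m<n B
      ... | y , (j , yj≉0) , eq = x y , (punchIn k j , λ e → yj≉0 (trans (reflexive (≡.sym (Vector.insertAt-punchIn y k (v y) j))) e)) ,
        λ where
          Fin.zero    → first y
          (Fin.suc i) → trans (rest y i) (eq i)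

    -- Artin's argument: subtracting χₙ(y) times the relation at x from the relation at y · x kills
    -- the last term, and induction applies to the shorter relation with coefficients aᵢ (χᵢ(y) -
    -- χₙ(y)). For each i < n some y makes the second factor nonzero.
    characters-independent : ∀ {d} {D : Set d} (_·_ : D → D → D) (1ᴰ : D) →
      ∀ n (χ : ℕ → D → Carrier) → (∀ i x y → χ i (x · y) ≈ χ i x * χ i y) → (∀ i → χ i 1ᴰ ≈ 1#) →
      (∀ {i j} → i < j → j < n → ∃[ y ] χ i y ≉ χ j y) →
      ∀ a → (∀ x → ∑ n (λ i → a i * χ i x) ≈ 0#) → ∀ i → i < n → a i ≈ 0#
    characters-independent _·_ 1ᴰ zero    χ χ-* χ-1 distinct a rel i ()
    characters-independent _·_ 1ᴰ (suc n) χ χ-* χ-1 distinct a rel = λ i i<1+n → cases (ℕ.m<1+n⇒m<n∨m≡n i<1+n)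
      where
      rel′ : ∀ y x → ∑ n (λ i → a i * (χ i y - χ n y) * χ i x) ≈ 0#
      rel′ y x = begin
        ∑ n (λ i → a i * (χ i y - χ n y) * χ i x)                  ≈⟨ +-identityʳ _ ⟨
        -- The term of index n is zero, so it may be appended, and then the full relation of length
        -- `suc n` can be applied.
        ∑ n (λ i → a i * (χ i y - χ n y) * χ i x) + 0#
          ≈⟨ +-congˡ (solve 3 (λ a u v → a :* (u :- u) :* v := con (+ 0)) (a n) (χ n y) (χ n x)) ⟨
        ∑ n (λ i → a i * (χ i y - χ n y) * χ i x) + a n * (χ n y - χ n y) * χ n x
          ≈⟨ ∑-last n (λ i → a i * (χ i y - χ n y) * χ i x) ⟨
        ∑ (suc n) (λ i → a i * (χ i y - χ n y) * χ i x)            ≈⟨ ∑-cong′ (suc n) (λ i → trans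
          (solve 4 (λ a u v w → a :* (u :- v) :* w := a :* (u :* w) :+ (:- v) :* (a :* w)) (a i) (χ i y) (χ n y) (χ i x))
          (+-congʳ (*-congˡ (sym (χ-* i y x))))) ⟩
        ∑ (suc n) (λ i → a i * χ i (y · x) + - χ n y * (a i * χ i x))  ≈⟨ ∑-+ (suc n) (λ i → a i * χ i (y · x)) (λ i → - χ n y * (a i * χ i x)) ⟩
        ∑ (suc n) (λ i → a i * χ i (y · x)) + ∑ (suc n) (λ i → - χ n y * (a i * χ i x))
          ≈⟨ +-cong (rel (y · x)) (trans (sym (*-∑ (suc n) (- χ n y) (λ i → a i * χ i x))) (trans (*-congˡ (rel x)) (zeroʳ _))) ⟩
        0# + 0#                                                    ≈⟨ +-identityˡ 0# ⟩
        0#                                                         ∎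
      init : ∀ i → i < n → a i ≈ 0#
      init i i<n with distinct i<n ℕ.≤-refl
      ... | y , χy≉ = *≈0⇒≈0 (λ e → χy≉ (x-y≈0⇒x≈y e)) (trans (*-comm _ _)
        (characters-independent _·_ 1ᴰ n χ χ-* χ-1 (λ i<j j<n → distinct i<j (ℕ.m<n⇒m<1+n j<n))
          (λ i → a i * (χ i y - χ n y)) (rel′ y) i i<n))
      last : a n ≈ 0#
      last = begin
        a n                                       ≈⟨ trans (*-congˡ (χ-1 n)) (*-identityʳ _) ⟨
        a n * χ n 1ᴰ                              ≈⟨ +-identityˡ _ ⟨
        0# + a n * χ n 1ᴰ                         ≈⟨ +-congʳ (∑-zero n (λ i i<n → trans (*-congʳ (init i i<n)) (zeroˡ _))) ⟨
        ∑ n (λ i → a i * χ i 1ᴰ) + a n * χ n 1ᴰ   ≈⟨ ∑-last n (λ i → a i * χ i 1ᴰ) ⟨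
        ∑ (suc n) (λ i → a i * χ i 1ᴰ)            ≈⟨ rel 1ᴰ ⟩
        0#                                        ∎
      cases : ∀ {i} → i < n ⊎ i ≡ n → a i ≈ 0#
      cases (inj₁ i<n)    = init _ i<n
      cases (inj₂ ≡.refl) = last 

extend : ∀ {a} {A : Set a} {n} → A → Vector A n → ℕ → A
extend {n = zero}  z x i       = z
extend {n = suc n} z x zero    = x Fin.zero
extend {n = suc n} z x (suc i) = extend z (x ∘ Fin.suc) i

extend-toℕ : ∀ {a} {A : Set a} {n} z (x : Vector A n) j → extend z x (toℕ j) ≡ x j
extend-toℕ z x Fin.zero    = ≡.refl
extend-toℕ z x (Fin.suc j) = extend-toℕ z (x ∘ Fin.suc) j

-- Homomorphisms of fields over ℚ.

module Embedding {a a₁ a₂ b b₁ b₂} {A : Field a a₁ a₂} {B : Field b b₁ b₂}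
  (ιA : Extension ℚ-field A) (ιB : Extension ℚ-field B) (φ : Extension A B) where
  private
    module A = FieldProperties A ιA
    module φ = Extension φ
  open FieldProperties B ιB
  open Rationals B ιB

  hom-ι : ∀ r → φ.⟦ Extension.⟦_⟧ ιA r ⟧ ≈ Extension.⟦_⟧ ιB r
  hom-ι = ℚ-embedding-unique (φ ∘ₑ ιA)

  hom-int : ∀ i → φ.⟦ A.int i ⟧ ≈ int i
  hom-int i = hom-ι (fromℤ i)

  hom-sum : ∀ {n} (f : Vector A.Carrier n) → φ.⟦ A.sum f ⟧ ≈ sum (λ i → φ.⟦ f i ⟧)
  hom-sum {zero}  f = φ.0#-homo
  hom-sum {suc n} f = trans (φ.+-homo _ _) (+-congˡ (hom-sum (f ∘ Fin.suc)))

  hom-∑ : ∀ n (f : ℕ → A.Carrier) → φ.⟦ A.∑ n f ⟧ ≈ ∑ n (λ i → φ.⟦ f i ⟧)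
  hom-∑ zero    f = φ.0#-homo
  hom-∑ (suc n) f = trans (φ.+-homo _ _) (+-congˡ (hom-∑ n (f ∘ suc)))

  hom-∏ : ∀ n (f : ℕ → A.Carrier) → φ.⟦ A.∏ n f ⟧ ≈ ∏ n (λ i → φ.⟦ f i ⟧)
  hom-∏ zero    f = φ.1#-homo
  hom-∏ (suc n) f = trans (φ.*-homo _ _) (*-congˡ (hom-∏ n (f ∘ suc)))

  hom-^ : ∀ x n → φ.⟦ x A.^ n ⟧ ≈ φ.⟦ x ⟧ ^ n
  hom-^ x zero    = φ.1#-homo
  hom-^ x (suc n) = trans (φ.*-homo _ _) (*-congˡ (hom-^ x n))

  hom-≉0 : ∀ {x} → x A.≉ A.0# → φ.⟦ x ⟧ ≉ 0#
  hom-≉0 x≉0 with A.inverse x≉0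
  ... | y , xy≈1 = invertible⇒≉0 (trans (sym (φ.*-homo _ y)) (trans (φ.⟦⟧-cong xy≈1) φ.1#-homo))

  hom-- : ∀ x y → φ.⟦ x A.- y ⟧ ≈ φ.⟦ x ⟧ - φ.⟦ y ⟧
  hom-- x y = trans (φ.+-homo x (A.- y)) (+-congˡ (φ.-‿homo y))

  hom-injective : ∀ {x y} → φ.⟦ x ⟧ ≈ φ.⟦ y ⟧ → x A.≈ y
  hom-injective {x} {y} eq with x A.≟ y
  ... | yes x≈y = x≈y
  ... | no  x≉y = contradiction (trans (hom-- x y) (x≈y⇒x-y≈0 eq)) (hom-≉0 (x≉y ∘ A.x-y≈0⇒x≈y))

idₑ : ∀ {a a₁ a₂} {A : Field a a₁ a₂} → Extension A A
idₑ {A = A} = record { homomorphism = record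
  { isRingHomomorphism = Identity.isRingHomomorphism (Field.rawRing A) (Field.refl A) } }

infixr 8 _^ₑ_
_^ₑ_ : ∀ {a a₁ a₂} {A : Field a a₁ a₂} → Extension A A → ℕ → Extension A A
φ ^ₑ zero  = idₑ
φ ^ₑ suc n = φ ∘ₑ (φ ^ₑ n)

^ₑ-fold : ∀ {a a₁ a₂} {A : Field a a₁ a₂} (φ : Extension A A) n x →
          Extension.⟦_⟧ (φ ^ₑ n) x ≡ fold x (Extension.⟦_⟧ φ) n
^ₑ-fold φ zero    x = ≡.refl
^ₑ-fold φ (suc n) x = ≡.cong (Extension.⟦_⟧ φ) (^ₑ-fold φ n x)

^ₑ-+ : ∀ {a a₁ a₂} {A : Field a a₁ a₂} (φ : Extension A A) m n x →
       Extension.⟦_⟧ (φ ^ₑ (m ℕ.+ n)) x ≡ Extension.⟦_⟧ (φ ^ₑ m) (Extension.⟦_⟧ (φ ^ₑ n) x)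
^ₑ-+ φ zero    n x = ≡.refl
^ₑ-+ φ (suc m) n x = ≡.cong (Extension.⟦_⟧ φ) (^ₑ-+ φ m n x)

gal⇒ₑ : ∀ {a a₁ a₂ b b₁ b₂} {k : Field a a₁ a₂} {E : Field b b₁ b₂} {φ : Extension k E} → Gal φ → Extension E E
gal⇒ₑ σ = record { homomorphism = record
  { isRingHomomorphism = IsRingIsomorphism.isRingHomomorphism (Gal.isRingIsomorphism σ) } }

-- The number of embeddings of a field of degree p.

module Coincidence {a a₁ a₂ b b₁ b₂} {F : Field a a₁ a₂} {E : Field b b₁ b₂}
  (ιF : Extension ℚ-field F) (ι : Extension ℚ-field E) {p} (B : Basis ιF p) where
  private
    module F = FieldProperties F ιF
    module B = Basis B
    module S = SemiringSum (Field.semiring E)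
    module ι = Extension ι
  open FieldProperties E ι
  open LinearAlgebra E ι

  Agree : (φ ψ : Extension F E) → Set _
  Agree φ ψ = ∀ x → Extension.⟦_⟧ φ x ≈ Extension.⟦_⟧ ψ x

  expand : ∀ (φ : Extension F E) y → Extension.⟦_⟧ φ y ≈
           sum (λ k → ι.⟦ proj₁ (B.spanning y) k ⟧ * Extension.⟦_⟧ φ (B.basis k))
  expand φ y = trans (φ.⟦⟧-cong (proj₂ (B.spanning y))) (trans (hom-sum {p} (λ k → Extension.⟦_⟧ ιF (c k) F.* B.basis k))
    (S.sum-cong-≋ {p} λ k → trans (φ.*-homo _ _) (*-congʳ (hom-ι (c k)))))
    where
    c : Fin p → ℚ
    c = proj₁ (B.spanning y)
    module φ = Extension φ
    open Embedding ιF ι φ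

  coincide-on-basis : (φ ψ : Extension F E) → (∀ k → Extension.⟦_⟧ φ (B.basis k) ≈ Extension.⟦_⟧ ψ (B.basis k)) →
                      Agree φ ψ
  coincide-on-basis φ ψ eq x = trans (expand φ x) (trans (S.sum-cong-≋ {p} λ k → *-congˡ (eq k)) (sym (expand ψ x)))

  -- It is enough to test the finitely many basis vectors, and one on which the embeddings differ is
  -- the explicit witness that `characters-independent` asks for.
  coincide? : (φ ψ : Extension F E) → Agree φ ψ ⊎ (∃[ x ] Extension.⟦_⟧ φ x ≉ Extension.⟦_⟧ ψ x)
  coincide? φ ψ with Fin.any? (λ k → ¬? (Extension.⟦_⟧ φ (B.basis k) ≟ Extension.⟦_⟧ ψ (B.basis k)))
  ... | yes (k , ≉) = inj₂ (B.basis k , ≉)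
  ... | no none     = inj₁ (coincide-on-basis φ ψ agree)
    where
    agree : ∀ k → Extension.⟦_⟧ φ (B.basis k) ≈ Extension.⟦_⟧ ψ (B.basis k)
    agree k with Extension.⟦_⟧ φ (B.basis k) ≟ Extension.⟦_⟧ ψ (B.basis k)
    ... | yes eq = eq
    ... | no  ≉  = contradiction (k , ≉) none

  agree? : ∀ φ ψ → Dec (Agree φ ψ)
  agree? φ ψ with coincide? φ ψ
  ... | inj₁ eq      = yes eq
  ... | inj₂ (x , ≉) = no λ eq → ≉ (eq x)

  module _ (χ : ℕ → Extension F E) where
    Repeats : ℕ → Set _
    Repeats j = ∃[ i ] i < j × Agree (χ i) (χ j)

    repeats? : ∀ j → Dec (Repeats j)
    repeats? j with find< (λ i → agree? (χ i) (χ j)) j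
    ... | inj₁ found = yes found
    ... | inj₂ none  = no λ (i , i<j , eq) → none i i<j eq

    χb : Fin p → Fin (suc p) → Carrier
    χb k i = Extension.⟦_⟧ (χ (toℕ i)) (B.basis k)

    relation : (x : Vector Carrier (suc p)) → (∀ k → sum (λ i → χb k i * x i) ≈ 0#) →
               ∀ y → ∑ (suc p) (λ i → extend 0# x i * Extension.⟦_⟧ (χ i) y) ≈ 0#
    relation x kernel y = begin
      ∑ (suc p) (λ i → extend 0# x i * Extension.⟦_⟧ (χ i) y)            ≡⟨ ∑≡sum (suc p) (λ i → extend 0# x i * Extension.⟦_⟧ (χ i) y) ⟩
      sum {suc p} (λ i → extend 0# x (toℕ i) * Extension.⟦_⟧ (χ (toℕ i)) y)      ≈⟨ S.sum-cong-≋ {suc p} term ⟩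
      sum (λ i → sum (λ k → c k * (χb k i * x i)))                       ≈⟨ S.∑-comm {suc p} {p} (λ i k → c k * (χb k i * x i)) ⟩
      sum (λ k → sum (λ i → c k * (χb k i * x i)))                       ≈⟨ S.sum-cong-≋ {p} (λ k → S.*-distribˡ-sum {suc p} (c k) (λ i → χb k i * x i)) ⟨
      sum (λ k → c k * sum (λ i → χb k i * x i))                         ≈⟨ S.sum-cong-≋ {p} (λ k → trans (*-congˡ (kernel k)) (zeroʳ (c k))) ⟩
      sum {p} (λ k → 0#)                                                 ≈⟨ S.sum-replicate-zero p ⟩
      0#                                                                 ∎
      where
      c : Fin p → Carrier
      c k = ι.⟦ proj₁ (B.spanning y) k ⟧
      term : ∀ i → extend 0# x (toℕ i) * Extension.⟦_⟧ (χ (toℕ i)) y ≈ sum (λ k → c k * (χb k i * x i))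
      term i = begin
        extend 0# x (toℕ i) * Extension.⟦_⟧ (χ (toℕ i)) y  ≈⟨ *-cong (reflexive (extend-toℕ 0# x i)) (expand (χ (toℕ i)) y) ⟩
        x i * sum (λ k → c k * χb k i)                     ≈⟨ S.*-distribˡ-sum {p} (x i) (λ k → c k * χb k i) ⟩
        sum (λ k → x i * (c k * χb k i))                   ≈⟨ S.sum-cong-≋ {p} (λ k → solve 3 (λ x c b → x :* (c :* b) := c :* (b :* x)) (x i) (c k) (χb k i)) ⟩
        sum (λ k → c k * (χb k i * x i))                   ∎

    -- The values of χ₀, ..., χₚ on the p basis vectors form a p × (p + 1) matrix. A nonzero kernel
    -- vector is a linear relation between the χᵢ on the whole field, which is impossible for
    -- pairwise distinct characters.
    embeddings-coincide : ∃[ i ] ∃[ j ] i < j × j ≤ p × Agree (χ i) (χ j)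
    embeddings-coincide with find< repeats? (suc p)
    ... | inj₁ (j , s≤s j≤p , i , i<j , eq) = i , j , i<j , j≤p , eq
    ... | inj₂ none with nontrivial-kernel {p} {suc p} ℕ.≤-refl χb
    ...   | x , (j , xj≉0) , kernel = contradiction
      (trans (reflexive (≡.sym (extend-toℕ 0# x j)))
        (characters-independent F._*_ F.1# (suc p) (λ i → Extension.⟦_⟧ (χ i)) (λ i → Extension.*-homo (χ i))
          (λ i → Extension.1#-homo (χ i)) distinct (extend 0# x) (relation x kernel) (toℕ j) (Fin.toℕ<n j)))
      xj≉0
      where
      distinct : ∀ {i j} → i < j → j < suc p → ∃[ y ] Extension.⟦_⟧ (χ i) y ≉ Extension.⟦_⟧ (χ j) y
      distinct {i} {j} i<j j<n with coincide? (χ i) (χ j)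
      ... | inj₁ eq = contradiction (i , i<j , eq) (none j j<n)
      ... | inj₂ w  = w

ringMap⇒ₑ : ∀ {a a₁ a₂ b b₁ b₂} {A : Field a a₁ a₂} {B : Field b b₁ b₂} →
  let module A = Field A; module B = Field B in
  (f : A.Carrier → B.Carrier) → (∀ {x y} → x A.≈ y → f x B.≈ f y) →
  (∀ x y → f (x A.+ y) B.≈ f x B.+ f y) → (∀ x y → f (x A.* y) B.≈ f x B.* f y) →
  f A.1# B.≈ B.1# → Extension A B
ringMap⇒ₑ {A = A} {B} f f-cong f-+ f-* f-1 = record { homomorphism = record { ⟦_⟧ = f ; isRingHomomorphism = record
  { isSemiringHomomorphism = record
    { isNearSemiringHomomorphism = record
      { +-isMonoidHomomorphism = record
        { isMagmaHomomorphism = record { isRelHomomorphism = record { cong = f-cong } ; homo = f-+ }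
        ; ε-homo = f-0 }
      ; *-homo = f-* }
    ; 1#-homo = f-1 }
  ; -‿homo = λ x → +-inverseʳ-unique (f x) (f (A.- x)) (B.trans (B.sym (f-+ x (A.- x))) (B.trans (f-cong (A.-‿inverseʳ x)) f-0)) } } }
  where
  module A = Field A
  module B = Field B
  open RingProperties B.ring using (x+x≈x⇒x≈0; +-inverseʳ-unique)
  f-0 : f A.0# B.≈ B.0#
  f-0 = x+x≈x⇒x≈0 (f A.0#) (B.trans (B.sym (f-+ A.0# A.0#)) (f-cong (A.+-identityˡ A.0#)))

-- The Galois group of a cyclic extension of ℚ.

module CyclicGroup {c ℓ₁ ℓ₂} {F : Field c ℓ₁ ℓ₂} (ιF : Extension ℚ-field F) {p} (B : Basis ιF p)
  (fixedField : ∀ x → (∀ (ρ : Gal ιF) → Field._≈_ F (Gal.⟦_⟧ ρ x) x) → Image ιF x)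
  (gal : Gal ιF) (generates : IsGenerator ιF gal) where
  private
    module B = Basis B
    module S = SemiringSum (Field.semiring F)
    module ιF = Extension ιF
  open FieldProperties F ιF
  open Coincidence ιF ιF B
  open LinearAlgebra F ιF

  σ : Extension F F
  σ = gal⇒ₑ gal

  σ^ : ℕ → Carrier → Carrier
  σ^ i = Extension.⟦_⟧ (σ ^ₑ i)

  private module σ^ i = Extension (σ ^ₑ i)

  fixed⇒rational : ∀ {x} → σ^ 1 x ≈ x → Image ιF x
  fixed⇒rational {x} fixed = fixedField x λ ρ → trans (proj₂ (generates ρ) x) (iter (proj₁ (generates ρ)))
    where
    iter : ∀ n → fold x (σ^ 1) n ≈ x
    iter zero    = refl
    iter (suc n) = trans (σ^.⟦⟧-cong 1 (iter n)) fixed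

  -- A nonzero x with ∑ⱼ σᵈ⁻ⁱ(bⱼ) xⱼ = 0 for all i < d gives ∑ⱼ Tr(μ xⱼ) bⱼ = 0 for all μ,
  -- so these rational traces vanish; but Tr(1) = d.
  order≥p : ∀ {d} → 0 < d → (∀ x → σ^ d x ≈ x) → p ≤ d
  order≥p {d} 0<d σᵈ≈id with p ℕ.≤? d
  ... | yes p≤d = p≤d
  ... | no  p≰d with nontrivial-kernel {d} {p} (ℕ.≰⇒> p≰d) (λ i j → σ^ (d ∸ toℕ i) (B.basis j))
  ...   | x , (j₀ , xj₀≉0) , kernel = contradiction d≈0 (nat≉0 d 0<d)
    where
    μ : Carrier
    μ = proj₁ (inverse xj₀≉0)
    trace : Fin p → Carrier
    trace j = ∑ d (λ i → σ^ i (μ * x j))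
    trace-fixed : ∀ j → σ^ 1 (trace j) ≈ trace j
    trace-fixed j = trans (Embedding.hom-∑ ιF ιF σ d (λ i → σ^ i (μ * x j)))
                          (∑-cycle d (λ i → σ^ i (μ * x j)) (σᵈ≈id (μ * x j)))
    r : ∀ j → Image ιF (trace j)
    r j = fixed⇒rational (trace-fixed j)
    row : ∀ i → i < d → sum {p} (λ j → σ^ (d ∸ i) (B.basis j) * x j) ≈ 0#
    row i i<d = trans
      (reflexive (≡.cong (λ m → sum {p} (λ j → σ^ (d ∸ m) (B.basis j) * x j)) (≡.sym (Fin.toℕ-fromℕ< i<d))))
      (kernel (Fin.fromℕ< i<d))
    term : ∀ i → i < d → ∀ j → σ^ i (μ * x j) * B.basis j ≈ σ^ i (μ * (σ^ (d ∸ i) (B.basis j) * x j))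
    term i i<d j = begin
      σ^ i (μ * x j) * B.basis j                            ≈⟨ *-congˡ (σᵈ≈id (B.basis j)) ⟨
      σ^ i (μ * x j) * σ^ d (B.basis j)                     ≡⟨ ≡.cong (λ m → σ^ i (μ * x j) * σ^ m (B.basis j)) (ℕ.m+[n∸m]≡n (ℕ.<⇒≤ i<d)) ⟨
      σ^ i (μ * x j) * σ^ (i ℕ.+ (d ∸ i)) (B.basis j)       ≡⟨ ≡.cong (σ^ i (μ * x j) *_) (^ₑ-+ σ i (d ∸ i) (B.basis j)) ⟩
      σ^ i (μ * x j) * σ^ i (σ^ (d ∸ i) (B.basis j))        ≈⟨ σ^.*-homo i _ _ ⟨
      σ^ i (μ * x j * σ^ (d ∸ i) (B.basis j))               ≈⟨ σ^.⟦⟧-cong i (solve 3 (λ m x s → m :* x :* s := m :* (s :* x)) μ (x j) _) ⟩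
      σ^ i (μ * (σ^ (d ∸ i) (B.basis j) * x j))             ∎
    equation : ∀ i → i < d → sum {p} (λ j → σ^ i (μ * x j) * B.basis j) ≈ 0#
    equation i i<d = begin
      sum {p} (λ j → σ^ i (μ * x j) * B.basis j)                            ≈⟨ S.sum-cong-≋ {p} (term i i<d) ⟩
      sum {p} (λ j → σ^ i (μ * (σ^ (d ∸ i) (B.basis j) * x j)))             ≈⟨ Embedding.hom-sum ιF ιF (σ ^ₑ i) {p} (λ j → μ * (σ^ (d ∸ i) (B.basis j) * x j)) ⟨
      σ^ i (sum {p} (λ j → μ * (σ^ (d ∸ i) (B.basis j) * x j)))             ≈⟨ σ^.⟦⟧-cong i (S.*-distribˡ-sum {p} μ (λ j → σ^ (d ∸ i) (B.basis j) * x j)) ⟨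
      σ^ i (μ * sum {p} (λ j → σ^ (d ∸ i) (B.basis j) * x j))               ≈⟨ σ^.⟦⟧-cong i (trans (*-congˡ (row i i<d)) (zeroʳ μ)) ⟩
      σ^ i 0#                                                               ≈⟨ σ^.0#-homo i ⟩
      0#                                                                    ∎
    trace-term : ∀ j → ιF.⟦ proj₁ (r j) ⟧ * B.basis j ≈ sum {d} (λ i → σ^ (toℕ i) (μ * x j) * B.basis j)
    trace-term j = begin
      ιF.⟦ proj₁ (r j) ⟧ * B.basis j                            ≈⟨ trans (*-congʳ (proj₂ (r j))) (*-comm _ _) ⟩
      B.basis j * ∑ d (λ i → σ^ i (μ * x j))                    ≈⟨ *-∑ d (B.basis j) (λ i → σ^ i (μ * x j)) ⟩
      ∑ d (λ i → B.basis j * σ^ i (μ * x j))                    ≈⟨ ∑-cong′ d (λ i → *-comm (B.basis j) (σ^ i (μ * x j))) ⟩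
      ∑ d (λ i → σ^ i (μ * x j) * B.basis j)                    ≡⟨ ∑≡sum d (λ i → σ^ i (μ * x j) * B.basis j) ⟩
      sum {d} (λ i → σ^ (toℕ i) (μ * x j) * B.basis j)          ∎
    dependence : sum {p} (λ j → ιF.⟦ proj₁ (r j) ⟧ * B.basis j) ≈ 0#
    dependence = begin
      sum {p} (λ j → ιF.⟦ proj₁ (r j) ⟧ * B.basis j)                                  ≈⟨ S.sum-cong-≋ {p} trace-term ⟩
      sum {p} (λ j → sum {d} (λ i → σ^ (toℕ i) (μ * x j) * B.basis j))                ≈⟨ S.∑-comm {p} {d} (λ j i → σ^ (toℕ i) (μ * x j) * B.basis j) ⟩
      sum {d} (λ i → sum {p} (λ j → σ^ (toℕ i) (μ * x j) * B.basis j))                ≈⟨ S.sum-cong-≋ {d} (λ i → equation (toℕ i) (Fin.toℕ<n i)) ⟩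
      sum {d} (λ i → 0#)                                                              ≈⟨ S.sum-replicate-zero d ⟩
      0#                                                                              ∎
    d≈0 : nat d ≈ 0#
    d≈0 = begin
      nat d                     ≈⟨ trans (∑-const d 1#) (*-identityʳ _) ⟨
      ∑ d (λ _ → 1#)            ≈⟨ ∑-cong′ d (λ i → trans (σ^.⟦⟧-cong i (trans (*-comm _ _) (proj₂ (inverse xj₀≉0)))) (σ^.1#-homo i)) ⟨
      trace j₀                  ≈⟨ proj₂ (r j₀) ⟨
      ιF.⟦ proj₁ (r j₀) ⟧       ≈⟨ ιF.⟦⟧-cong (B.independent (λ j → proj₁ (r j)) dependence j₀) ⟩
      ιF.⟦ ℚ.0ℚ ⟧               ≈⟨ ιF.0#-homo ⟩
      0#                        ∎

  σⁱ≈σʲ⇒σʲ⁻ⁱ≈id : ∀ {i j} → i < j → (∀ x → σ^ i x ≈ σ^ j x) → ∀ x → σ^ (j ∸ i) x ≈ x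
  σⁱ≈σʲ⇒σʲ⁻ⁱ≈id {i} {j} i<j eq x = Embedding.hom-injective ιF ιF (σ ^ₑ i) (begin
    σ^ i (σ^ (j ∸ i) x)     ≡⟨ ^ₑ-+ σ i (j ∸ i) x ⟨
    σ^ (i ℕ.+ (j ∸ i)) x    ≡⟨ ≡.cong (λ m → σ^ m x) (ℕ.m+[n∸m]≡n (ℕ.<⇒≤ i<j)) ⟩
    σ^ j x                  ≈⟨ eq x ⟨
    σ^ i x                  ∎)

  -- Two of the p + 1 embeddings σ⁰, ..., σᵖ coincide, so some σᵈ with 0 < d ≤ p is the identity,
  -- and `order≥p` leaves only d = p.
  σᵖ≈id : ∀ x → σ^ p x ≈ x
  σᵖ≈id with embeddings-coincide (σ ^ₑ_)
  ... | i , j , i<j , j≤p , eq = ≡.subst (λ m → ∀ x → σ^ m x ≈ x)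
    (ℕ.≤-antisym (ℕ.≤-trans (ℕ.m∸n≤m j i) j≤p) (order≥p (ℕ.m<n⇒0<n∸m i<j) (σⁱ≈σʲ⇒σʲ⁻ⁱ≈id i<j eq))) (σⁱ≈σʲ⇒σʲ⁻ⁱ≈id i<j eq)

  σⁱ≉σʲ : ∀ {i j} → i < j → j < p → ¬ (∀ x → σ^ i x ≈ σ^ j x)
  σⁱ≉σʲ {i} {j} i<j j<p eq =
    ℕ.<⇒≱ (ℕ.≤-<-trans (ℕ.m∸n≤m j i) j<p) (order≥p (ℕ.m<n⇒0<n∸m i<j) (σⁱ≈σʲ⇒σʲ⁻ⁱ≈id i<j eq))

  moved : 1 < p → ∃[ x ] σ^ 1 x ≉ x
  moved 1<p with coincide? (σ ^ₑ 1) idₑ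
  ... | inj₁ eq = contradiction (λ x → sym (eq x)) (σⁱ≉σʲ {0} {1} (s≤s z≤n) 1<p)
  ... | inj₂ w  = w

-- Divisibility of natural numbers.

n<b^n : ∀ {b} → 1 < b → ∀ n → n < b ℕ.^ n
n<b^n 1<b zero    = s≤s z≤n
n<b^n {b} 1<b (suc n) = ℕ.≤-<-trans (n<b^n 1<b n) (ℕ.^-monoʳ-< b 1<b (ℕ.n<1+n n))

coprime-^ : ∀ {a b} k → Coprime b a → Coprime (b ℕ.^ k) a
coprime-^ zero    c = Coprimality.1-coprimeTo _
coprime-^ {a} {b} (suc k) c {d} (d∣b*bᵏ , d∣a) =
  coprime-^ k c (Coprimality.coprime-divisor (λ (x∣d , x∣b) → c (x∣b , ∣-trans x∣d d∣a)) d∣b*bᵏ , d∣a)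

-- For k = M, coprimality cancels the power of a and leaves bᴹ ∣ M; but M < bᴹ as soon as b > 1.
powers-divide : ∀ {a b M} → 0 < M → Coprime a b → (∀ k → b ℕ.^ k ∣ M ℕ.* a ℕ.^ k) → b ≤ 1
powers-divide {a} {b} {M} 0<M a⊥b divides-all = ℕ.≮⇒≥ λ 1<b →
  ℕ.<⇒≱ (n<b^n 1<b M) (∣⇒≤ {{ℕ.>-nonZero 0<M}} (cancel M (divides-all M)))
  where
  cancel : ∀ j → b ℕ.^ M ∣ M ℕ.* a ℕ.^ j → b ℕ.^ M ∣ M
  cancel zero    d = ≡.subst (b ℕ.^ M ∣_) (ℕ.*-identityʳ M) d
  cancel (suc j) d = cancel j (Coprimality.coprime-divisor (coprime-^ M (Coprimality.sym a⊥b))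
    (≡.subst (b ℕ.^ M ∣_) (≡.trans (≡.sym (ℕ.*-assoc M a (a ℕ.^ j)))
      (≡.trans (≡.cong (ℕ._* a ℕ.^ j) (ℕ.*-comm M a)) (ℕ.*-assoc a M (a ℕ.^ j)))) d))

abs-^ : ∀ i k → ℤ.∣ i ℤ.^ k ∣ ≡ ℤ.∣ i ∣ ℕ.^ k
abs-^ i zero    = ≡.refl
abs-^ i (suc k) = ≡.trans (ℤ.abs-* i (i ℤ.^ k)) (≡.cong (ℤ.∣ i ∣ ℕ.*_) (abs-^ i k))

-- Here `Q i d` stands for conditions like "d clears the i-th denominator", which pass to multiples
-- of d; the product of the separate values then serves all indices.
common-multiple : ∀ {ℓ} n (Q : Fin n → ℕ → Set ℓ) → (∀ i d k → Q i d → Q i (k ℕ.* d)) →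
                  (∀ i → ∃[ d ] 0 < d × Q i d) → ∃[ d ] 0 < d × (∀ i → Q i d)
common-multiple zero    Q mult ex = 1 , s≤s z≤n , λ ()
common-multiple (suc n) Q mult ex with common-multiple n (Q ∘ Fin.suc) (mult ∘ Fin.suc) (ex ∘ Fin.suc) | ex Fin.zero
... | d , 0<d , all | d₀ , 0<d₀ , q₀ = d ℕ.* d₀ , ℕ.*-mono-< 0<d 0<d₀ , λ where
  Fin.zero    → mult Fin.zero d₀ d q₀
  (Fin.suc i) → ≡.subst (Q (Fin.suc i)) (ℕ.*-comm d₀ d) (mult (Fin.suc i) d d₀ (all i))

common-multiple₂ : ∀ {ℓ} m n (Q : Fin m → Fin n → ℕ → Set ℓ) → (∀ i j d k → Q i j d → Q i j (k ℕ.* d)) →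
                   (∀ i j → ∃[ d ] 0 < d × Q i j d) → ∃[ d ] 0 < d × (∀ i j → Q i j d)
common-multiple₂ m n Q mult ex = common-multiple m (λ i d → ∀ j → Q i j d) (λ i d k q j → mult i j d k (q j))
  λ i → common-multiple n (Q i) (mult i) (ex i)

prime∣^⇒∣ : ∀ {p} → Prime p → ∀ a k → p ∣ a ℕ.^ k → p ∣ a
prime∣^⇒∣ p-prime a zero    p∣1 = contradiction (∣⇒≤ p∣1) (ℕ.<⇒≱ (ℕ.nonTrivial⇒n>1 _ {{prime⇒nonTrivial p-prime}}))
prime∣^⇒∣ p-prime a (suc k) p∣  with euclidsLemma a (a ℕ.^ k) p-prime p∣
... | inj₁ p∣a  = p∣a
... | inj₂ p∣aᵏ = prime∣^⇒∣ p-prime a k p∣aᵏ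

^-∣-mono : ∀ {a b} k → a ∣ b → a ℕ.^ k ∣ b ℕ.^ k
^-∣-mono zero    a∣b = divides 1 ≡.refl
^-∣-mono (suc k) a∣b = *-pres-∣ a∣b (^-∣-mono k a∣b)

prime∤⇒coprime : ∀ {q n} → Prime q → ¬ (q ∣ n) → Coprime n q
prime∤⇒coprime {q} {n} q-prime q∤n {k} (k∣n , k∣q) = either (prime⇒irreducible q-prime k∣q)
  where
  either : k ≡ 1 ⊎ k ≡ q → k ≡ 1
  either (inj₁ k≡1)    = k≡1
  either (inj₂ ≡.refl) = contradiction k∣n q∤n

prime-divisor : ∀ {n} → 1 < n → ∃[ q ] Prime q × q ∣ n
prime-divisor {n} 1<n = from (factorise n {{ℕ.>-nonZero (ℕ.<⇒≤ 1<n)}})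
  where
  from : PrimeFactorisation n → ∃[ q ] Prime q × q ∣ n
  from record { factors = [] ; isFactorisation = eq } = contradiction eq (ℕ.<⇒≢ 1<n ∘ ≡.sym)
  from record { factors = q ∷ qs ; isFactorisation = eq ; factorsPrime = q-prime ∷ _ } =
    q , q-prime , ≡.subst (q ∣_) (≡.sym eq) (m∣m*n _)

∣abs⇒multiple : ∀ {q} z → q ∣ ℤ.∣ z ∣ → ∃[ k ] z ≡ + q ℤ.* k
∣abs⇒multiple {q} (+ n)    (divides k eq) = + k , ≡.trans (≡.cong +_ (≡.trans eq (ℕ.*-comm k q))) (ℤ.pos-* q k)
∣abs⇒multiple {q} -[1+ n ] (divides k eq) = ℤ.- + k , ≡.trans
  (≡.cong (λ m → ℤ.- + m) (≡.trans eq (ℕ.*-comm k q))) (≡.trans (≡.cong ℤ.-_ (ℤ.pos-* q k)) (ℤ.neg-distribʳ-* (+ q) (+ k)))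

module Iterates {c ℓ₁ ℓ₂} {E : Field c ℓ₁ ℓ₂} (φ : Extension E E) where
  private module E = Field E

  iterate-% : ∀ d .{{_ : ℕ.NonZero d}} → (∀ x → Extension.⟦_⟧ (φ ^ₑ d) x E.≈ x) →
              ∀ n x → Extension.⟦_⟧ (φ ^ₑ n) x E.≈ Extension.⟦_⟧ (φ ^ₑ (n % d)) x
  iterate-% d φᵈ≈id n x = E.trans
    (E.reflexive (≡.trans (≡.cong (λ k → Extension.⟦_⟧ (φ ^ₑ k) x) (m≡m%n+[m/n]*n n d)) (^ₑ-+ φ (n % d) (n / d ℕ.* d) x)))
    (Extension.⟦⟧-cong (φ ^ₑ (n % d)) (multiple (n / d)))
    where
    multiple : ∀ q → Extension.⟦_⟧ (φ ^ₑ (q ℕ.* d)) x E.≈ x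
    multiple zero    = E.refl
    multiple (suc q) = E.trans (E.reflexive (^ₑ-+ φ d (q ℕ.* d) x)) (E.trans (φᵈ≈id _) (multiple q))

-- Integers, lattices, and orders with an abelian group of automorphisms.

module _ {c ℓ₁ ℓ₂} (E : Field c ℓ₁ ℓ₂) (ι : Extension ℚ-field E) where
  open FieldProperties E ι
  open FieldTools E ι
  private
    module E = Field E
    module ι = Extension ι

  module Integers where

    Integer : Carrier → Set ℓ₁
    Integer x = ∃[ z ] x ≈ int z

    integer-resp : ∀ {x y} → x ≈ y → Integer x → Integer y
    integer-resp eq (z , eq′) = z , trans (sym eq) eq′

    integer-+ : ∀ {x y} → Integer x → Integer y → Integer (x + y)
    integer-+ (a , eq) (b , eq′) = a ℤ.+ b , trans (+-cong eq eq′) (sym (int-+ a b))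

    integer-* : ∀ {x y} → Integer x → Integer y → Integer (x * y)
    integer-* (a , eq) (b , eq′) = a ℤ.* b , trans (*-cong eq eq′) (sym (int-* a b))

    integer-int : ∀ z → Integer (int z)
    integer-int z = z , refl

    int-^ : ∀ z k → int (z ℤ.^ k) ≈ int z ^ k
    int-^ z zero    = int-1
    int-^ z (suc k) = trans (int-* z (z ℤ.^ k)) (*-congˡ (int-^ z k))

    denominator-* : ∀ r → nat (ℚ.↧ₙ r) * ι.⟦ r ⟧ ≈ int (ℚ.↥ r)
    denominator-* r = trans (sym (ι.*-homo (fromℤ (ℚ.↧ r)) r)) (ι.⟦⟧-cong (↧*≡↥ r))

    denominator : ∀ {x} → Image ι x → ∃[ d ] 0 < d × Integer (nat d * x)
    denominator (r@record{} , eq) = ℚ.↧ₙ r , s≤s z≤n , ℚ.↥ r , trans (*-congˡ (sym eq)) (denominator-* r)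

    denominator-multiple : ∀ k d x → Integer (nat d * x) → Integer (nat (k ℕ.* d) * x)
    denominator-multiple k d x u = integer-resp (trans (sym (*-assoc _ _ _)) (*-congʳ (sym (nat-* k d)))) (integer-* (integer-int (+ k)) u)

    -- If x = a / b in lowest terms, then bᵏ divides M aᵏ for every k, which forces b = 1. This is
    -- the criterion that replaces integral closedness of ℤ.
    bounded-powers⇒integer : ∀ {x M} → 0 < M → Image ι x → (∀ k → Integer (nat M * x ^ k)) → Integer x
    bounded-powers⇒integer {x} {M} 0<M (r@(mkℚ a b-1 a⊥b) , eq) bounded = a , (begin
      x              ≈⟨ *-identityˡ x ⟨
      1# * x         ≈⟨ *-congʳ (trans (reflexive (≡.cong nat b≡1)) int-1) ⟨
      nat b * x      ≈⟨ bx≈a ⟩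
      int a          ∎)
      where
      b = suc b-1
      bx≈a : nat b * x ≈ int a
      bx≈a = trans (*-congˡ (sym eq)) (denominator-* r)
      identity : ∀ k → + M ℤ.* a ℤ.^ k ≡ (+ b) ℤ.^ k ℤ.* proj₁ (bounded k)
      identity k = int-injective (begin
        int (+ M ℤ.* a ℤ.^ k)                      ≈⟨ trans (int-* (+ M) (a ℤ.^ k)) (*-congˡ (int-^ a k)) ⟩
        nat M * int a ^ k                          ≈⟨ *-congˡ (trans (^-congˡ k (sym bx≈a)) (^-distrib-* (nat b) x k)) ⟩
        nat M * (nat b ^ k * x ^ k)                ≈⟨ solve 3 (λ m b x → m :* (b :* x) := b :* (m :* x)) (nat M) (nat b ^ k) (x ^ k) ⟩
        nat b ^ k * (nat M * x ^ k)                ≈⟨ *-cong (sym (int-^ (+ b) k)) (proj₂ (bounded k)) ⟩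
        int ((+ b) ℤ.^ k) * int (proj₁ (bounded k))   ≈⟨ int-* ((+ b) ℤ.^ k) (proj₁ (bounded k)) ⟨
        int ((+ b) ℤ.^ k ℤ.* proj₁ (bounded k))    ∎)
      b≡1 : b ≡ 1
      b≡1 = ℕ.≤-antisym (powers-divide 0<M (Coprimality.recompute a⊥b) λ k → divides ℤ.∣ proj₁ (bounded k) ∣ (
        ≡.trans (≡.trans (≡.cong (M ℕ.*_) (≡.sym (abs-^ a k))) (≡.sym (ℤ.abs-* (+ M) (a ℤ.^ k))))
        (≡.trans (≡.cong ℤ.∣_∣ (identity k)) (≡.trans (ℤ.abs-* ((+ b) ℤ.^ k) (proj₁ (bounded k)))
        (≡.trans (ℕ.*-comm _ ℤ.∣ proj₁ (bounded k) ∣) (≡.cong (ℤ.∣ proj₁ (bounded k) ∣ ℕ.*_) (abs-^ (+ b) k))))))) (s≤s z≤n)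

    -- The sums are nonempty, so membership of 0 is not automatic for an arbitrary G; the closure
    -- lemmas for possibly empty sums take it as the argument `0∈`.
    data ℤSpan {ℓ} (G : Carrier → Set ℓ) : Carrier → Set (c ⊔ ℓ₁ ⊔ ℓ) where
      gen  : ∀ z {g x} → G g → x ≈ int z * g → ℤSpan G x
      plus : ∀ {x y z} → ℤSpan G x → ℤSpan G y → z ≈ x + y → ℤSpan G z

    module _ {ℓ} {G : Carrier → Set ℓ} where
      span-resp : ∀ {x y} → x ≈ y → ℤSpan G x → ℤSpan G y
      span-resp eq (gen z g eq′)  = gen z g (trans (sym eq) eq′)
      span-resp eq (plus u v eq′) = plus u v (trans (sym eq) eq′)

      span-int* : ∀ n {x} → ℤSpan G x → ℤSpan G (int n * x)
      span-int* n (gen z g eq)  = gen (n ℤ.* z) g (trans (*-congˡ eq) (trans (sym (*-assoc _ _ _)) (*-congʳ (sym (int-* n z)))))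
      span-int* n (plus u v eq) = plus (span-int* n u) (span-int* n v) (trans (*-congˡ eq) (distribˡ _ _ _))

      span-gen : ∀ {g} → G g → ℤSpan G g
      span-gen Gg = gen (+ 1) Gg (sym (trans (*-congʳ int-1) (*-identityˡ _)))

      -- The factor b is there for lattices closed under multiplication only up to a fixed
      -- denominator.
      span-bilinear : ∀ b → (∀ {g h} → G g → G h → ℤSpan G (b * (g * h))) →
                      ∀ {x y} → ℤSpan G x → ℤSpan G y → ℤSpan G (b * (x * y))
      span-bilinear b G-* (plus u v eq) w = plus (span-bilinear b G-* u w) (span-bilinear b G-* v w)
        (trans (*-congˡ (trans (*-congʳ eq) (distribʳ _ _ _))) (distribˡ b _ _))
      span-bilinear b G-* u@(gen _ _ _) (plus v w eq) = plus (span-bilinear b G-* u v) (span-bilinear b G-* u w)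
        (trans (*-congˡ (trans (*-congˡ eq) (distribˡ _ _ _))) (distribˡ b _ _))
      span-bilinear b G-* (gen z Gg eq) (gen z′ Gh eq′) = span-resp
        (sym (trans (*-congˡ (*-cong eq eq′)) (solve 5 (λ b z g z′ h → b :* ((z :* g) :* (z′ :* h)) := z :* (z′ :* (b :* (g :* h)))) b (int z) _ (int z′) _)))
        (span-int* z (span-int* z′ (G-* Gg Gh)))

      span-* : (∀ {g h} → G g → G h → ℤSpan G (g * h)) → ∀ {x y} → ℤSpan G x → ℤSpan G y → ℤSpan G (x * y)
      span-* G-* u v = span-resp (*-identityˡ _) (span-bilinear 1# (λ g h → span-resp (sym (*-identityˡ _)) (G-* g h)) u v)

      span-sum : ∀ {n} {f : Fin n → Carrier} → ℤSpan G 0# → (∀ i → ℤSpan G (f i)) → ℤSpan G (sum f)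
      span-sum {zero}  0∈ u = 0∈
      span-sum {suc n} 0∈ u = plus (u Fin.zero) (span-sum 0∈ (u ∘ Fin.suc)) refl

      span-∑ : ∀ n {f : ℕ → Carrier} → ℤSpan G 0# → (∀ i → ℤSpan G (f i)) → ℤSpan G (∑ n f)
      span-∑ zero    0∈ u = 0∈
      span-∑ (suc n) 0∈ u = plus (u 0) (span-∑ n 0∈ (u ∘ suc)) refl

  module Polynomials where

    poly-*∏ : ∀ k n {f} (a : ℕ → Carrier) → Poly n f → Poly (k ℕ.+ n) (λ t → ∏ k (λ i → 1# - t * a i) * f t)
    poly-*∏ zero    n a p = poly-resp n (λ t → sym (*-identityˡ _)) p
    poly-*∏ (suc k) n {f} a p = poly-resp (suc (k ℕ.+ n))
      (λ t → solve 4 (λ t a π f → π :* f :- a :* (t :* (π :* f)) := (con (+ 1) :- t :* a) :* π :* f) t (a 0) _ (f t))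
      (poly-- (suc (k ℕ.+ n)) (poly-weaken (k ℕ.+ n) rest) (poly-*ˡ (suc (k ℕ.+ n)) (a 0) (poly-shift (k ℕ.+ n) rest)))
      where rest = poly-*∏ k n (a ∘ suc) p

    poly-∏∏ : ∀ m n (a : ℕ → ℕ → Carrier) → Poly (m ℕ.* n ℕ.+ 1) (λ t → ∏ m (λ j → ∏ n (λ i → 1# - t * a j i)))
    poly-∏∏ zero    n a = poly-constant 0 1#
    poly-∏∏ (suc m) n a = ≡.subst (λ d → Poly d (λ t → ∏ (suc m) (λ j → ∏ n (λ i → 1# - t * a j i))))
      (≡.sym (ℕ.+-assoc n (m ℕ.* n) 1)) (poly-*∏ n (m ℕ.* n ℕ.+ 1) (a 0) (poly-∏∏ m n (a ∘ suc)))

  -- Two commuting automorphisms with common fixed field ℚ. Their periods are stored as `suc s` and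
  -- `suc t` so that the factor of index 0, which is x itself, splits off a norm by computation.
  record AbelianAction : Set (c ⊔ ℓ₁) where
    field
      σ τ        : Extension E E
      s t        : ℕ
      σ-period   : ∀ x → Extension.⟦_⟧ (σ ^ₑ suc s) x E.≈ x
      τ-period   : ∀ x → Extension.⟦_⟧ (τ ^ₑ suc t) x E.≈ x
      στ-comm    : ∀ i j x → Extension.⟦_⟧ (σ ^ₑ i) (Extension.⟦_⟧ (τ ^ₑ j) x) E.≈ Extension.⟦_⟧ (τ ^ₑ j) (Extension.⟦_⟧ (σ ^ₑ i) x)
      fixed∈ℚ    : ∀ {x} → Extension.⟦_⟧ (σ ^ₑ 1) x E.≈ x → Extension.⟦_⟧ (τ ^ₑ 1) x E.≈ x → Image ι x

  module _ (A : AbelianAction) where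
    open AbelianAction A
    open Integers

    -- An order of E stable under the action, not necessarily integrally closed. `𝒪-integer` stands
    -- in for integrality of its elements, and `𝒪-clear` makes E its field of fractions.
    record IntegralRing : Set (lsuc (c ⊔ ℓ₁)) where
      field
        𝒪         : E.Carrier → Set (c ⊔ ℓ₁)
        𝒪-resp    : ∀ {x y} → x E.≈ y → 𝒪 x → 𝒪 y
        𝒪-+       : ∀ {x y} → 𝒪 x → 𝒪 y → 𝒪 (x E.+ y)
        𝒪-*       : ∀ {x y} → 𝒪 x → 𝒪 y → 𝒪 (x E.* y)
        𝒪-int     : ∀ z → 𝒪 (int z)
        𝒪-σ       : ∀ i {x} → 𝒪 x → 𝒪 (Extension.⟦_⟧ (σ ^ₑ i) x)
        𝒪-τ       : ∀ j {x} → 𝒪 x → 𝒪 (Extension.⟦_⟧ (τ ^ₑ j) x)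
        𝒪-integer : ∀ {x} → 𝒪 x → Image ι x → Integer x
        𝒪-clear   : ∀ x → ∃[ d ] 0 < d × 𝒪 (nat d E.* x)

    module Norms where

      module σ^ i = Extension (σ ^ₑ i)
      module τ^ i = Extension (τ ^ₑ i)
      module σ^-hom i = Embedding ι ι (σ ^ₑ i)
      module τ^-hom i = Embedding ι ι (τ ^ₑ i)

      σ^ τ^ : ℕ → Carrier → Carrier
      σ^ i = σ^.⟦_⟧ i
      τ^ i = τ^.⟦_⟧ i

      -- The slash marks the omission of the factor of index 0. Expanding `Nτ/ (Nσ x)` shows that
      -- `adjugate x` is the product of all conjugates of x except x itself.
      Nσ Nτ Norm Nσ/ Nτ/ adjugate : Carrier → Carrier
      Nσ x       = ∏ (suc s) (λ i → σ^ i x)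
      Nτ x       = ∏ (suc t) (λ j → τ^ j x)
      Norm x     = Nτ (Nσ x)
      Nσ/ x      = ∏ s (λ i → σ^ (suc i) x)
      Nτ/ x      = ∏ t (λ j → τ^ (suc j) x)
      adjugate x = Nσ/ x * Nτ/ (Nσ x)

      x*adjugate : ∀ x → x * adjugate x ≈ Norm x
      x*adjugate x = sym (*-assoc x _ _)

      Norm-* : ∀ x y → Norm (x * y) ≈ Norm x * Norm y
      Norm-* x y = trans (∏-cong′ (suc t) (λ j → trans (τ^.⟦⟧-cong j (Nσ-* x y)) (τ^.*-homo j _ _)))
        (∏-* (suc t) (λ j → τ^ j (Nσ x)) (λ j → τ^ j (Nσ y)))
        where
        Nσ-* : ∀ x y → Nσ (x * y) ≈ Nσ x * Nσ y
        Nσ-* x y = trans (∏-cong′ (suc s) (λ i → σ^.*-homo i x y)) (∏-* (suc s) (λ i → σ^ i x) (λ i → σ^ i y))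

      Norm-cong : ∀ {x y} → x ≈ y → Norm x ≈ Norm y
      Norm-cong eq = ∏-cong′ (suc t) λ j → τ^.⟦⟧-cong j (∏-cong′ (suc s) λ i → σ^.⟦⟧-cong i eq)

      Norm-int : ∀ z → Norm (int z) ≈ (int z ^ suc s) ^ suc t
      Norm-int z = trans (∏-cong′ (suc t) (λ j → trans (τ^.⟦⟧-cong j Nσ-int)
          (trans (τ^-hom.hom-^ j (int z) (suc s)) (^-congˡ (suc s) (τ^-hom.hom-int j z)))))
        (∏-const (suc t) _)
        where
        Nσ-int : Nσ (int z) ≈ int z ^ suc s
        Nσ-int = trans (∏-cong′ (suc s) (λ i → σ^-hom.hom-int i z)) (∏-const (suc s) (int z))

      Norm-≉0 : ∀ {x} → x ≉ 0# → Norm x ≉ 0#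
      Norm-≉0 x≉0 = ∏-≉0 (suc t) λ j _ → τ^-hom.hom-≉0 j (∏-≉0 (suc s) λ i _ → σ^-hom.hom-≉0 i x≉0)

      σ-comm : ∀ i j x → σ^ i (σ^ j x) ≈ σ^ (i ℕ.+ j) x
      σ-comm i j x = reflexive (≡.sym (^ₑ-+ σ i j x))

      τ-comm : ∀ i j x → τ^ i (τ^ j x) ≈ τ^ (i ℕ.+ j) x
      τ-comm i j x = reflexive (≡.sym (^ₑ-+ τ i j x))

      Nσ-fixed : ∀ i x → σ^ i (Nσ x) ≈ Nσ x
      Nσ-fixed zero    x = refl
      Nσ-fixed (suc i) x = trans (σ^.⟦⟧-cong 1 (Nσ-fixed i x))
        (trans (σ^-hom.hom-∏ 1 (suc s) (λ i → σ^ i x)) (∏-cycle (suc s) (λ i → σ^ i x) (σ-period x)))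

      Nτ/-fixed : ∀ i x → σ^ i (Nτ/ (Nσ x)) ≈ Nτ/ (Nσ x)
      Nτ/-fixed i x = trans (σ^-hom.hom-∏ i t (λ j → τ^ (suc j) (Nσ x)))
        (∏-cong′ t λ j → trans (στ-comm i (suc j) (Nσ x)) (τ^.⟦⟧-cong (suc j) (Nσ-fixed i x)))

      Norm-rational : ∀ x → Image ι (Norm x)
      Norm-rational x = fixed∈ℚ
        (trans (σ^-hom.hom-∏ 1 (suc t) (λ j → τ^ j (Nσ x))) (∏-cong′ (suc t) λ j → trans (στ-comm 1 j (Nσ x)) (τ^.⟦⟧-cong j (Nσ-fixed 1 x))))
        (trans (τ^-hom.hom-∏ 1 (suc t) (λ j → τ^ j (Nσ x))) (∏-cycle (suc t) (λ j → τ^ j (Nσ x)) (τ-period (Nσ x))))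

      Trσ Trace : Carrier → Carrier
      Trσ x   = ∑ (suc s) (λ i → σ^ i x)
      Trace x = ∑ (suc t) (λ j → τ^ j (Trσ x))

      Trace-rational : ∀ x → Image ι (Trace x)
      Trace-rational x = fixed∈ℚ
        (trans (σ^-hom.hom-∑ 1 (suc t) (λ j → τ^ j (Trσ x))) (∑-cong′ (suc t) λ j → trans (στ-comm 1 j (Trσ x)) (τ^.⟦⟧-cong j
          (trans (σ^-hom.hom-∑ 1 (suc s) (λ i → σ^ i x)) (∑-cycle (suc s) (λ i → σ^ i x) (σ-period x))))))
        (trans (τ^-hom.hom-∑ 1 (suc t) (λ j → τ^ j (Trσ x))) (∑-cycle (suc t) (λ j → τ^ j (Trσ x)) (τ-period (Trσ x))))

    -- Divisibility in a stable order.

    module _ (O : IntegralRing) where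
      open Norms
      open IntegralRing O

      module Ring where

        𝒪-0 : 𝒪 0#
        𝒪-0 = 𝒪-resp int-0 (𝒪-int (+ 0))

        𝒪-1 : 𝒪 1#
        𝒪-1 = 𝒪-resp int-1 (𝒪-int (+ 1))

        𝒪-neg : ∀ {x} → 𝒪 x → 𝒪 (- x)
        𝒪-neg {x} u = 𝒪-resp (trans (*-congʳ (trans (int-neg (+ 1)) (-‿cong int-1))) (solve 1 (λ x → (:- con (+ 1)) :* x := :- x) x))
          (𝒪-* (𝒪-int (ℤ.- + 1)) u)

        𝒪-- : ∀ {x y} → 𝒪 x → 𝒪 y → 𝒪 (x - y)
        𝒪-- u v = 𝒪-+ u (𝒪-neg v)

        𝒪-∏ : ∀ n {f : ℕ → Carrier} → (∀ i → 𝒪 (f i)) → 𝒪 (∏ n f)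
        𝒪-∏ zero    u = 𝒪-1
        𝒪-∏ (suc n) u = 𝒪-* (u 0) (𝒪-∏ n (u ∘ suc))

        𝒪-∑ : ∀ n {f : ℕ → Carrier} → (∀ i → 𝒪 (f i)) → 𝒪 (∑ n f)
        𝒪-∑ zero    u = 𝒪-0
        𝒪-∑ (suc n) u = 𝒪-+ (u 0) (𝒪-∑ n (u ∘ suc))

        𝒪-^ : ∀ n {x} → 𝒪 x → 𝒪 (x ^ n)
        𝒪-^ zero    u = 𝒪-1
        𝒪-^ (suc n) u = 𝒪-* u (𝒪-^ n u)

        𝒪-Nσ : ∀ {x} → 𝒪 x → 𝒪 (Nσ x)
        𝒪-Nσ u = 𝒪-∏ (suc s) λ i → 𝒪-σ i u

        𝒪-Norm : ∀ {x} → 𝒪 x → 𝒪 (Norm x)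
        𝒪-Norm u = 𝒪-∏ (suc t) λ j → 𝒪-τ j (𝒪-Nσ u)

        𝒪-adjugate : ∀ {x} → 𝒪 x → 𝒪 (adjugate x)
        𝒪-adjugate u = 𝒪-* (𝒪-∏ s λ i → 𝒪-σ (suc i) u) (𝒪-∏ t λ j → 𝒪-τ (suc j) (𝒪-Nσ u))

        𝒪-Trace : ∀ {x} → 𝒪 x → 𝒪 (Trace x)
        𝒪-Trace u = 𝒪-∑ (suc t) λ j → 𝒪-τ j (𝒪-∑ (suc s) λ i → 𝒪-σ i u)

        Norm-integer : ∀ {x} → 𝒪 x → Integer (Norm x)
        Norm-integer {x} u = 𝒪-integer (𝒪-Norm u) (Norm-rational x)

        Trace-integer : ∀ {x} → 𝒪 x → Integer (Trace x)
        Trace-integer {x} u = 𝒪-integer (𝒪-Trace u) (Trace-rational x)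

        -- Since u = a / n is rational and lies in 𝒪, `𝒪-integer` applies. This brings divisibility
        -- of integers in 𝒪 back to divisibility in ℤ.
        quotient-integer : ∀ {n a u} → 0 < n → 𝒪 u → int a ≈ nat n * u → ∃[ z ] u ≈ int z × a ≡ + n ℤ.* z
        quotient-integer {n} {a} {u} 0<n u∈ eq = from (nat-inverse n 0<n)
          where
          from : (∃[ r ] nat n * ι.⟦ r ⟧ ≈ 1#) → _
          from (r , nr≈1) = proj₁ u-integer , proj₂ u-integer ,
            int-injective (trans eq (trans (*-congˡ (proj₂ u-integer)) (sym (int-* (+ n) (proj₁ u-integer)))))
            where
            u-integer : Integer u
            u-integer = 𝒪-integer u∈ (r ℚ.* fromℤ a , trans (ι.*-homo r (fromℤ a)) (trans (*-congˡ eq)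
              (trans (solve 3 (λ r n u → r :* (n :* u) := (n :* r) :* u) ι.⟦ r ⟧ (nat n) u) (trans (*-congʳ nr≈1) (*-identityˡ u)))))

        infix 4 _≼_
        _≼_ : Carrier → Carrier → Set (c ⊔ ℓ₁)
        x ≼ y = ∃[ w ] 𝒪 w × y ≈ x * w

        ≼-resp : ∀ {x y z} → y ≈ z → x ≼ y → x ≼ z
        ≼-resp eq (w , w∈ , eq′) = w , w∈ , trans (sym eq) eq′

        ≼-+ : ∀ {x y z} → x ≼ y → x ≼ z → x ≼ y + z
        ≼-+ (w , w∈ , eq) (v , v∈ , eq′) = w + v , 𝒪-+ w∈ v∈ , trans (+-cong eq eq′) (sym (distribˡ _ _ _))

        ≼-*ʳ : ∀ {x y z} → 𝒪 z → x ≼ y → x ≼ y * z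
        ≼-*ʳ z∈ (w , w∈ , eq) = w * _ , 𝒪-* w∈ z∈ , trans (*-congʳ eq) (*-assoc _ _ _)

        ≼-*ˡ : ∀ {x y z} → 𝒪 z → x ≼ y → x ≼ z * y
        ≼-*ˡ z∈ d = ≼-resp (*-comm _ _) (≼-*ʳ z∈ d)

        ≼-refl : ∀ {x} → x ≼ x
        ≼-refl = 1# , 𝒪-1 , sym (*-identityʳ _)

        ≼-∑ : ∀ n {x} {f : ℕ → Carrier} → (∀ i → i < n → x ≼ f i) → x ≼ ∑ n f
        ≼-∑ zero    d = 0# , 𝒪-0 , sym (zeroʳ _)
        ≼-∑ (suc n) d = ≼-+ (d 0 (s≤s z≤n)) (≼-∑ n λ i i<n → d (suc i) (s≤s i<n))

        ≼-∏ : ∀ n {x} {f : ℕ → Carrier} → (∀ i → 𝒪 (f i)) → ∀ k → k < n → x ≼ f k → x ≼ ∏ n f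
        ≼-∏ (suc n) u zero    _         d = ≼-*ʳ (𝒪-∏ n (u ∘ suc)) d
        ≼-∏ (suc n) u (suc k) (s≤s k<n) d = ≼-*ˡ (u 0) (≼-∏ n (u ∘ suc) k k<n d)

        complement : ∀ {i n} → i < n → suc i ℕ.+ suc (n ∸ suc i) ≡ suc n
        complement {i} {n} i<n = ≡.trans (ℕ.+-suc (suc i) (n ∸ suc i)) (≡.cong suc (ℕ.m+[n∸m]≡n i<n))

        module _ {x} (x∈ : 𝒪 x) where
          -- Among the factors of `Nσ/ x` is the conjugate of x whose exponent completes `suc i` to
          -- the full period; σ to the power `suc i` carries it to x.
          x≼σ[Nσ/] : ∀ i → i < s → x ≼ σ^ (suc i) (Nσ/ x)
          x≼σ[Nσ/] i i<s = ≼-resp (sym (σ^-hom.hom-∏ (suc i) s (λ k → σ^ (suc k) x)))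
            (≼-∏ s (λ k → 𝒪-σ (suc i) (𝒪-σ (suc k) x∈)) (s ∸ suc i) (ℕ.∸-monoʳ-< (s≤s z≤n) i<s)
              (≼-resp (sym (trans (σ-comm (suc i) (suc (s ∸ suc i)) x) (trans (reflexive (≡.cong (λ n → σ^ n x) (complement i<s))) (σ-period x)))) ≼-refl))

          x≼τ[Nτ/] : ∀ j → j < t → x ≼ τ^ (suc j) (Nτ/ (Nσ x))
          x≼τ[Nτ/] j j<t = ≼-resp (sym (τ^-hom.hom-∏ (suc j) t (λ k → τ^ (suc k) (Nσ x))))
            (≼-∏ t (λ k → 𝒪-τ (suc j) (𝒪-τ (suc k) (𝒪-Nσ x∈))) (t ∸ suc j) (ℕ.∸-monoʳ-< (s≤s z≤n) j<t)
              (≼-resp (sym (trans (τ-comm (suc j) (suc (t ∸ suc j)) (Nσ x)) (trans (reflexive (≡.cong (λ n → τ^ n (Nσ x)) (complement j<t))) (τ-period (Nσ x)))))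
                (≼-*ʳ (𝒪-∏ s λ i → 𝒪-σ (suc i) x∈) ≼-refl)))

          -- All conjugates of the adjugate other than itself are divisible by x.
          Trace≡ : ∀ {y} → 𝒪 y → x ≼ Trace (y * adjugate x) - y * adjugate x
          Trace≡ {y} y∈ = ≼-resp (solve 3 (λ w a b → a :+ b := (w :+ a) :+ b :- w) w _ _)
            (≼-+ (≼-∑ s λ i i<s → σ-term i i<s) (≼-∑ t λ j j<t → ≼-resp (sym (τ^-hom.hom-∑ (suc j) (suc s) (λ i → σ^ i w)))
              (≼-∑ (suc s) λ i _ → τ-term j j<t i)))
            where
            w : Carrier
            w = y * adjugate x
            σ-term : ∀ i → i < s → x ≼ σ^ (suc i) w
            σ-term i i<s = ≼-resp (sym (trans (σ^.*-homo (suc i) y (adjugate x)) (*-congˡ (σ^.*-homo (suc i) (Nσ/ x) (Nτ/ (Nσ x))))))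
              (≼-*ˡ (𝒪-σ (suc i) y∈) (≼-*ʳ (𝒪-σ (suc i) (𝒪-∏ t λ j → 𝒪-τ (suc j) (𝒪-Nσ x∈))) (x≼σ[Nσ/] i i<s)))
            τ-term : ∀ j → j < t → ∀ i → x ≼ τ^ (suc j) (σ^ i w)
            τ-term j j<t i = ≼-resp (sym (begin
              τ^ (suc j) (σ^ i w)                                               ≈⟨ τ^.⟦⟧-cong (suc j) (trans (σ^.⟦⟧-cong i (sym (*-assoc y (Nσ/ x) (Nτ/ (Nσ x)))))
                                                                                     (trans (σ^.*-homo i _ _) (*-congˡ (Nτ/-fixed i x)))) ⟩
              τ^ (suc j) (σ^ i (y * Nσ/ x) * Nτ/ (Nσ x))                        ≈⟨ τ^.*-homo (suc j) _ _ ⟩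
              τ^ (suc j) (σ^ i (y * Nσ/ x)) * τ^ (suc j) (Nτ/ (Nσ x))           ∎))
              (≼-*ˡ (𝒪-τ (suc j) (𝒪-σ i (𝒪-* y∈ (𝒪-∏ s λ i → 𝒪-σ (suc i) x∈)))) (x≼τ[Nτ/] j j<t))

        product-mod : ∀ n q {f g : ℕ → Carrier} → 𝒪 q → (∀ i → 𝒪 (f i)) → (∀ i → 𝒪 (g i)) → (∀ i → q ≼ g i - f i) → q ≼ ∏ n g - ∏ n f
        product-mod zero    q q∈ f∈ g∈ d = 0# , 𝒪-0 , trans (-‿inverseʳ 1#) (sym (zeroʳ q))
        product-mod (suc n) q {f} {g} q∈ f∈ g∈ d = ≼-resp
          (solve 4 (λ a b x y → (b :- a) :* y :+ a :* (y :- x) := b :* y :- a :* x) (f 0) (g 0) _ _)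
          (≼-+ (≼-*ʳ (𝒪-∏ n (g∈ ∘ suc)) (d 0)) (≼-*ˡ (f∈ 0) (product-mod n q q∈ (f∈ ∘ suc) (g∈ ∘ suc) (d ∘ suc))))

        -- Conjugation fixes the integer z, so the congruence holds between all conjugates and hence
        -- between their products.
        Norm-mod : ∀ z {x y} → 𝒪 x → 𝒪 y → int z ≼ y - x → int z ≼ Norm y - Norm x
        Norm-mod z {x} {y} x∈ y∈ (w , w∈ , eq) = product-mod (suc t) (int z) (𝒪-int z)
          (λ j → 𝒪-τ j (𝒪-Nσ x∈)) (λ j → 𝒪-τ j (𝒪-Nσ y∈)) λ j → τ-conj j
            (product-mod (suc s) (int z) (𝒪-int z) (λ i → 𝒪-σ i x∈) (λ i → 𝒪-σ i y∈) λ i →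
              σ^ i w , 𝒪-σ i w∈ , trans (sym (σ^-hom.hom-- i y x)) (trans (σ^.⟦⟧-cong i eq) (trans (σ^.*-homo i _ _) (*-congʳ (σ^-hom.hom-int i z)))))
          where
          τ-conj : ∀ j {u v} → int z ≼ v - u → int z ≼ τ^ j v - τ^ j u
          τ-conj j (w , w∈ , eq) = τ^ j w , 𝒪-τ j w∈ ,
            trans (sym (τ^-hom.hom-- j _ _)) (trans (τ^.⟦⟧-cong j eq) (trans (τ^.*-homo j _ _) (*-congʳ (τ^-hom.hom-int j z))))

      open Ring

      -- The ideal J = (q, x) and its residue field.

      module Ideal (q : ℕ) (x : Carrier) where

        J : Carrier → Set (c ⊔ ℓ₁)
        J y = ∃[ a ] ∃[ b ] 𝒪 a × 𝒪 b × y ≈ nat q * a + x * b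

        J-resp : ∀ {y z} → y ≈ z → J y → J z
        J-resp eq (a , b , a∈ , b∈ , eq′) = a , b , a∈ , b∈ , trans (sym eq) eq′

        J-+ : ∀ {y z} → J y → J z → J (y + z)
        J-+ (a , b , a∈ , b∈ , eq) (a′ , b′ , a′∈ , b′∈ , eq′) = a + a′ , b + b′ , 𝒪-+ a∈ a′∈ , 𝒪-+ b∈ b′∈ , trans (+-cong eq eq′)
          (solve 6 (λ q x a b a′ b′ → (q :* a :+ x :* b) :+ (q :* a′ :+ x :* b′) := q :* (a :+ a′) :+ x :* (b :+ b′)) (nat q) x a b a′ b′)

        J-*ˡ : ∀ {y z} → 𝒪 y → J z → J (y * z)
        J-*ˡ {y} y∈ (a , b , a∈ , b∈ , eq) = y * a , y * b , 𝒪-* y∈ a∈ , 𝒪-* y∈ b∈ , trans (*-congˡ eq)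
          (solve 5 (λ q x a b y → y :* (q :* a :+ x :* b) := q :* (y :* a) :+ x :* (y :* b)) (nat q) x a b y)

        J-*ʳ : ∀ {y z} → 𝒪 z → J y → J (y * z)
        J-*ʳ z∈ j = J-resp (*-comm _ _) (J-*ˡ z∈ j)

        J-neg : ∀ {y} → J y → J (- y)
        J-neg {y} j = J-resp (trans (*-congʳ (trans (int-neg (+ 1)) (-‿cong int-1))) (solve 1 (λ x → (:- con (+ 1)) :* x := :- x) y))
          (J-*ˡ (𝒪-int (ℤ.- + 1)) j)

        J-q : ∀ {y} → 𝒪 y → J (nat q * y)
        J-q {y} y∈ = y , 0# , y∈ , 𝒪-0 , sym (trans (+-congˡ (zeroʳ x)) (+-identityʳ _))

        J-x : ∀ {y} → x ≼ y → J y
        J-x {y} (w , w∈ , eq) = 0# , w , 𝒪-0 , w∈ , trans eq (sym (trans (+-congʳ (zeroʳ (nat q))) (+-identityˡ _)))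

        J-shift : ∀ {y z} → J (y - z) → J z → J y
        J-shift {y} {z} d j = J-resp (solve 2 (λ y z → (y :- z) :+ z := y) y z) (J-+ d j)

        J-shift′ : ∀ {y z} → J (y - z) → J y → J z
        J-shift′ {y} {z} d j = J-resp (solve 2 (λ y z → y :+ (:- (y :- z)) := z) y z) (J-+ j (J-neg d))

        -- A certificate that v ∉ J, provided that J is proper.
        Good : Carrier → Set (c ⊔ ℓ₁)
        Good v = 𝒪 v × ∃[ ε ] ∃[ d ] 𝒪 ε × ¬ (q ∣ d) × J (v * ε - nat d)

        module _ (q-prime : Prime q) where
          q∤1 : ¬ (q ∣ 1)
          q∤1 q∣1 = ℕ.<⇒≱ (ℕ.nonTrivial⇒n>1 q {{prime⇒nonTrivial q-prime}}) (∣⇒≤ q∣1)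

          Good-1 : Good 1#
          Good-1 = 𝒪-1 , 1# , 1 , 𝒪-1 , q∤1 , J-resp (trans (zeroʳ x) (sym (trans (+-cong (*-identityˡ 1#) (-‿cong int-1)) (-‿inverseʳ 1#))))
            (J-x (0# , 𝒪-0 , refl))

          Good-* : ∀ {u v} → Good u → Good v → Good (u * v)
          Good-* {u} {v} (u∈ , ε , d , ε∈ , q∤d , j) (v∈ , ε′ , d′ , ε′∈ , q∤d′ , j′) = 𝒪-* u∈ v∈ , ε * ε′ , d ℕ.* d′ , 𝒪-* ε∈ ε′∈ ,
            (λ q∣ → either (euclidsLemma d d′ q-prime q∣)) ,
            J-resp (trans (solve 6 (λ u v ε ε′ d d′ → (u :* ε :- d) :* (v :* ε′) :+ d :* (v :* ε′ :- d′) := u :* v :* (ε :* ε′) :- d :* d′) u v ε ε′ (nat d) (nat d′)) (+-congˡ (-‿cong (sym (nat-* d d′)))))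
              (J-+ (J-*ʳ (𝒪-* v∈ ε′∈) j) (J-*ˡ (𝒪-int (+ d)) j′))
            where
            either : q ∣ d ⊎ q ∣ d′ → ⊥
            either (inj₁ h) = q∤d h
            either (inj₂ h) = q∤d′ h

          Good-∏ : ∀ n {f : ℕ → Carrier} → (∀ i → i < n → Good (f i)) → Good (∏ n f)
          Good-∏ zero    g = Good-1
          Good-∏ (suc n) g = Good-* (g 0 (s≤s z≤n)) (Good-∏ n λ i i<n → g (suc i) (s≤s i<n))

          -- As d is prime to q, Bézout writes y as an integral combination of d y and q y, both of
          -- which lie in J.
          J-cancel : ∀ {d y} → ¬ (q ∣ d) → 𝒪 y → J (nat d * y) → J y
          J-cancel {d} {y} q∤d y∈ j = from (Coprimality.coprime-Bézout d⊥q)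
            where
            d⊥q : Coprime d q
            d⊥q {k} (k∣d , k∣q) = either (prime⇒irreducible q-prime k∣q)
              where
              either : k ≡ 1 ⊎ k ≡ q → k ≡ 1
              either (inj₁ k≡1)    = k≡1
              either (inj₂ ≡.refl) = contradiction k∣d q∤d
            identity : ∀ a b → 1 ℕ.+ a ≡ b → nat b * y - nat a * y ≈ y
            identity a b eq = trans (+-congʳ (*-congʳ (trans (reflexive (≡.cong nat (≡.sym eq))) (nat-suc a))))
              (solve 2 (λ a y → (con (+ 1) :+ a) :* y :- a :* y := y) (nat a) y)
            multiple-d : ∀ k → J (nat (k ℕ.* d) * y)
            multiple-d k = J-resp (trans (sym (*-assoc _ _ _)) (*-congʳ (sym (nat-* k d)))) (J-*ˡ (𝒪-int (+ k)) j)
            multiple-q : ∀ k → J (nat (k ℕ.* q) * y)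
            multiple-q k = J-resp (trans (solve 3 (λ q k y → q :* (k :* y) := k :* q :* y) (nat q) (nat k) y) (*-congʳ (sym (nat-* k q)))) (J-q (𝒪-* (𝒪-int (+ k)) y∈))
            from : Bézout.Identity 1 d q → J y
            from (Bézout.+- k l eq) = J-resp (identity (l ℕ.* q) (k ℕ.* d) eq) (J-+ (multiple-d k) (J-neg (multiple-q l)))
            from (Bézout.-+ k l eq) = J-resp (identity (k ℕ.* d) (l ℕ.* q) eq) (J-+ (multiple-q l) (J-neg (multiple-d k)))

          -- The certificate makes u a unit modulo J: from u ε ≡ d it follows that d y ≡ y u ε ≡ 0,
          -- and d can be cancelled.
          Good-cancel : ∀ {u y} → Good u → 𝒪 y → J (y * u) → J y
          Good-cancel {u} {y} (u∈ , ε , d , ε∈ , q∤d , j) y∈ yu∈J = J-cancel q∤d y∈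
            (J-shift′ (J-resp (solve 4 (λ y u ε d → y :* (u :* ε :- d) := y :* u :* ε :- d :* y) y u ε (nat d)) (J-*ˡ y∈ j)) (J-*ʳ ε∈ yu∈J))

      module PrimeIdeal (q : ℕ) (q-prime : Prime q) (x : Carrier) where
        open Ideal q x

        -- The data making J = (q, x) a prime ideal with residue field 𝔽_q, unramified over ℚ.
        record Unramified : Set (c ⊔ ℓ₁) where
          field
            x∈𝒪     : 𝒪 x
            q∣Norm  : ∃[ z ] Norm x ≈ int (+ q ℤ.* z)
            good-σ  : ∀ i → i < s → Good (σ^ (suc i) x)
            good-τ  : ∀ j → j < t → ∀ i → i < suc s → Good (τ^ (suc j) (σ^ i x))

        module _ (U : Unramified) where
          open Unramified U

          good-adjugate : Good (adjugate x)
          good-adjugate = Good-* q-prime (Good-∏ q-prime s good-σ) (Good-∏ q-prime t λ j j<t →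
            good-resp (sym (τ^-hom.hom-∏ (suc j) (suc s) (λ i → σ^ i x))) (Good-∏ q-prime (suc s) λ i i<s → good-τ j j<t i i<s))
            where
            good-resp : ∀ {u v} → u ≈ v → Good u → Good v
            good-resp eq (u∈ , ε , d , ε∈ , q∤d , j) = 𝒪-resp eq u∈ , ε , d , ε∈ , q∤d , J-resp (+-congʳ (*-congʳ eq)) j

          -- From 1 = q a + x b follows 1 ≡ x b modulo q. Taking norms gives 1 ≡ Nr(x) Nr(b) ≡ 0
          -- modulo q, and this descends to ℤ.
          1∉J : ¬ J 1#
          1∉J (a , b , a∈ , b∈ , 1≈qa+xb) = from (Norm-mod (+ q) (𝒪-* x∈𝒪 b∈) 𝒪-1 (a , a∈ , difference))
            where
            difference : 1# - x * b ≈ nat q * a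
            difference = trans (+-congʳ 1≈qa+xb) (solve 2 (λ u v → (u :+ v) :- v := u) (nat q * a) (x * b))
            Norm-1 : Norm 1# ≈ 1#
            Norm-1 = trans (Norm-cong (sym int-1)) (trans (Norm-int (+ 1)) (trans (^-congˡ (suc t) (trans (^-congˡ (suc s) int-1) (1^n≈1 (suc s)))) (1^n≈1 (suc t))))
            z = proj₁ q∣Norm
            from : nat q ≼ Norm 1# - Norm (x * b) → ⊥
            from (w , w∈ , eq) = conclude (quotient-integer {q} {+ 1} 0<q (𝒪-+ w∈ (𝒪-* (𝒪-int z) (𝒪-Norm b∈))) (begin
              int (+ 1)                                            ≈⟨ trans int-1 (sym Norm-1) ⟩
              Norm 1#                                              ≈⟨ solve 2 (λ u v → u := (u :- v) :+ v) (Norm 1#) (Norm (x * b)) ⟩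
              (Norm 1# - Norm (x * b)) + Norm (x * b)              ≈⟨ +-cong eq (trans (Norm-* x b) (*-congʳ (trans (proj₂ q∣Norm) (int-* (+ q) z)))) ⟩
              nat q * w + nat q * int z * Norm b                   ≈⟨ solve 4 (λ q w z n → q :* w :+ q :* z :* n := q :* (w :+ z :* n)) (nat q) w (int z) (Norm b) ⟩
              nat q * (w + int z * Norm b)                         ∎))
              where
              0<q : 0 < q
              0<q = ℕ.>-nonZero⁻¹ q {{prime⇒nonZero q-prime}}
              conclude : ∃[ k ] _ × + 1 ≡ + q ℤ.* k → ⊥
              conclude (k , _ , 1≡qk) = q∤1 q-prime (divides ℤ.∣ k ∣ (≡.trans (≡.cong ℤ.∣_∣ 1≡qk) (≡.trans (ℤ.abs-* (+ q) k) (ℕ.*-comm q ℤ.∣ k ∣))))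

          J-abs : ∀ {z} → J (int z) → J (nat ℤ.∣ z ∣)
          J-abs {+ n}      j = j
          J-abs { -[1+ n ]} j = J-resp (sym (int-neg -[1+ n ])) (J-neg j)

          J-int : ∀ {z} → J (int z) → q ∣ ℤ.∣ z ∣
          J-int {z} j with q ∣? ℤ.∣ z ∣
          ... | yes q∣z = q∣z
          ... | no  q∤z = contradiction (J-cancel q-prime q∤z 𝒪-1 (J-resp (sym (*-identityʳ _)) (J-abs j))) 1∉J

          Good⇒∉J : ∀ {u} → Good u → ¬ J u
          Good⇒∉J {u} g j = 1∉J (Good-cancel q-prime g 𝒪-1 (J-resp (sym (*-identityˡ u)) j))

          -- The integer is the trace of `y * adjugate x`: by `Trace≡` the other conjugates
          -- contribute multiples of x. Because the adjugate is a unit modulo J, membership of y in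
          -- J amounts to divisibility of this integer by q, which makes J decidable.
          residue : ∀ {y} → 𝒪 y → ∃[ z ] J (int z - y * adjugate x)
          residue {y} y∈ = proj₁ trace , J-resp (+-congʳ (proj₂ trace)) (J-x (Trace≡ x∈𝒪 y∈))
            where trace = Trace-integer (𝒪-* y∈ (𝒪-adjugate x∈𝒪))

          q∣residue⇒J : ∀ {y} (y∈ : 𝒪 y) → q ∣ ℤ.∣ proj₁ (residue y∈) ∣ → J y
          q∣residue⇒J {y} y∈ q∣z = Good-cancel q-prime good-adjugate y∈ (J-shift′ (proj₂ (residue y∈)) (int-J q∣z))
            where
            int-J : ∀ {z} → q ∣ ℤ.∣ z ∣ → J (int z)
            int-J {z} (divides k eq) = sign z eq
              where
              nat-J : ∀ {n} → n ≡ k ℕ.* q → J (nat n)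
              nat-J eq = J-resp (trans (trans (sym (nat-* q k)) (reflexive (≡.cong nat (ℕ.*-comm q k)))) (reflexive (≡.cong nat (≡.sym eq)))) (J-q (𝒪-int (+ k)))
              sign : ∀ z → ℤ.∣ z ∣ ≡ k ℕ.* q → J (int z)
              sign (+ n)    eq = nat-J eq
              sign -[1+ n ] eq = J-resp (sym (int-neg (+ suc n))) (J-neg (nat-J eq))

          J⇒q∣residue : ∀ {y} (y∈ : 𝒪 y) → J y → q ∣ ℤ.∣ proj₁ (residue y∈) ∣
          J⇒q∣residue y∈ j = J-int (J-shift (proj₂ (residue y∈)) (J-*ʳ (𝒪-adjugate x∈𝒪) j))

          J? : ∀ {y} → 𝒪 y → Dec (J y)
          J? y∈ = map′ (q∣residue⇒J y∈) (J⇒q∣residue y∈) (q ∣? ℤ.∣ proj₁ (residue y∈) ∣)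

          -- The residues u and v satisfy u v ≡ y z a² modulo J with a the adjugate of x, so q
          -- divides the integer u v and Euclid's lemma decides which factor lies in J.
          J-prime : ∀ {y z} → 𝒪 y → 𝒪 z → J (y * z) → J y ⊎ J z
          J-prime {y} {z} y∈ z∈ yz∈J = either (euclidsLemma ℤ.∣ u ∣ ℤ.∣ v ∣ q-prime (≡.subst (q ∣_) (ℤ.abs-* u v) (J-int uv∈J)))
            where
            a = adjugate x
            a∈ = 𝒪-adjugate x∈𝒪
            u = proj₁ (residue y∈)
            v = proj₁ (residue z∈)
            uv∈J : J (int (u ℤ.* v))
            uv∈J = J-resp (sym (int-* u v)) (J-shift (J-resp
              (solve 5 (λ u v y z a → (u :- y :* a) :* v :+ y :* a :* (v :- z :* a) := u :* v :- y :* z :* (a :* a)) (int u) (int v) y z a)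
              (J-+ (J-*ʳ (𝒪-int v) (proj₂ (residue y∈))) (J-*ˡ (𝒪-* y∈ a∈) (proj₂ (residue z∈))))) (J-*ʳ (𝒪-* a∈ a∈) yz∈J))
            either : q ∣ ℤ.∣ u ∣ ⊎ q ∣ ℤ.∣ v ∣ → J y ⊎ J z
            either (inj₁ h) = inj₁ (q∣residue⇒J y∈ h)
            either (inj₂ h) = inj₂ (q∣residue⇒J z∈ h)

          ∉J-* : ∀ {y z} → 𝒪 y → 𝒪 z → ¬ J y → ¬ J z → ¬ J (y * z)
          ∉J-* y∈ z∈ y∉ z∉ j = either (J-prime y∈ z∈ j)
            where
            either : _ ⊎ _ → ⊥
            either (inj₁ h) = y∉ h
            either (inj₂ h) = z∉ h

          ∉J-^ : ∀ n {y} → 𝒪 y → ¬ J y → ¬ J (y ^ n)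
          ∉J-^ zero    y∈ y∉ = 1∉J
          ∉J-^ (suc n) y∈ y∉ = ∉J-* y∈ (𝒪-^ n y∈) y∉ (∉J-^ n y∈ y∉)

          ∉J-∏ : ∀ n {f : ℕ → Carrier} → (∀ i → 𝒪 (f i)) → (∀ i → i < n → ¬ J (f i)) → ¬ J (∏ n f)
          ∉J-∏ zero    f∈ f∉ = 1∉J
          ∉J-∏ (suc n) f∈ f∉ = ∉J-* (f∈ 0) (𝒪-∏ n (f∈ ∘ suc)) (f∉ 0 (s≤s z≤n)) (∉J-∏ n (f∈ ∘ suc) λ i i<n → f∉ (suc i) (s≤s i<n))

      -- The valuation at J when the norm of x is q times an integer prime to q.

      module Valuation (q : ℕ) (q-prime : Prime q) (x : Carrier) (U : PrimeIdeal.Unramified q q-prime x)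
        (z : ℤ) (Norm≈qz : Norm x ≈ int (+ q ℤ.* z)) (q∤z : ¬ (q ∣ ℤ.∣ z ∣)) where
        open Ideal q x
        open PrimeIdeal q q-prime x
        open Unramified U

        1<q : 1 < q
        1<q = ℕ.nonTrivial⇒n>1 q {{prime⇒nonTrivial q-prime}}

        z∉J : ¬ J (int z)
        z∉J j = q∤z (J-int U j)

        x≉0 : x ≉ 0#
        x≉0 x≈0 = z∉J (J-resp (sym (*-cancelˡ (nat≉0 q (ℕ.<⇒≤ 1<q)) (begin
          nat q * int z        ≈⟨ trans (sym (int-* (+ q) z)) (sym Norm≈qz) ⟩
          Norm x               ≈⟨ x*adjugate x ⟨
          x * adjugate x       ≈⟨ trans (*-congʳ x≈0) (zeroˡ _) ⟩
          0#                   ≈⟨ zeroʳ (nat q) ⟨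
          nat q * 0#           ∎))) (J-x (0# , 𝒪-0 , sym (zeroʳ x))))

        -- z J ⊆ x 𝒪, because x times its adjugate is q z.
        J⇒x≼ : ∀ {y} → J y → x ≼ int z * y
        J⇒x≼ {y} (a , b , a∈ , b∈ , eq) = adjugate x * a + int z * b , 𝒪-+ (𝒪-* (𝒪-adjugate x∈𝒪) a∈) (𝒪-* (𝒪-int z) b∈) , (begin
          int z * y                                  ≈⟨ *-congˡ eq ⟩
          int z * (nat q * a + x * b)                ≈⟨ solve 5 (λ z q a x b → z :* (q :* a :+ x :* b) := q :* z :* a :+ x :* (z :* b)) (int z) (nat q) a x b ⟩
          nat q * int z * a + x * (int z * b)        ≈⟨ +-congʳ (*-congʳ (trans (sym (int-* (+ q) z)) (trans (sym Norm≈qz) (sym (x*adjugate x))))) ⟩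
          x * adjugate x * a + x * (int z * b)       ≈⟨ solve 4 (λ x d a v → x :* d :* a :+ x :* v := x :* (d :* a :+ v)) x (adjugate x) a (int z * b) ⟩
          x * (adjugate x * a + int z * b)           ∎)

        norm : ∀ {y} → 𝒪 y → ℕ
        norm y∈ = ℤ.∣ proj₁ (Norm-integer y∈) ∣

        norm-step : ∀ {y y₁} (y∈ : 𝒪 y) (y₁∈ : 𝒪 y₁) → int z * y ≈ x * y₁ →
                    (ℤ.∣ z ∣ ℕ.^ suc s) ℕ.^ suc t ℕ.* norm y∈ ≡ q ℕ.* ℤ.∣ z ∣ ℕ.* norm y₁∈
        norm-step {y} {y₁} y∈ y₁∈ eq = ≡.trans (≡.cong (ℕ._* norm y∈) (≡.sym (≡.trans (abs-^ (z ℤ.^ suc s) (suc t)) (≡.cong (ℕ._^ suc t) (abs-^ z (suc s))))))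
          (≡.trans (≡.sym (ℤ.abs-* ((z ℤ.^ suc s) ℤ.^ suc t) n)) (≡.trans (≡.cong ℤ.∣_∣ identity)
          (≡.trans (ℤ.abs-* (+ q ℤ.* z) n₁) (≡.cong (ℕ._* norm y₁∈) (ℤ.abs-* (+ q) z)))))
          where
          n  = proj₁ (Norm-integer y∈)
          n₁ = proj₁ (Norm-integer y₁∈)
          identity : (z ℤ.^ suc s) ℤ.^ suc t ℤ.* n ≡ + q ℤ.* z ℤ.* n₁
          identity = int-injective (begin
            int ((z ℤ.^ suc s) ℤ.^ suc t ℤ.* n)        ≈⟨ int-* ((z ℤ.^ suc s) ℤ.^ suc t) n ⟩
            int ((z ℤ.^ suc s) ℤ.^ suc t) * int n      ≈⟨ *-cong (trans (int-^ (z ℤ.^ suc s) (suc t)) (^-congˡ (suc t) (int-^ z (suc s)))) (sym (proj₂ (Norm-integer y∈))) ⟩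
            (int z ^ suc s) ^ suc t * Norm y           ≈⟨ *-congʳ (Norm-int z) ⟨
            Norm (int z) * Norm y                      ≈⟨ Norm-* (int z) y ⟨
            Norm (int z * y)                           ≈⟨ Norm-cong eq ⟩
            Norm (x * y₁)                              ≈⟨ Norm-* x y₁ ⟩
            Norm x * Norm y₁                           ≈⟨ *-cong Norm≈qz (proj₂ (Norm-integer y₁∈)) ⟩
            int (+ q ℤ.* z) * int n₁                   ≈⟨ int-* (+ q ℤ.* z) n₁ ⟨
            int (+ q ℤ.* z ℤ.* n₁)                     ∎)

        -- Norms turn z y = x y₁ into ∣z∣ᴺ Nr(y) = ± q ∣z∣ Nr(y₁), up to sign, where N is the number
        -- of conjugates. As z is prime to q, passing from y to y₁ removes one factor q.
        norm-descends : ∀ k {y y₁} (y∈ : 𝒪 y) (y₁∈ : 𝒪 y₁) → int z * y ≈ x * y₁ → ¬ (q ℕ.^ suc k ∣ norm y∈) → ¬ (q ℕ.^ k ∣ norm y₁∈)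
        norm-descends k y∈ y₁∈ eq ∤ qᵏ∣ = ∤ (Coprimality.coprime-divisor
          (coprime-^ (suc k) (Coprimality.sym (coprime-^ (suc t) (coprime-^ (suc s) (prime∤⇒coprime q-prime q∤z)))))
          (≡.subst (q ℕ.^ suc k ∣_) (≡.sym (≡.trans (norm-step y∈ y₁∈ eq) (≡.trans (ℕ.*-assoc q ℤ.∣ z ∣ (norm y₁∈))
            (≡.trans (≡.cong (q ℕ.*_) (ℕ.*-comm ℤ.∣ z ∣ (norm y₁∈))) (≡.sym (ℕ.*-assoc q (norm y₁∈) ℤ.∣ z ∣))))))
            (∣m⇒∣m*n ℤ.∣ z ∣ (*-pres-∣ (divides 1 (≡.sym (ℕ.*-identityˡ q))) qᵏ∣))))

        -- The equation y = xⁿ v / w in the localization at J, with v / w a unit there, written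
        -- without fractions.
        HasValuation : Carrier → ℕ → Set (c ⊔ ℓ₁)
        HasValuation y n = ∃[ w ] ∃[ v ] 𝒪 w × 𝒪 v × ¬ J w × ¬ J v × w * y ≈ x ^ n * v

        -- The number k is the fuel of the recursion: each division by x replaces a norm not
        -- divisible by qᵏ⁺¹ with one not divisible by qᵏ, and q⁰ divides everything.
        valuation : ∀ k {y} (y∈ : 𝒪 y) → ¬ (q ℕ.^ k ∣ norm y∈) → ∃[ n ] HasValuation y n
        valuation zero    y∈ ∤ = contradiction (divides (norm y∈) (≡.sym (ℕ.*-identityʳ (norm y∈)))) ∤
        valuation (suc k) {y} y∈ ∤ = by (J? U y∈)
          where
          by : Dec (J y) → ∃[ n ] HasValuation y n
          by (no y∉J)  = 0 , 1# , y , 𝒪-1 , y∈ , 1∉J U , y∉J , refl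
          by (yes y∈J) = from (J⇒x≼ y∈J)
            where
            from : x ≼ int z * y → ∃[ n ] HasValuation y n
            from (y₁ , y₁∈ , eq) = step (valuation k y₁∈ (norm-descends k y∈ y₁∈ eq ∤))
              where
              step : ∃[ n ] HasValuation y₁ n → ∃[ n ] HasValuation y n
              step (n , w , v , w∈ , v∈ , w∉ , v∉ , eq′) = suc n , w * int z , v , 𝒪-* w∈ (𝒪-int z) , v∈ , ∉J-* U w∈ (𝒪-int z) w∉ z∉J , v∉ , (begin
                w * int z * y         ≈⟨ trans (*-assoc _ _ _) (*-congˡ eq) ⟩
                w * (x * y₁)          ≈⟨ solve 3 (λ w x y → w :* (x :* y) := x :* (w :* y)) w x y₁ ⟩
                x * (w * y₁)          ≈⟨ trans (*-congˡ eq′) (sym (*-assoc _ _ _)) ⟩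
                x ^ suc n * v         ∎)

        valuation-exists : ∀ {y} → 𝒪 y → y ≉ 0# → ∃[ n ] HasValuation y n
        -- The norm itself is enough fuel, because n < qⁿ.
        valuation-exists {y} y∈ y≉0 = valuation (norm y∈) y∈ λ q^∣ → ℕ.<⇒≱ (n<b^n 1<q (norm y∈)) (∣⇒≤ {{ℕ.≢-nonZero norm≢0}} q^∣)
          where
          norm≢0 : ¬ (norm y∈ ≡ 0)
          norm≢0 eq = Norm-≉0 y≉0 (trans (proj₂ (Norm-integer y∈)) (trans (reflexive (≡.cong int (ℤ.∣i∣≡0⇒i≡0 eq))) int-0))

        exponent-≮ : ∀ {a b u v} → 𝒪 v → ¬ J u → x ^ a * u ≈ x ^ b * v → ¬ (a < b)
        exponent-≮ {a} {b} {u} {v} v∈ u∉J eq a<b = u∉J (J-resp (sym (*-cancelˡ (^-≉0 a x≉0) (begin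
          x ^ a * u                      ≈⟨ eq ⟩
          x ^ b * v                      ≡⟨ ≡.cong (λ n → x ^ n * v) (ℕ.m+[n∸m]≡n (ℕ.<⇒≤ a<b)) ⟨
          x ^ (a ℕ.+ (b ∸ a)) * v        ≈⟨ trans (*-congʳ (^-homo-* x a (b ∸ a))) (*-assoc _ _ _) ⟩
          x ^ a * (x ^ (b ∸ a) * v)      ∎))) (J-x (divisible (b ∸ a) (ℕ.m<n⇒0<n∸m a<b))))
          where
          divisible : ∀ n → 0 < n → x ≼ x ^ n * v
          divisible (suc n) _ = x ^ n * v , 𝒪-* (𝒪-^ n x∈𝒪) v∈ , *-assoc x (x ^ n) v

        exponent-unique : ∀ {a b u v} → 𝒪 u → 𝒪 v → ¬ J u → ¬ J v → x ^ a * u ≈ x ^ b * v → a ≡ b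
        exponent-unique u∈ v∈ u∉J v∉J eq = ℕ.≤-antisym (ℕ.≮⇒≥ (exponent-≮ u∈ v∉J (sym eq))) (ℕ.≮⇒≥ (exponent-≮ v∈ u∉J eq))

        -- The element y may lie outside 𝒪, so it is written as (d y) / d. If a and b are the
        -- valuations of numerator and denominator, comparing the exponents of x gives a p = b p +
        -- e, whence p ∣ e.
        not-power : ∀ {p e u} → ¬ (p ∣ e) → 𝒪 u → ¬ J u → ∀ {y} → y ≉ 0# → ¬ (y ^ p ≈ x ^ e * u)
        not-power {p} {e} {u} p∤e u∈ u∉J {y} y≉0 yᵖ≈ = from (𝒪-clear y)
          where
          from : ∃[ d ] 0 < d × 𝒪 (nat d * y) → ⊥
          from (d , 0<d , dy∈) = compare (valuation-exists dy∈ (*-≉0 (nat≉0 d 0<d) y≉0)) (valuation-exists (𝒪-int (+ d)) (nat≉0 d 0<d))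
            where
            compare : ∃[ n ] HasValuation (nat d * y) n → ∃[ n ] HasValuation (nat d) n → ⊥
            compare (a , w , v , w∈ , v∈ , w∉ , v∉ , eq) (b , w′ , v′ , w′∈ , v′∈ , w′∉ , v′∉ , eq′) = p∤e (∣m+n∣m⇒∣n
              (≡.subst (p ∣_) ap≡bp+e (divides a ≡.refl)) (divides b ≡.refl))
              where
              ap≡bp+e : a ℕ.* p ≡ b ℕ.* p ℕ.+ e
              ap≡bp+e = exponent-unique
                (𝒪-* (𝒪-^ p v∈) (𝒪-^ p w′∈)) (𝒪-* (𝒪-* (𝒪-^ p v′∈) (𝒪-^ p w∈)) u∈)
                (∉J-* U (𝒪-^ p v∈) (𝒪-^ p w′∈) (∉J-^ U p v∈ v∉) (∉J-^ U p w′∈ w′∉))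
                (∉J-* U (𝒪-* (𝒪-^ p v′∈) (𝒪-^ p w∈)) u∈ (∉J-* U (𝒪-^ p v′∈) (𝒪-^ p w∈) (∉J-^ U p v′∈ v′∉) (∉J-^ U p w∈ w∉)) u∉J)
                (begin
                  x ^ (a ℕ.* p) * (v ^ p * w′ ^ p)               ≈⟨ trans (*-congʳ (sym (^-assocʳ x a p))) (sym (*-assoc _ _ _)) ⟩
                  (x ^ a) ^ p * v ^ p * w′ ^ p                   ≈⟨ *-congʳ (trans (sym (^-distrib-* (x ^ a) v p)) (trans (^-congˡ p (sym eq)) (trans (^-distrib-* w (nat d * y) p) (*-congˡ (^-distrib-* (nat d) y p))))) ⟩
                  w ^ p * (nat d ^ p * y ^ p) * w′ ^ p           ≈⟨ *-congʳ (*-congˡ (*-congˡ yᵖ≈)) ⟩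
                  w ^ p * (nat d ^ p * (x ^ e * u)) * w′ ^ p     ≈⟨ solve 5 (λ w d x u w′ → w :* (d :* (x :* u)) :* w′ := (w′ :* d) :* x :* (w :* u)) (w ^ p) (nat d ^ p) (x ^ e) u (w′ ^ p) ⟩
                  (w′ ^ p * nat d ^ p) * x ^ e * (w ^ p * u)     ≈⟨ *-congʳ (*-congʳ (trans (sym (^-distrib-* w′ (nat d) p)) (trans (^-congˡ p eq′) (trans (^-distrib-* (x ^ b) v′ p) (*-congʳ (^-assocʳ x b p)))))) ⟩
                  x ^ (b ℕ.* p) * v′ ^ p * x ^ e * (w ^ p * u)   ≈⟨ solve 5 (λ b v x w u → b :* v :* x :* (w :* u) := (b :* x) :* (v :* w :* u)) (x ^ (b ℕ.* p)) (v′ ^ p) (x ^ e) (w ^ p) u ⟩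
                  (x ^ (b ℕ.* p) * x ^ e) * (v′ ^ p * w ^ p * u) ≈⟨ *-congʳ (sym (^-homo-* x (b ℕ.* p) e)) ⟩
                  x ^ (b ℕ.* p ℕ.+ e) * (v′ ^ p * w ^ p * u)     ∎)

      -- Existence of a prime ideal at which x has valuation one.

      module SimplePrimes where

        -- A prime ideal (q, x) at which x has valuation one.
        record SimplePrime : Set (c ⊔ ℓ₁) where
          constructor simple-prime
          field
            q          : ℕ
            q-prime    : Prime q
            x          : Carrier
            unramified : PrimeIdeal.Unramified q q-prime x
            z          : ℤ
            Norm≈qz    : Norm x ≈ int (+ q ℤ.* z)
            q∤z        : ¬ (q ∣ ℤ.∣ z ∣)

        -- Together with q, the elements x and x + q generate the same ideal, and conjugates change
        -- only by q. So x + q inherits every condition at J and may replace x when q² divides the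
        -- norm of x.
        module Shift (q : ℕ) (q-prime : Prime q) (x : Carrier) (U : PrimeIdeal.Unramified q q-prime x) where
          private
            module J = Ideal q x
            module J′ = Ideal q (x + nat q)
            module P = PrimeIdeal q q-prime x
            module P′ = PrimeIdeal q q-prime (x + nat q)
          open P.Unramified U

          x′ : Carrier
          x′ = x + nat q

          x′∈𝒪 : 𝒪 x′
          x′∈𝒪 = 𝒪-+ x∈𝒪 (𝒪-int (+ q))

          0<q : 0 < q
          0<q = ℕ.>-nonZero⁻¹ q {{prime⇒nonZero q-prime}}

          J⇒J′ : ∀ {y} → J.J y → J′.J y
          J⇒J′ (a , b , a∈ , b∈ , eq) = a - b , b , 𝒪-- a∈ b∈ , b∈ ,
            trans eq (solve 4 (λ q x a b → q :* a :+ x :* b := q :* (a :- b) :+ (x :+ q) :* b) (nat q) x a b)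

          good-shift : ∀ {v v′} → v′ ≈ v + nat q → J.Good v → J′.Good v′
          good-shift {v} {v′} eq (v∈ , ε , d , ε∈ , q∤d , j) = 𝒪-resp (sym eq) (𝒪-+ v∈ (𝒪-int (+ q))) , ε , d , ε∈ , q∤d ,
            J′.J-resp (trans (solve 4 (λ v ε d q → (v :* ε :- d) :+ q :* ε := (v :+ q) :* ε :- d) v ε (nat d) (nat q)) (+-congʳ (*-congʳ (sym eq))))
              (J′.J-+ (J⇒J′ j) (J′.J-q ε∈))

          q∣Norm′ : ∃[ z ] Norm x′ ≈ int (+ q ℤ.* z)
          q∣Norm′ = from (Norm-mod (+ q) x∈𝒪 x′∈𝒪 (1# , 𝒪-1 , solve 2 (λ x q → x :+ q :- x := q :* con (+ 1)) x (nat q)))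
            where
            z = proj₁ q∣Norm
            R′ = Norm-integer x′∈𝒪
            from : int (+ q) ≼ Norm x′ - Norm x → ∃[ z ] Norm x′ ≈ int (+ q ℤ.* z)
            from (w , w∈ , eq) = proj₁ k , trans (proj₂ R′) (reflexive (≡.cong int (proj₂ (proj₂ k))))
              where
              k : ∃[ k ] int z + w ≈ int k × proj₁ R′ ≡ + q ℤ.* k
              k = quotient-integer 0<q (𝒪-+ (𝒪-int z) w∈) (begin
                int (proj₁ R′)                     ≈⟨ proj₂ R′ ⟨
                Norm x′                            ≈⟨ solve 2 (λ a b → a := b :+ (a :- b)) (Norm x′) (Norm x) ⟩
                Norm x + (Norm x′ - Norm x)        ≈⟨ +-cong (trans (proj₂ q∣Norm) (int-* (+ q) z)) eq ⟩
                nat q * int z + nat q * w          ≈⟨ distribˡ (nat q) (int z) w ⟨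
                nat q * (int z + w)                ∎)

          unramified′ : P′.Unramified
          unramified′ = record
            { x∈𝒪    = x′∈𝒪
            ; q∣Norm = q∣Norm′
            ; good-σ = λ i i<s → good-shift (trans (σ^.+-homo (suc i) x (nat q)) (+-congˡ (σ^-hom.hom-int (suc i) (+ q)))) (good-σ i i<s)
            ; good-τ = λ j j<t i i<s → good-shift (trans (τ^.⟦⟧-cong (suc j) (trans (σ^.+-homo i x (nat q)) (+-congˡ (σ^-hom.hom-int i (+ q)))))
                (trans (τ^.+-homo (suc j) _ _) (+-congˡ (τ^-hom.hom-int (suc j) (+ q))))) (good-τ j j<t i i<s)
            }

          -- Since q = x′ - x, one has q a a′ = (x′ a′) a - (x a) a′, and both terms on the right
          -- are divisible by q². Applied to adjugates, it places their product in J.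
          cofactor-product : ∀ {a a′ k k′} → x * a ≈ nat q * (nat q * k) → x′ * a′ ≈ nat q * (nat q * k′) →
                             a * a′ ≈ nat q * (k′ * a - k * a′)
          cofactor-product {a} {a′} {k} {k′} eq eq′ = *-cancelˡ (nat≉0 q 0<q) (begin
            nat q * (a * a′)                                         ≈⟨ solve 4 (λ q x a a′ → q :* (a :* a′) := (x :+ q) :* a′ :* a :- x :* a :* a′) (nat q) x a a′ ⟩
            x′ * a′ * a - x * a * a′                                 ≈⟨ +-cong (*-congʳ eq′) (-‿cong (*-congʳ eq)) ⟩
            nat q * (nat q * k′) * a - nat q * (nat q * k) * a′
              ≈⟨ solve 5 (λ q k k′ a a′ → q :* (q :* k′) :* a :- q :* (q :* k) :* a′ := q :* (q :* (k′ :* a :- k :* a′))) (nat q) k k′ a a′ ⟩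
            nat q * (nat q * (k′ * a - k * a′))                      ∎)

          square-multiple : ∀ {y z k} → Norm y ≈ int (+ q ℤ.* z) → z ≡ + q ℤ.* k → y * adjugate y ≈ nat q * (nat q * int k)
          square-multiple {y} {z} {k} eq z≡ =
            trans (x*adjugate y) (trans eq (trans (int-* (+ q) z) (*-congˡ (trans (reflexive (≡.cong int z≡)) (int-* (+ q) k)))))

          -- With q² dividing the norms of both x and x + q, q would divide the product of their adjugates.
          not-both : ∀ {z z′} → Norm x ≈ int (+ q ℤ.* z) → Norm x′ ≈ int (+ q ℤ.* z′) →
                     (∃[ k ] z ≡ + q ℤ.* k) → (∃[ k ] z′ ≡ + q ℤ.* k) → ⊥
          not-both eq eq′ (k , z≡) (k′ , z′≡) = either (P.J-prime U a∈ a′∈ (J.J-resp (sym aa′≈) (J.J-q (𝒪-- (𝒪-* (𝒪-int k′) a∈) (𝒪-* (𝒪-int k) a′∈)))))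
            where
            a∈ : 𝒪 (adjugate x)
            a∈ = 𝒪-adjugate x∈𝒪
            a′∈ : 𝒪 (adjugate x′)
            a′∈ = 𝒪-adjugate x′∈𝒪
            aa′≈ : adjugate x * adjugate x′ ≈ nat q * (int k′ * adjugate x - int k * adjugate x′)
            aa′≈ = cofactor-product (square-multiple eq z≡) (square-multiple eq′ z′≡)
            either : J.J (adjugate x) ⊎ J.J (adjugate x′) → ⊥
            either (inj₁ j) = P.Good⇒∉J U (P.good-adjugate U) j
            either (inj₂ j) = P′.Good⇒∉J unramified′ (P′.good-adjugate unramified′) (J⇒J′ j)

          simple : SimplePrime
          simple = decide q∣Norm q∣Norm′
            where
            decide : (∃[ z ] Norm x ≈ int (+ q ℤ.* z)) → (∃[ z ] Norm x′ ≈ int (+ q ℤ.* z)) → SimplePrime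
            decide (z , eq) (z′ , eq′) = split (q ∣? ℤ.∣ z ∣)
              where
              split : Dec (q ∣ ℤ.∣ z ∣) → SimplePrime
              split (no q∤z)  = simple-prime q q-prime x U z eq q∤z
              split (yes q∣z) = simple-prime q q-prime x′ unramified′ z′ eq′
                λ q∣z′ → not-both eq eq′ (∣abs⇒multiple z q∣z) (∣abs⇒multiple z′ q∣z′)

        -- For suitable n, the primes dividing the norm of 1 - n ξ ≡ 1 mod n divide no difference of conjugates of ξ.
        module Existence (ξ : Carrier) (ξ∈ : 𝒪 ξ)
          (distinct-σ : ∀ i → i < s → ξ ≉ σ^ (suc i) ξ)
          (distinct-τ : ∀ j → j < t → ∀ i → i < suc s → ξ ≉ τ^ (suc j) (σ^ i ξ)) where

          DividesInteger : Carrier → ℕ → Set (c ⊔ ℓ₁)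
          DividesInteger v d = ∃[ ε ] 𝒪 ε × v * ε ≈ nat d

          divides-multiple : ∀ v d k → DividesInteger v d → DividesInteger v (k ℕ.* d)
          divides-multiple v d k (ε , ε∈ , eq) = nat k * ε , 𝒪-* (𝒪-int (+ k)) ε∈ ,
            trans (solve 3 (λ v k e → v :* (k :* e) := k :* (v :* e)) v (nat k) ε) (trans (*-congˡ eq) (sym (nat-* k d)))

          divides-integer : ∀ {v} → v ≉ 0# → ∃[ d ] 0 < d × DividesInteger v d
          divides-integer {v} v≉0 = proj₁ u , proj₁ (proj₂ u) , nat (proj₁ u) * w , proj₂ (proj₂ u) ,
            trans (solve 3 (λ v d w → v :* (d :* w) := v :* w :* d) v (nat (proj₁ u)) w) (trans (*-congʳ (proj₂ (inverse v≉0))) (*-identityˡ _))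
            where
            w = proj₁ (inverse v≉0)
            u = 𝒪-clear w

          difference≉0 : ∀ {v} → ξ ≉ v → ξ - v ≉ 0#
          difference≉0 ξ≉v eq = ξ≉v (x-y≈0⇒x≈y eq)

          common-σ : ∃[ d ] 0 < d × (∀ (i : Fin s) → DividesInteger (ξ - σ^ (suc (toℕ i)) ξ) d)
          common-σ = common-multiple s (λ i → DividesInteger (ξ - σ^ (suc (toℕ i)) ξ)) (λ i → divides-multiple (ξ - σ^ (suc (toℕ i)) ξ))
            λ i → divides-integer (difference≉0 (distinct-σ (toℕ i) (Fin.toℕ<n i)))

          common-τ : ∃[ d ] 0 < d × (∀ (j : Fin t) (i : Fin (suc s)) → DividesInteger (ξ - τ^ (suc (toℕ j)) (σ^ (toℕ i) ξ)) d)
          common-τ = common-multiple₂ t (suc s) (λ j i → DividesInteger (ξ - τ^ (suc (toℕ j)) (σ^ (toℕ i) ξ)))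
            (λ j i → divides-multiple (ξ - τ^ (suc (toℕ j)) (σ^ (toℕ i) ξ)))
            λ j i → divides-integer (difference≉0 (distinct-τ (toℕ j) (Fin.toℕ<n j) (toℕ i) (Fin.toℕ<n i)))

          D : ℕ
          D = proj₁ common-σ ℕ.* proj₁ common-τ

          0<D : 0 < D
          0<D = ℕ.*-mono-< (proj₁ (proj₂ common-σ)) (proj₁ (proj₂ common-τ))

          D-σ : ∀ i → i < s → DividesInteger (ξ - σ^ (suc i) ξ) D
          D-σ i i<s = ≡.subst₂ (λ k d → DividesInteger (ξ - σ^ (suc k) ξ) d) (Fin.toℕ-fromℕ< i<s) (ℕ.*-comm (proj₁ common-τ) (proj₁ common-σ))
            (divides-multiple _ (proj₁ common-σ) (proj₁ common-τ) (proj₂ (proj₂ common-σ) (Fin.fromℕ< i<s)))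

          D-τ : ∀ j → j < t → ∀ i → i < suc s → DividesInteger (ξ - τ^ (suc j) (σ^ i ξ)) D
          D-τ j j<t i i<s = ≡.subst₂ (λ k l → DividesInteger (ξ - τ^ (suc k) (σ^ l ξ)) D) (Fin.toℕ-fromℕ< j<t) (Fin.toℕ-fromℕ< i<s)
            (divides-multiple _ (proj₁ common-τ) (proj₁ common-σ) (proj₂ (proj₂ common-τ) (Fin.fromℕ< j<t) (Fin.fromℕ< i<s)))

          -- The norm of `X k` is congruent to 1 modulo `n k`. The factor 3 therefore excludes the
          -- norms 0 and -1, so that a norm other than 1 has a prime divisor; the factor D keeps
          -- that prime away from the differences of conjugates.
          n : ℕ → ℕ
          n k = 3 ℕ.* D ℕ.* k

          X : ℕ → Carrier
          X k = 1# - nat (n k) * ξ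

          X∈𝒪 : ∀ k → 𝒪 (X k)
          X∈𝒪 k = 𝒪-- 𝒪-1 (𝒪-* (𝒪-int (+ n k)) ξ∈)

          ξ≉0 : 0 < s → ξ ≉ 0#
          ξ≉0 0<s ξ≈0 = distinct-σ 0 0<s (trans ξ≈0 (sym (trans (σ^.⟦⟧-cong 1 ξ≈0) (σ^.0#-homo 1))))

          -- The number of conjugates plus one, hence the number of coefficients of
          -- `norm-polynomial`.
          size : ℕ
          size = suc t ℕ.* suc s ℕ.+ 1

          norm-polynomial : Carrier → Carrier
          norm-polynomial u = ∏ (suc t) (λ j → ∏ (suc s) (λ i → 1# - u * τ^ j (σ^ i ξ)))

          Norm-X : ∀ k → Norm (X k) ≈ norm-polynomial (nat (n k))
          Norm-X k = ∏-cong′ (suc t) λ j → trans (τ^-hom.hom-∏ j (suc s) (λ i → σ^ i (X k))) (∏-cong′ (suc s) λ i → begin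
            τ^ j (σ^ i (1# - nat (n k) * ξ))                       ≈⟨ τ^.⟦⟧-cong j (trans (σ^-hom.hom-- i 1# _) (+-cong (σ^.1#-homo i)
                                                                        (-‿cong (trans (σ^.*-homo i (nat (n k)) ξ) (*-congʳ (σ^-hom.hom-int i (+ n k))))))) ⟩
            τ^ j (1# - nat (n k) * σ^ i ξ)                         ≈⟨ trans (τ^-hom.hom-- j 1# _) (+-cong (τ^.1#-homo j)
                                                                        (-‿cong (trans (τ^.*-homo j (nat (n k)) (σ^ i ξ)) (*-congʳ (τ^-hom.hom-int j (+ n k)))))) ⟩
            1# - nat (n k) * τ^ j (σ^ i ξ)                         ∎)

          -- A polynomial with value 1 at size many points would have no zero, but it has the zero 1 / ξ.
          nontrivial-norm : 0 < s → ∃[ k ] Norm (X k) ≉ 1#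
          nontrivial-norm 0<s = from (find< (λ k → ¬? (Norm (X k) ≟ 1#)) size)
            where
            from : (∃[ k ] k < size × Norm (X k) ≉ 1#) ⊎ (∀ k → k < size → ¬ (Norm (X k) ≉ 1#)) → ∃[ k ] Norm (X k) ≉ 1#
            from (inj₁ (k , _ , ≉1)) = k , ≉1
            from (inj₂ none) = contradiction (trans (sym (poly≈1 ξ⁻¹)) poly≈0) 1≉0
              where
              ξ⁻¹ = proj₁ (inverse (ξ≉0 0<s))
              -- The factor with i = j = 0 is 1 - ξ⁻¹ ξ.
              poly≈0 : norm-polynomial ξ⁻¹ ≈ 0#
              poly≈0 = trans (*-congʳ (trans (*-congʳ (x≈y⇒x-y≈0 (sym (trans (*-comm _ _) (proj₂ (inverse (ξ≉0 0<s))))))) (zeroˡ _))) (zeroˡ _)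
              n-injective : ∀ {i j} → i < j → nat (n i) ≉ nat (n j)
              n-injective i<j eq = ℕ.<⇒≢ (ℕ.*-monoʳ-< (3 ℕ.* D) {{ℕ.>-nonZero (ℕ.*-mono-< {0} {3} (s≤s z≤n) 0<D)}} i<j) (nat-injective eq)
              ≈1 : ∀ k → k < size → Norm (X k) ≈ 1#
              ≈1 k k<size = stable (Norm (X k) ≟ 1#)
                where
                stable : Dec (Norm (X k) ≈ 1#) → Norm (X k) ≈ 1#
                stable (yes eq) = eq
                stable (no ¬eq) = contradiction ¬eq (none k k<size)
              open Polynomials
              poly≈1 : ∀ u → norm-polynomial u ≈ 1#
              poly≈1 u = x-y≈0⇒x≈y (poly-vanishes size
                (poly-- size (poly-∏∏ (suc t) (suc s) (λ j i → τ^ j (σ^ i ξ)))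
                  (≡.subst (λ d → Poly d (λ _ → 1#)) (ℕ.+-comm 1 (suc t ℕ.* suc s)) (poly-constant (suc t ℕ.* suc s) 1#)))
                (λ k → nat (n k)) (λ i<j _ → n-injective i<j) (λ k k<size → x≈y⇒x-y≈0 (trans (sym (Norm-X k)) (≈1 k k<size))) u)

          Norm-1 : Norm 1# ≈ 1#
          Norm-1 = trans (Norm-cong (sym int-1)) (trans (Norm-int (+ 1)) (trans (^-congˡ (suc t) (trans (^-congˡ (suc s) int-1) (1^n≈1 (suc s)))) (1^n≈1 (suc t))))

          module _ (k : ℕ) (≉1 : Norm (X k) ≉ 1#) where
            0<k : 0 < k
            0<k = ℕ.n≢0⇒n>0 λ { ≡.refl → ≉1 (trans (Norm-cong (trans (+-congˡ (-‿cong (trans (*-congʳ (trans (reflexive (≡.cong nat (ℕ.*-zeroʳ (3 ℕ.* D)))) int-0)) (zeroˡ ξ)))) (x-0≈x 1#))) Norm-1) }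

            0<n : 0 < n k
            0<n = ℕ.*-mono-< {0} (ℕ.*-mono-< {0} {3} (s≤s z≤n) 0<D) 0<k

            R : ℤ
            R = proj₁ (Norm-integer (X∈𝒪 k))

            R≡1 : ∃[ z ] R ℤ.- + 1 ≡ + n k ℤ.* z
            R≡1 = from (Norm-mod (+ n k) 𝒪-1 (X∈𝒪 k) (- ξ , 𝒪-neg ξ∈ , solve 2 (λ n ξ → con (+ 1) :- n :* ξ :- con (+ 1) := n :* (:- ξ)) (nat (n k)) ξ))
              where
              from : int (+ n k) ≼ Norm (X k) - Norm 1# → ∃[ z ] R ℤ.- + 1 ≡ + n k ℤ.* z
              from (w , w∈ , eq) = proj₁ q , proj₂ (proj₂ q)
                where
                q = quotient-integer {n k} {R ℤ.- + 1} 0<n w∈ (trans (int-+ R (ℤ.- + 1)) (trans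
                  (+-cong (sym (proj₂ (Norm-integer (X∈𝒪 k)))) (trans (int-neg (+ 1)) (-‿cong (trans int-1 (sym Norm-1))))) eq))

            3∣R-1 : 3 ∣ ℤ.∣ R ℤ.- + 1 ∣
            3∣R-1 = ≡.subst (3 ∣_) (≡.sym (≡.trans (≡.cong ℤ.∣_∣ (proj₂ R≡1)) (ℤ.abs-* (+ n k) (proj₁ R≡1))))
              (∣m⇒∣m*n ℤ.∣ proj₁ R≡1 ∣ (∣m⇒∣m*n k (∣m⇒∣m*n D (divides 1 ≡.refl))))

            1<∣R∣ : 1 < ℤ.∣ R ∣
            1<∣R∣ = cases R 3∣R-1 λ R≡1 → ≉1 (trans (proj₂ (Norm-integer (X∈𝒪 k))) (trans (reflexive (≡.cong int R≡1)) int-1))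
              where
              cases : ∀ R → 3 ∣ ℤ.∣ R ℤ.- + 1 ∣ → ¬ (R ≡ + 1) → 1 < ℤ.∣ R ∣
              cases (+ 0)             3∣ _  = contradiction (∣⇒≤ 3∣) λ { (s≤s ()) }
              cases (+ 1)             _  ≢1 = contradiction ≡.refl ≢1
              cases (+ suc (suc _))   _  _  = s≤s (s≤s z≤n)
              cases -[1+ 0 ]          3∣ _  = contradiction (∣⇒≤ 3∣) λ { (s≤s (s≤s ())) }
              cases -[1+ suc _ ]      _  _  = s≤s (s≤s z≤n)

            module AtPrime (q : ℕ) (q-prime : Prime q) (R≡qz : ∃[ z ] R ≡ + q ℤ.* z) where
              -- The prime q divides R, while R - 1 is a multiple of `n k`; a common divisor would
              -- divide 1.
              q∤n : ¬ (q ∣ n k)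
              q∤n q∣n = Ideal.q∤1 q (X k) q-prime (divides ℤ.∣ u ℤ.- v ∣ (≡.trans (≡.cong ℤ.∣_∣ 1≡) (≡.trans (ℤ.abs-* (+ q) (u ℤ.- v)) (ℕ.*-comm q _))))
                where
                u = proj₁ R≡qz
                R-1≡qv : ∃[ v ] R ℤ.- + 1 ≡ + q ℤ.* v
                R-1≡qv = ∣abs⇒multiple (R ℤ.- + 1) (≡.subst (q ∣_)
                  (≡.sym (≡.trans (≡.cong ℤ.∣_∣ (proj₂ R≡1)) (ℤ.abs-* (+ n k) (proj₁ R≡1)))) (∣m⇒∣m*n ℤ.∣ proj₁ R≡1 ∣ q∣n))
                v = proj₁ R-1≡qv
                1≡ : + 1 ≡ + q ℤ.* (u ℤ.- v)
                1≡ = int-injective (begin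
                  int (+ 1)                                   ≈⟨ solve 2 (λ r o → o := r :- (r :- o)) (int R) (int (+ 1)) ⟩
                  int R - (int R - int (+ 1))                 ≈⟨ +-cong (trans (reflexive (≡.cong int (proj₂ R≡qz))) (int-* (+ q) u)) (-‿cong (trans (trans (+-congˡ (sym (int-neg (+ 1)))) (sym (int-+ R (ℤ.- + 1))))
                                                                   (trans (reflexive (≡.cong int (proj₂ R-1≡qv))) (int-* (+ q) v)))) ⟩
                  nat q * int u - nat q * int v               ≈⟨ solve 3 (λ q u v → q :* u :- q :* v := q :* (u :- v)) (nat q) (int u) (int v) ⟩
                  nat q * (int u - int v)                     ≈⟨ trans (int-* (+ q) (u ℤ.- v)) (*-congˡ (trans (int-+ u (ℤ.- v)) (+-congˡ (int-neg v)))) ⟨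
                  int (+ q ℤ.* (u ℤ.- v))                     ∎)

              q∤nD : ¬ (q ∣ n k ℕ.* D)
              q∤nD q∣ = either (euclidsLemma (n k) D q-prime q∣)
                where
                either : q ∣ n k ⊎ q ∣ D → ⊥
                either (inj₁ h) = q∤n h
                either (inj₂ h) = q∤n (∣m⇒∣m*n k (≡.subst (q ∣_) (ℕ.*-comm D 3) (∣m⇒∣m*n 3 h)))

              -- If (ξ - v) ε = D and w = 1 - n v, then w ε - n D = (1 - n ξ) ε, a multiple of
              -- `X k`. So w is certified by ε and the integer n D, which is prime to q.
              good : ∀ {v w} → 𝒪 w → w ≈ 1# - nat (n k) * v → DividesInteger (ξ - v) D → Ideal.Good q (X k) w
              good {v} {w} w∈ eq (ε , ε∈ , eq′) = w∈ , ε , n k ℕ.* D , ε∈ , q∤nD , Ideal.J-x q (X k) (ε , ε∈ , (begin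
                w * ε - nat (n k ℕ.* D)                               ≈⟨ +-cong (*-congʳ eq) (-‿cong (trans (nat-* (n k) D) (*-congˡ (sym eq′)))) ⟩
                (1# - nat (n k) * v) * ε - nat (n k) * ((ξ - v) * ε)  ≈⟨ solve 4 (λ n v ξ ε → (con (+ 1) :- n :* v) :* ε :- n :* ((ξ :- v) :* ε) := (con (+ 1) :- n :* ξ) :* ε) (nat (n k)) v ξ ε ⟩
                X k * ε                                               ∎))

              σ-X : ∀ i → σ^ i (X k) ≈ 1# - nat (n k) * σ^ i ξ
              σ-X i = trans (σ^-hom.hom-- i 1# _) (+-cong (σ^.1#-homo i) (-‿cong (trans (σ^.*-homo i (nat (n k)) ξ) (*-congʳ (σ^-hom.hom-int i (+ n k))))))

              unramified : PrimeIdeal.Unramified q q-prime (X k)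
              unramified = record
                { x∈𝒪    = X∈𝒪 k
                ; q∣Norm = proj₁ R≡qz , trans (proj₂ (Norm-integer (X∈𝒪 k))) (reflexive (≡.cong int (proj₂ R≡qz)))
                ; good-σ = λ i i<s → good (𝒪-σ (suc i) (X∈𝒪 k)) (σ-X (suc i)) (D-σ i i<s)
                ; good-τ = λ j j<t i i<s → good (𝒪-τ (suc j) (𝒪-σ i (X∈𝒪 k)))
                    (trans (τ^.⟦⟧-cong (suc j) (σ-X i)) (trans (τ^-hom.hom-- (suc j) 1# _) (+-cong (τ^.1#-homo (suc j))
                      (-‿cong (trans (τ^.*-homo (suc j) (nat (n k)) _) (*-congʳ (τ^-hom.hom-int (suc j) (+ n k)))))))) (D-τ j j<t i i<s)
                }

          simplePrime : 0 < s → SimplePrime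
          simplePrime 0<s = from (nontrivial-norm 0<s)
            where
            from : ∃[ k ] Norm (X k) ≉ 1# → SimplePrime
            from (k , ≉1) = at (prime-divisor (1<∣R∣ k ≉1))
              where
              at : ∃[ q ] Prime q × q ∣ ℤ.∣ R k ≉1 ∣ → SimplePrime
              at (q , q-prime , q∣R) = Shift.simple q q-prime (X k) (AtPrime.unramified k ≉1 q q-prime (∣abs⇒multiple (R k ≉1) q∣R))

-- The fields F, K, L and the element τ.

record Setup c ℓ₁ ℓ₂ : Set (lsuc (c ⊔ ℓ₁ ⊔ ℓ₂)) where
  field
    p             : ℕ
    p-prime       : Prime p
    p-odd         : 2 ∤ p
    F K L         : Field c ℓ₁ ℓ₂
    ιF            : Extension ℚ-field F
    F-cyclic      : IsCyclicOfDegree ιF p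
    ιK            : Extension ℚ-field K
    ζ′            : Field.Carrier K
    ζ′-primitive  : IsPrimitiveRootOfUnity K p ζ′
    K-generated   : GeneratedBy ιK (Field._≈_ K ζ′)
    γ             : Extension F L
    κ             : Extension K L
    L-generated   : GeneratedBy γ (Image κ)
    τ             : Gal γ
    e             : ℕ
    e-primitive   : IsPrimitiveRootModulo p e
    τζ≈ζᵉ         : Field._≈_ L (Gal.⟦_⟧ τ (Extension.⟦_⟧ κ ζ′)) (Field._^_ L (Extension.⟦_⟧ κ ζ′) e)

  ι : Extension ℚ-field L
  ι = γ ∘ₑ ιF

  ζ : Field.Carrier L
  ζ = Extension.⟦_⟧ κ ζ′

  instance
    p-nonZero : ℕ.NonZero p
    p-nonZero = prime⇒nonZero p-prime

  1<p : 1 < p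
  1<p = ℕ.nonTrivial⇒n>1 p {{prime⇒nonTrivial p-prime}}

  0<p : 0 < p
  0<p = ℕ.<⇒≤ 1<p

  m : ℕ
  m = p ∸ 1

  1+m≡p : suc m ≡ p
  1+m≡p = ℕ.m+[n∸m]≡n 0<p

  m<p : m < p
  m<p = ℕ.≤-reflexive 1+m≡p

  0<m : 0 < m
  0<m = ℕ.m<n⇒0<n∸m 1<p

module _ {c ℓ₁ ℓ₂} (S : Setup c ℓ₁ ℓ₂) where
  open Setup S
  open FieldProperties L ι
  open FieldTools L ι
  open Integers L ι
  private
    module F = FieldProperties F ιF
    module K = Field K
    module ι = Extension ι
    module γ where
      open Extension γ public
      open Embedding ιF ι γ public
    module κ where
      open Extension κ public
      open Embedding ιK ι κ public

  -- The action of τ on the p-th roots of unity.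

  module CyclotomicAction where

    ζ-primitive : IsPrimitiveRootOfUnity L p ζ
    ζ-primitive =
      trans (sym (κ.hom-^ ζ′ p)) (trans (κ.⟦⟧-cong (proj₁ ζ′-primitive)) κ.1#-homo) ,
      λ i 0<i i<p eq → proj₂ ζ′-primitive i 0<i i<p
        (κ.hom-injective (trans (κ.hom-^ ζ′ i) (trans eq (sym κ.1#-homo))))

    open RootOfUnity ζ-primitive 0<p public

    τ^ₑ : ℕ → Extension L L
    τ^ₑ i = gal⇒ₑ τ ^ₑ i

    module τ^ i = Extension (τ^ₑ i)
    module τ^-hom i = Embedding ι ι (τ^ₑ i)

    τ^ : ℕ → Carrier → Carrier
    τ^ i = τ^.⟦_⟧ i

    τ^-γ : ∀ i f → τ^ i γ.⟦ f ⟧ ≈ γ.⟦ f ⟧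
    τ^-γ zero    f = refl
    τ^-γ (suc i) f = trans (τ^.⟦⟧-cong 1 (τ^-γ i f)) (Gal.fixes τ f)

    τ^-ζ : ∀ i → τ^ i ζ ≈ ζ ^ (e ℕ.^ i)
    τ^-ζ zero    = sym (*-identityʳ ζ)
    τ^-ζ (suc i) = begin
      τ^ 1 (τ^ i ζ)            ≈⟨ τ^.⟦⟧-cong 1 (τ^-ζ i) ⟩
      τ^ 1 (ζ ^ (e ℕ.^ i))     ≈⟨ τ^-hom.hom-^ 1 ζ (e ℕ.^ i) ⟩
      τ^ 1 ζ ^ (e ℕ.^ i)       ≈⟨ ^-congˡ (e ℕ.^ i) τζ≈ζᵉ ⟩
      (ζ ^ e) ^ (e ℕ.^ i)      ≈⟨ ^-assocʳ ζ e (e ℕ.^ i) ⟩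
      ζ ^ (e ℕ.* e ℕ.^ i)      ∎

    ζ^[a+q*p] : ∀ a q → ζ ^ (a ℕ.+ q ℕ.* p) ≈ ζ ^ a
    ζ^[a+q*p] a q = begin
      ζ ^ (a ℕ.+ q ℕ.* p)      ≈⟨ ^-+ ζ a (q ℕ.* p) ⟨
      ζ ^ a * ζ ^ (q ℕ.* p)    ≈⟨ *-congˡ (trans (sym (^-assocʳ ζ q p)) ([ζ^i]ⁿ≈1 q)) ⟩
      ζ ^ a * 1#               ≈⟨ *-identityʳ _ ⟩
      ζ ^ a                    ∎

    ζ^-% : ∀ a → ζ ^ a ≈ ζ ^ (a % p)
    ζ^-% a = trans (reflexive (≡.cong (ζ ^_) (m≡m%n+[m/n]*n a p))) (ζ^[a+q*p] (a % p) (a / p))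

    ∣⇒ζ^≈1 : ∀ {a} → p ∣ a → ζ ^ a ≈ 1#
    ∣⇒ζ^≈1 (divides q ≡.refl) = ζ^[a+q*p] 0 q

    ζ^≈1⇒∣ : ∀ {a} → ζ ^ a ≈ 1# → p ∣ a
    ζ^≈1⇒∣ {a} eq with a % p in eq%
    ... | zero  = m%n≡0⇒n∣m a p eq%
    ... | suc r = contradiction (trans (sym (trans (ζ^-% a) (reflexive (≡.cong (ζ ^_) eq%)))) eq)
                    (ζ^i≉1 (s≤s z≤n) (ℕ.≤-<-trans (ℕ.≤-reflexive (≡.sym eq%)) (m%n<n a p)))

    ζ^-shift : ∀ {a b} → a ≤ b → p ∣ b ∸ a → ζ ^ b ≈ ζ ^ a
    ζ^-shift {a} {b} a≤b (divides q eq) = trans (reflexive (≡.cong (ζ ^_)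
      (≡.trans (≡.sym (ℕ.m+[n∸m]≡n a≤b)) (≡.cong (a ℕ.+_) eq)))) (ζ^[a+q*p] a q)

    ζ^-congruent : ∀ a b → p ∣ ℕ.∣ a - b ∣ → ζ ^ a ≈ ζ ^ b
    ζ^-congruent a b p∣ with ℕ.≤-total a b
    ... | inj₁ a≤b = sym (ζ^-shift a≤b (≡.subst (p ∣_) (ℕ.m≤n⇒∣m-n∣≡n∸m a≤b) p∣))
    ... | inj₂ b≤a = ζ^-shift b≤a (≡.subst (p ∣_) (≡.trans (ℕ.∣-∣-comm a b) (ℕ.m≤n⇒∣m-n∣≡n∸m b≤a)) p∣)

    ζ^-injective : ∀ {i j} → i < p → j < p → ζ ^ i ≈ ζ ^ j → i ≡ j
    ζ^-injective {i} {j} i<p j<p eq with ℕ.<-cmp i j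
    ... | Tri.tri< i<j _ _ = contradiction eq (ζ^i≉ζ^j i<j j<p)
    ... | Tri.tri≈ _ i≡j _ = i≡j
    ... | Tri.tri> _ _ j<i = contradiction (sym eq) (ζ^i≉ζ^j j<i i<p)

    τ-orbit : ∀ {a} → 0 < a → a < p → ∃[ n ] τ^ n ζ ≈ ζ ^ a
    τ-orbit {a} 0<a a<p = n , trans (τ^-ζ n) (ζ^-congruent (e ℕ.^ n) a (proj₂ (proj₂ e-primitive a a⊥p)))
      where
      a⊥p : Coprime a p
      a⊥p = Coprimality.sym (prime⇒coprime p-prime {{ℕ.>-nonZero 0<a}} a<p)
      n = proj₁ (proj₂ e-primitive a a⊥p)

    τ^-+ : ∀ i j x → τ^ (i ℕ.+ j) x ≈ τ^ i (τ^ j x)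
    τ^-+ i j x = reflexive (^ₑ-+ (gal⇒ₑ τ) i j x)

    -- All of ζ, ..., ζᵖ⁻¹ occur as τⁿ(ζ), because e is a primitive root. With period d < p - 1
    -- these p - 1 values would be among d, and two distinct powers of ζ would coincide.
    τ-period≥m : ∀ {d} → 0 < d → τ^ d ζ ≈ ζ → m ≤ d
    τ-period≥m {d} 0<d τᵈζ≈ζ with m ℕ.≤? d
    ... | yes m≤d = m≤d
    ... | no  m≰d = contradiction i≡j (ℕ.<⇒≢ i<j)
      where
      instance _ = ℕ.>-nonZero 0<d
      orbit : (i : Fin m) → ∃[ n ] τ^ n ζ ≈ ζ ^ suc (toℕ i)
      orbit i = τ-orbit (s≤s z≤n) (≡.subst (suc (toℕ i) <_) 1+m≡p (s≤s (Fin.toℕ<n i)))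
      f : Fin m → Fin d
      f i = Fin.fromℕ< (m%n<n (proj₁ (orbit i)) d)
      τ^[q*d]ζ : ∀ q → τ^ (q ℕ.* d) ζ ≈ ζ
      τ^[q*d]ζ zero    = refl
      τ^[q*d]ζ (suc q) = trans (τ^-+ d (q ℕ.* d) ζ) (trans (τ^.⟦⟧-cong d (τ^[q*d]ζ q)) τᵈζ≈ζ)
      τ^-%-ζ : ∀ n → τ^ n ζ ≈ τ^ (n % d) ζ
      τ^-%-ζ n = trans (reflexive (≡.cong (λ k → τ^ k ζ) (m≡m%n+[m/n]*n n d)))
        (trans (τ^-+ (n % d) (n / d ℕ.* d) ζ) (τ^.⟦⟧-cong (n % d) (τ^[q*d]ζ (n / d))))
      collision = Fin.pigeonhole (ℕ.≰⇒> m≰d) f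
      i = proj₁ collision
      j = proj₁ (proj₂ collision)
      i<j : toℕ i < toℕ j
      i<j = proj₁ (proj₂ (proj₂ collision))
      fi≡fj : proj₁ (orbit i) % d ≡ proj₁ (orbit j) % d
      fi≡fj = ≡.trans (≡.sym (Fin.toℕ-fromℕ< (m%n<n (proj₁ (orbit i)) d)))
        (≡.trans (≡.cong toℕ (proj₂ (proj₂ (proj₂ collision)))) (Fin.toℕ-fromℕ< (m%n<n (proj₁ (orbit j)) d)))
      <p : ∀ (i : Fin m) → suc (toℕ i) < p
      <p i = ≡.subst (suc (toℕ i) <_) 1+m≡p (s≤s (Fin.toℕ<n i))
      i≡j : toℕ i ≡ toℕ j
      i≡j = ℕ.suc-injective (ζ^-injective (<p i) (<p j) (begin
        ζ ^ suc (toℕ i)                  ≈⟨ proj₂ (orbit i) ⟨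
        τ^ (proj₁ (orbit i)) ζ           ≈⟨ τ^-%-ζ (proj₁ (orbit i)) ⟩
        τ^ (proj₁ (orbit i) % d) ζ       ≡⟨ ≡.cong (λ n → τ^ n ζ) fi≡fj ⟩
        τ^ (proj₁ (orbit j) % d) ζ       ≈⟨ τ^-%-ζ (proj₁ (orbit j)) ⟨
        τ^ (proj₁ (orbit j)) ζ           ≈⟨ proj₂ (orbit j) ⟩
        ζ ^ suc (toℕ j)                  ∎))

    -- The values τⁱ(ζ) for 0 ≤ i ≤ m are powers of ζ with exponents among the m numbers 1, ..., p -
    -- 1, so two of them agree and some period is at most m; `τ-period≥m` gives equality. This is
    -- Fermat's congruence for e, in the form of a pigeonhole argument.
    τᵐζ≈ζ : τ^ m ζ ≈ ζ
    τᵐζ≈ζ = ≡.subst (λ d → τ^ d ζ ≈ ζ) (ℕ.≤-antisym d≤m (τ-period≥m 0<d period)) period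
      where
      exponent : (i : Fin (suc m)) → ∃[ a ] 0 < a × a < p × τ^ (toℕ i) ζ ≈ ζ ^ a
      exponent i with root {τ^ (toℕ i) ζ} (trans (sym (τ^-hom.hom-^ (toℕ i) ζ p))
                        (trans (τ^.⟦⟧-cong (toℕ i) ζⁿ≈1) (τ^.1#-homo (toℕ i))))
      ... | a , eq = a % p , ℕ.n≢0⇒n>0 nonzero , m%n<n a p , trans eq (ζ^-% a)
        where
        nonzero : ¬ (a % p ≡ 0)
        nonzero a%p≡0 = ζ^i≉1 {1} (s≤s z≤n) 1<p (trans (*-identityʳ ζ) (τ^-hom.hom-injective (toℕ i)
          (trans eq (trans (ζ^-% a) (trans (reflexive (≡.cong (ζ ^_) a%p≡0)) (sym (τ^.1#-homo (toℕ i))))))))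
      f : Fin (suc m) → Fin m
      f i = Fin.fromℕ< {proj₁ (exponent i) ∸ 1} (ℕ.∸-monoˡ-< (proj₁ (proj₂ (proj₂ (exponent i)))) (proj₁ (proj₂ (exponent i))))
      collision = Fin.pigeonhole (ℕ.n<1+n m) f
      i = proj₁ collision
      j = proj₁ (proj₂ collision)
      i<j : toℕ i < toℕ j
      i<j = proj₁ (proj₂ (proj₂ collision))
      0<d : 0 < toℕ j ∸ toℕ i
      0<d = ℕ.m<n⇒0<n∸m i<j
      d≤m : toℕ j ∸ toℕ i ≤ m
      d≤m = ℕ.≤-trans (ℕ.m∸n≤m (toℕ j) (toℕ i)) (ℕ.≤-pred (Fin.toℕ<n j))
      fi≡fj : proj₁ (exponent i) ≡ proj₁ (exponent j)
      fi≡fj = ℕ.∸-cancelʳ-≡ (proj₁ (proj₂ (exponent i))) (proj₁ (proj₂ (exponent j)))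
        (≡.trans (≡.sym (Fin.toℕ-fromℕ< _)) (≡.trans (≡.cong toℕ (proj₂ (proj₂ (proj₂ collision)))) (Fin.toℕ-fromℕ< _)))
      period : τ^ (toℕ j ∸ toℕ i) ζ ≈ ζ
      period = τ^-hom.hom-injective (toℕ i) (begin
        τ^ (toℕ i) (τ^ (toℕ j ∸ toℕ i) ζ)     ≈⟨ τ^-+ (toℕ i) (toℕ j ∸ toℕ i) ζ ⟨
        τ^ (toℕ i ℕ.+ (toℕ j ∸ toℕ i)) ζ      ≡⟨ ≡.cong (λ k → τ^ k ζ) (ℕ.m+[n∸m]≡n (ℕ.<⇒≤ i<j)) ⟩
        τ^ (toℕ j) ζ                          ≈⟨ proj₂ (proj₂ (proj₂ (exponent j))) ⟩
        ζ ^ proj₁ (exponent j)                ≡⟨ ≡.cong (ζ ^_) fi≡fj ⟨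
        ζ ^ proj₁ (exponent i)                ≈⟨ proj₂ (proj₂ (proj₂ (exponent i))) ⟨
        τ^ (toℕ i) ζ                          ∎)

    τⁱζ≉ζ : ∀ {i} → 0 < i → i < m → τ^ i ζ ≉ ζ
    τⁱζ≉ζ 0<i i<m eq = ℕ.<⇒≱ i<m (τ-period≥m 0<i eq)

    ζ-power-generates : ∀ {a} → ¬ (p ∣ a) → ∃[ j ] ζ ≈ (ζ ^ a) ^ j
    ζ-power-generates {a} p∤a = RootOfUnity.root {p} {ζ ^ a} ([ζ^i]ⁿ≈1 a , nontrivial) 0<p ζⁿ≈1
      where
      nontrivial : ∀ i → 0 < i → i < p → (ζ ^ a) ^ i ≉ 1#
      nontrivial i 0<i i<p eq with euclidsLemma a i p-prime (ζ^≈1⇒∣ (trans (sym (^-assocʳ ζ a i)) eq))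
      ... | inj₁ p∣a = p∤a p∣a
      ... | inj₂ p∣i = ℕ.<⇒≱ i<p (∣⇒≤ {{ℕ.>-nonZero 0<i}} p∣i)

  -- L as the ring of polynomial expressions in ζ over F.

  module Structure where
    open CyclotomicAction

    -- Unlike `Adjoin` it has no constructor for inverses, so linear and multiplicative claims
    -- reduce to monomials. Closure under inverses is proved as `F[ζ]-inv`.
    data F[ζ] : Carrier → Set (c ⊔ ℓ₁) where
      term : ∀ b n {x} → x ≈ γ.⟦ b ⟧ * ζ ^ n → F[ζ] x
      plus : ∀ {x y z} → F[ζ] x → F[ζ] y → z ≈ x + y → F[ζ] z

    F[ζ]-resp : ∀ {x y} → x ≈ y → F[ζ] x → F[ζ] y
    F[ζ]-resp x≈y (term b n eq) = term b n (trans (sym x≈y) eq)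
    F[ζ]-resp x≈y (plus u v eq) = plus u v (trans (sym x≈y) eq)

    F[ζ]-γ : ∀ f → F[ζ] γ.⟦ f ⟧
    F[ζ]-γ f = term f 0 (sym (*-identityʳ _))

    F[ζ]-ζ^ : ∀ n → F[ζ] (ζ ^ n)
    F[ζ]-ζ^ n = term F.1# n (sym (trans (*-congʳ γ.1#-homo) (*-identityˡ _)))

    F[ζ]-* : ∀ {x y} → F[ζ] x → F[ζ] y → F[ζ] (x * y)
    F[ζ]-* (plus u v eq) w = plus (F[ζ]-* u w) (F[ζ]-* v w) (trans (*-congʳ eq) (distribʳ _ _ _))
    F[ζ]-* u@(term _ _ _) (plus v w eq) = plus (F[ζ]-* u v) (F[ζ]-* u w) (trans (*-congˡ eq) (distribˡ _ _ _))
    F[ζ]-* {x} {y} (term b i eq) (term b′ j eq′) = term (b F.* b′) (i ℕ.+ j) (begin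
      x * y                                            ≈⟨ *-cong eq eq′ ⟩
      (γ.⟦ b ⟧ * ζ ^ i) * (γ.⟦ b′ ⟧ * ζ ^ j)           ≈⟨ solve 4 (λ a b c d → (a :* b) :* (c :* d) := (a :* c) :* (b :* d)) _ _ _ _ ⟩
      (γ.⟦ b ⟧ * γ.⟦ b′ ⟧) * (ζ ^ i * ζ ^ j)           ≈⟨ *-cong (sym (γ.*-homo b b′)) (^-+ ζ i j) ⟩
      γ.⟦ b F.* b′ ⟧ * ζ ^ (i ℕ.+ j)                   ∎)

    F[ζ]-neg : ∀ {x} → F[ζ] x → F[ζ] (- x)
    F[ζ]-neg {x} u = F[ζ]-resp (trans (*-congʳ (trans (γ.-‿homo F.1#) (-‿cong γ.1#-homo)))
      (solve 1 (λ x → (:- con (+ 1)) :* x := :- x) x)) (F[ζ]-* (F[ζ]-γ (F.- F.1#)) u)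

    F[ζ]-∏ : ∀ n {f : ℕ → Carrier} → (∀ i → F[ζ] (f i)) → F[ζ] (∏ n f)
    F[ζ]-∏ zero    u = F[ζ]-ζ^ 0
    F[ζ]-∏ (suc n) u = F[ζ]-* (u 0) (F[ζ]-∏ n (u ∘ suc))

    τ^-ζ^ : ∀ i n → τ^ i (ζ ^ n) ≈ ζ ^ (e ℕ.^ i ℕ.* n)
    τ^-ζ^ i n = trans (τ^-hom.hom-^ i ζ n) (trans (^-congˡ n (τ^-ζ i)) (^-assocʳ ζ (e ℕ.^ i) n))

    F[ζ]-τ : ∀ i {x} → F[ζ] x → F[ζ] (τ^ i x)
    F[ζ]-τ i (term b n eq) = term b (e ℕ.^ i ℕ.* n)
      (trans (τ^.⟦⟧-cong i eq) (trans (τ^.*-homo i _ _) (*-cong (τ^-γ i b) (τ^-ζ^ i n))))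
    F[ζ]-τ i (plus u v eq) = plus (F[ζ]-τ i u) (F[ζ]-τ i v) (trans (τ^.⟦⟧-cong i eq) (τ^.+-homo i _ _))

    F[ζ]-ext : (φ ψ : Extension L L) → (∀ f → Extension.⟦_⟧ φ γ.⟦ f ⟧ ≈ Extension.⟦_⟧ ψ γ.⟦ f ⟧) →
               Extension.⟦_⟧ φ ζ ≈ Extension.⟦_⟧ ψ ζ → ∀ {x} → F[ζ] x → Extension.⟦_⟧ φ x ≈ Extension.⟦_⟧ ψ x
    F[ζ]-ext φ ψ eqγ eqζ {x} (term b n eq) = begin
      φ.⟦ x ⟧                           ≈⟨ trans (φ.⟦⟧-cong eq) (φ.*-homo _ _) ⟩
      φ.⟦ γ.⟦ b ⟧ ⟧ * φ.⟦ ζ ^ n ⟧       ≈⟨ *-cong (eqγ b) (trans (Embedding.hom-^ ι ι φ ζ n)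
                                             (trans (^-congˡ n eqζ) (sym (Embedding.hom-^ ι ι ψ ζ n)))) ⟩
      ψ.⟦ γ.⟦ b ⟧ ⟧ * ψ.⟦ ζ ^ n ⟧       ≈⟨ trans (ψ.⟦⟧-cong eq) (ψ.*-homo _ _) ⟨
      ψ.⟦ x ⟧                           ∎
      where
      module φ = Extension φ
      module ψ = Extension ψ
    F[ζ]-ext φ ψ eqγ eqζ (plus u v eq) = trans (Extension.⟦⟧-cong φ eq) (trans (Extension.+-homo φ _ _) (trans
      (+-cong (F[ζ]-ext φ ψ eqγ eqζ u) (F[ζ]-ext φ ψ eqγ eqζ v))
      (sym (trans (Extension.⟦⟧-cong ψ eq) (Extension.+-homo ψ _ _)))))

    τᵐ≈id-F[ζ] : ∀ {x} → F[ζ] x → τ^ m x ≈ x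
    τᵐ≈id-F[ζ] = F[ζ]-ext (τ^ₑ m) idₑ (τ^-γ m) τᵐζ≈ζ

    τ-comm : ∀ i j x → τ^ i (τ^ j x) ≈ τ^ j (τ^ i x)
    τ-comm i j x = trans (sym (τ^-+ i j x)) (trans (reflexive (≡.cong (λ n → τ^ n x) (ℕ.+-comm i j))) (τ^-+ j i x))

    Tr : Carrier → Carrier
    Tr x = ∑ m (λ i → τ^ i x)

    Tr-cong : ∀ {x y} → x ≈ y → Tr x ≈ Tr y
    Tr-cong eq = ∑-cong′ m (λ i → τ^.⟦⟧-cong i eq)

    Tr-+ : ∀ x y → Tr (x + y) ≈ Tr x + Tr y
    Tr-+ x y = trans (∑-cong′ m (λ i → τ^.+-homo i x y)) (∑-+ m (λ i → τ^ i x) (λ i → τ^ i y))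

    Tr-γ* : ∀ f x → Tr (γ.⟦ f ⟧ * x) ≈ γ.⟦ f ⟧ * Tr x
    Tr-γ* f x = trans (∑-cong′ m (λ i → trans (τ^.*-homo i _ _) (*-congʳ (τ^-γ i f)))) (sym (*-∑ m γ.⟦ f ⟧ (λ i → τ^ i x)))

    τ^-Tr : ∀ k {x} → F[ζ] x → τ^ k (Tr x) ≈ Tr x
    τ^-Tr zero    u = refl
    τ^-Tr (suc k) {x} u = trans (τ^.⟦⟧-cong 1 (τ^-Tr k u))
      (trans (τ^-hom.hom-∑ 1 m (λ i → τ^ i x)) (∑-cycle m (λ i → τ^ i x) (τᵐ≈id-F[ζ] u)))

    Tr-one : Tr 1# ≈ nat m
    Tr-one = trans (∑-cong′ m τ^.1#-homo) (trans (∑-const m 1#) (*-identityʳ _))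

    Tr-ζ^≈Tr-ζ : ∀ {a} → 0 < a → a < p → Tr (ζ ^ a) ≈ Tr ζ
    Tr-ζ^≈Tr-ζ {a} 0<a a<p with τ-orbit 0<a a<p
    ... | k , τᵏζ≈ζᵃ = begin
      Tr (ζ ^ a)                  ≈⟨ Tr-cong τᵏζ≈ζᵃ ⟨
      Tr (τ^ k ζ)                 ≈⟨ ∑-cong′ m (λ i → τ-comm i k ζ) ⟩
      ∑ m (λ i → τ^ k (τ^ i ζ))   ≈⟨ τ^-hom.hom-∑ k m (λ i → τ^ i ζ) ⟨
      τ^ k (Tr ζ)                 ≈⟨ τ^-Tr k (F[ζ]-resp (*-identityʳ ζ) (F[ζ]-ζ^ 1)) ⟩
      Tr ζ                        ∎

    -- The traces of ζᵃ for 0 < a < p are equal, and the traces for all a < p sum to 0, so m + m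
    -- Tr(ζ) = 0. Averaging over a spares the rearrangement of the τⁱ(ζ) into ζ, ..., ζᵖ⁻¹.
    Tr-ζ≈-1 : Tr ζ ≈ - 1#
    Tr-ζ≈-1 = *-cancelˡ (nat≉0 m 0<m) (begin
      nat m * Tr ζ                                          ≈⟨ solve 2 (λ m t → m :* t := (m :+ m :* t) :- m) (nat m) (Tr ζ) ⟩
      (nat m + nat m * Tr ζ) - nat m                        ≈⟨ +-congʳ (+-cong Tr-one (∑-const m (Tr ζ))) ⟨
      (Tr (ζ ^ 0) + ∑ m (λ _ → Tr ζ)) - nat m               ≈⟨ +-congʳ (+-congˡ (∑-cong m λ a a<m →
                                                                 Tr-ζ^≈Tr-ζ (s≤s z≤n) (ℕ.<-≤-trans (s≤s a<m) (ℕ.≤-reflexive 1+m≡p)))) ⟨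
      ∑ (suc m) (λ a → Tr (ζ ^ a)) - nat m                  ≡⟨ ≡.cong (λ n → ∑ n (λ a → Tr (ζ ^ a)) - nat m) 1+m≡p ⟩
      ∑ p (λ a → Tr (ζ ^ a)) - nat m                        ≈⟨ +-congʳ vanishes ⟩
      0# - nat m                                            ≈⟨ solve 1 (λ m → con (+ 0) :- m := m :* (:- con (+ 1))) (nat m) ⟩
      nat m * - 1#                                          ∎)
      where
      vanishes : ∑ p (λ a → Tr (ζ ^ a)) ≈ 0#
      vanishes = begin
        ∑ p (λ a → ∑ m (λ i → τ^ i (ζ ^ a)))   ≈⟨ ∑-comm p m (λ a i → τ^ i (ζ ^ a)) ⟩
        ∑ m (λ i → ∑ p (λ a → τ^ i (ζ ^ a)))   ≈⟨ ∑-cong′ m (λ i → ∑-cong′ p (τ^-hom.hom-^ i ζ)) ⟩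
        ∑ m (λ i → ∑ p (τ^ i ζ ^_))            ≈⟨ ∑-zero m (λ i _ → geometric-zero p
                                                    (trans (sym (τ^-hom.hom-^ i ζ p)) (trans (τ^.⟦⟧-cong i ζⁿ≈1) (τ^.1#-homo i)))
                                                    (λ eq → ζ^i≉1 {1} (s≤s z≤n) 1<p (trans (*-identityʳ ζ)
                                                      (τ^-hom.hom-injective i (trans eq (sym (τ^.1#-homo i))))))) ⟩
        0#                                     ∎

    -- That the value is a rational integer matters twice: it puts traces of elements of F[ζ] into
    -- F, and every endomorphism of F fixes it, which is what lets `lift` act on coefficients.
    Tr-ζ^ : ∀ n → ∃[ z ] Tr (ζ ^ n) ≈ int z
    Tr-ζ^ n with n % p in eq
    ... | zero  = + m , trans (Tr-cong (trans (ζ^-% n) (reflexive (≡.cong (ζ ^_) eq)))) Tr-one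
    ... | suc a = ℤ.-1ℤ , (begin
      Tr (ζ ^ n)        ≈⟨ Tr-cong (trans (ζ^-% n) (reflexive (≡.cong (ζ ^_) eq))) ⟩
      Tr (ζ ^ suc a)    ≈⟨ Tr-ζ^≈Tr-ζ (s≤s z≤n) (ℕ.≤-<-trans (ℕ.≤-reflexive (≡.sym eq)) (m%n<n n p)) ⟩
      Tr ζ              ≈⟨ Tr-ζ≈-1 ⟩
      - 1#              ≈⟨ -‿cong int-1 ⟨
      - int (+ 1)       ≈⟨ int-neg (+ 1) ⟨
      int ℤ.-1ℤ         ∎)

    Tr∈F : ∀ {x} → F[ζ] x → Image γ (Tr x)
    Tr∈F {x} (term b n eq) = b F.* F.int (proj₁ (Tr-ζ^ n)) , (begin
      γ.⟦ b F.* F.int (proj₁ (Tr-ζ^ n)) ⟧      ≈⟨ γ.*-homo _ _ ⟩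
      γ.⟦ b ⟧ * int (proj₁ (Tr-ζ^ n))          ≈⟨ *-congˡ (proj₂ (Tr-ζ^ n)) ⟨
      γ.⟦ b ⟧ * Tr (ζ ^ n)                     ≈⟨ Tr-γ* b (ζ ^ n) ⟨
      Tr (γ.⟦ b ⟧ * ζ ^ n)                     ≈⟨ Tr-cong eq ⟨
      Tr x                                     ∎)
    Tr∈F (plus u v eq) with Tr∈F u | Tr∈F v
    ... | f , γf≈ | g , γg≈ = f F.+ g , trans (γ.+-homo f g) (trans (+-cong γf≈ γg≈) (sym (trans (Tr-cong eq) (Tr-+ _ _))))

    -- A fixed x satisfies Tr(x) = m x, and the trace lies in F.
    τ-fixed∈F-F[ζ] : ∀ {x} → F[ζ] x → τ^ 1 x ≈ x → Image γ x
    τ-fixed∈F-F[ζ] {x} u τx≈x with Tr∈F u | F.inverse (F.nat≉0 m 0<m)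
    ... | f , γf≈Tr | w , mw≈1 = w F.* f , (begin
      γ.⟦ w F.* f ⟧                ≈⟨ trans (γ.*-homo w f) (*-congˡ γf≈Tr) ⟩
      γ.⟦ w ⟧ * Tr x               ≈⟨ *-congˡ (trans (∑-cong′ m fixed) (∑-const m x)) ⟩
      γ.⟦ w ⟧ * (nat m * x)        ≈⟨ solve 3 (λ w m x → w :* (m :* x) := (m :* w) :* x) _ _ _ ⟩
      (nat m * γ.⟦ w ⟧) * x        ≈⟨ *-congʳ (trans (sym (γ.*-homo _ w)) (trans (γ.⟦⟧-cong mw≈1) γ.1#-homo)) ⟩
      1# * x                       ≈⟨ *-identityˡ x ⟩
      x                            ∎)
      where
      fixed : ∀ i → τ^ i x ≈ x
      fixed zero    = refl
      fixed (suc i) = trans (τ^.⟦⟧-cong 1 (fixed i)) τx≈x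

    -- The product N of the conjugates of x is fixed by τ, so y = N⁻¹ ∏ τʲ(x) over 0 < j < m.
    F[ζ]-inv : ∀ {x y} → F[ζ] x → x * y ≈ 1# → F[ζ] y
    F[ζ]-inv {x} {y} u xy≈1 = F[ζ]-resp
      (*-cancelˡ x≉0 (begin
        x * (γ.⟦ w ⟧ * x′)        ≈⟨ solve 3 (λ x w x′ → x :* (w :* x′) := (x :* x′) :* w) _ _ _ ⟩
        x * x′ * γ.⟦ w ⟧          ≈⟨ *-congʳ (proj₂ N∈F) ⟨
        γ.⟦ f ⟧ * γ.⟦ w ⟧         ≈⟨ trans (sym (γ.*-homo f w)) (trans (γ.⟦⟧-cong (proj₂ (F.inverse f≉0))) γ.1#-homo) ⟩
        1#                        ≈⟨ xy≈1 ⟨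
        x * y                     ∎))
      (F[ζ]-* (F[ζ]-γ w) (F[ζ]-∏ k (λ i → F[ζ]-τ (suc i) u)))
      where
      k = m ∸ 1
      1+k≡m : suc k ≡ m
      1+k≡m = ℕ.m+[n∸m]≡n 0<m
      x≉0 : x ≉ 0#
      x≉0 = invertible⇒≉0 xy≈1
      x′ : Carrier
      x′ = ∏ k (λ i → τ^ (suc i) x)
      N-fixed : τ^ 1 (x * x′) ≈ x * x′
      N-fixed = trans (τ^-hom.hom-∏ 1 (suc k) (λ i → τ^ i x)) (∏-cycle (suc k) (λ i → τ^ i x)
        (trans (reflexive (≡.cong (λ n → τ^ n x) 1+k≡m)) (τᵐ≈id-F[ζ] u)))
      N∈F : Image γ (x * x′)
      N∈F = τ-fixed∈F-F[ζ] (F[ζ]-* u (F[ζ]-∏ k (λ i → F[ζ]-τ (suc i) u))) N-fixed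
      f : F.Carrier
      f = proj₁ N∈F
      f≉0 : f F.≉ F.0#
      f≉0 eq = *-≉0 x≉0 (∏-≉0 k λ i _ → τ^-hom.hom-≉0 (suc i) x≉0)
        (trans (sym (proj₂ N∈F)) (trans (γ.⟦⟧-cong eq) γ.0#-homo))
      w : F.Carrier
      w = proj₁ (F.inverse f≉0)

    κ∈F[ζ] : ∀ {x} → Adjoin ιK (Field._≈_ K ζ′) x → F[ζ] κ.⟦ x ⟧
    κ∈F[ζ] (base r)     = F[ζ]-resp (sym (κ.hom-ι r)) (F[ζ]-γ _)
    κ∈F[ζ] (gen eq)     = F[ζ]-resp (trans (*-identityʳ ζ) (κ.⟦⟧-cong eq)) (F[ζ]-ζ^ 1)
    κ∈F[ζ] (add u v)    = plus (κ∈F[ζ] u) (κ∈F[ζ] v) (κ.+-homo _ _)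
    κ∈F[ζ] (neg u)      = F[ζ]-resp (sym (κ.-‿homo _)) (F[ζ]-neg (κ∈F[ζ] u))
    κ∈F[ζ] (mul u v)    = F[ζ]-resp (sym (κ.*-homo _ _)) (F[ζ]-* (κ∈F[ζ] u) (κ∈F[ζ] v))
    κ∈F[ζ] (inv u eq)   = F[ζ]-inv (κ∈F[ζ] u) (trans (sym (κ.*-homo _ _)) (trans (κ.⟦⟧-cong eq) κ.1#-homo))
    κ∈F[ζ] (resp eq u)  = F[ζ]-resp (κ.⟦⟧-cong eq) (κ∈F[ζ] u)

    L≡F[ζ] : ∀ x → F[ζ] x
    L≡F[ζ] x = from (L-generated x)
      where
      from : ∀ {x} → Adjoin γ (Image κ) x → F[ζ] x
      from (base f)        = F[ζ]-γ f
      from (gen (k , eq))  = F[ζ]-resp eq (κ∈F[ζ] (K-generated k))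
      from (add u v)       = plus (from u) (from v) refl
      from (neg u)         = F[ζ]-neg (from u)
      from (mul u v)       = F[ζ]-* (from u) (from v)
      from (inv u eq)      = F[ζ]-inv (from u) eq
      from (resp eq u)     = F[ζ]-resp eq (from u) 

  -- Extension of the automorphisms of F to L.

  module Lifting where
    open CyclotomicAction
    open Structure
    private
      module F-cyclic = IsCyclicOfDegree F-cyclic

    module Galois = CyclicGroup ιF F-cyclic.degree F-cyclic.fixedField (proj₁ F-cyclic.cyclic) (proj₂ F-cyclic.cyclic)
    open Galois using (fixed⇒rational)

    ext : (φ ψ : Extension L L) → (∀ f → Extension.⟦_⟧ φ γ.⟦ f ⟧ ≈ Extension.⟦_⟧ ψ γ.⟦ f ⟧) →
          Extension.⟦_⟧ φ ζ ≈ Extension.⟦_⟧ ψ ζ → ∀ x → Extension.⟦_⟧ φ x ≈ Extension.⟦_⟧ ψ x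
    ext φ ψ eqγ eqζ x = F[ζ]-ext φ ψ eqγ eqζ (L≡F[ζ] x)

    τᵐ≈id : ∀ x → τ^ m x ≈ x
    τᵐ≈id x = τᵐ≈id-F[ζ] (L≡F[ζ] x)

    τ-fixed∈F : ∀ {x} → τ^ 1 x ≈ x → Image γ x
    τ-fixed∈F = τ-fixed∈F-F[ζ] (L≡F[ζ] _)

    ζ̄ : Carrier
    ζ̄ = ζ ^ m

    ζζ̄≈1 : ζ * ζ̄ ≈ 1#
    ζζ̄≈1 = trans (reflexive (≡.cong (ζ ^_) 1+m≡p)) ζⁿ≈1

    -- The p elements 1, ζ, ..., ζᵖ⁻¹ span L over F but are linearly dependent. Traces against
    -- powers of ζ⁻¹ are coefficients that are additive in x and respect equality, so no basis has
    -- to be chosen.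
    coordinate : ℕ → Carrier → F.Carrier
    coordinate k x = proj₁ (Tr∈F (L≡F[ζ] (x * ζ̄ ^ k)))

    γ-coordinate : ∀ k x → γ.⟦ coordinate k x ⟧ ≈ Tr (x * ζ̄ ^ k)
    γ-coordinate k x = proj₂ (Tr∈F (L≡F[ζ] (x * ζ̄ ^ k)))

    p*x≈∑Tr : ∀ x → nat p * x ≈ ∑ p (λ k → Tr (x * ζ̄ ^ k) * ζ ^ k)
    p*x≈∑Tr = fourier 0<m τ^ (λ i → τ^.*-homo i _ _) (λ _ → refl) τ^.1#-homo ζζ̄≈1 root′ distinct
      where
      τⁱζ̄-inverse : ∀ i → τ^ i ζ̄ * τ^ i ζ ≈ 1#
      τⁱζ̄-inverse i = trans (sym (τ^.*-homo i _ _)) (trans (τ^.⟦⟧-cong i (trans (*-comm _ _) ζζ̄≈1)) (τ^.1#-homo i))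
      root′ : ∀ i → (τ^ i ζ̄ * ζ) ^ p ≈ 1#
      root′ i = trans (^-distrib-* (τ^ i ζ̄) ζ p) (trans (*-cong
        (trans (sym (τ^-hom.hom-^ i ζ̄ p)) (trans (τ^.⟦⟧-cong i ([ζ^i]ⁿ≈1 m)) (τ^.1#-homo i))) ζⁿ≈1) (*-identityˡ 1#))
      distinct : ∀ i → 0 < i → i < m → τ^ i ζ̄ * ζ ≉ 1#
      distinct i 0<i i<m eq = τⁱζ≉ζ 0<i i<m (sym (*-cancelˡ (invertible⇒≉0 (τⁱζ̄-inverse i)) (trans eq (sym (τⁱζ̄-inverse i)))))

    1/p : Carrier
    1/p = proj₁ (inverse (nat≉0 p 0<p))

    p*1/p≈1 : nat p * 1/p ≈ 1#
    p*1/p≈1 = proj₂ (inverse (nat≉0 p 0<p))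

    1/p*[p*x] : ∀ x → 1/p * (nat p * x) ≈ x
    1/p*[p*x] x = trans (solve 3 (λ w p x → w :* (p :* x) := (p :* w) :* x) 1/p (nat p) x)
                        (trans (*-congʳ p*1/p≈1) (*-identityˡ x))

    -- Acting on the coefficients of x = p⁻¹ ∑ₖ Tr(x ζ⁻ᵏ) ζᵏ extends an endomorphism of F to L.
    module _ (φ : Extension F F) where
      private module φ = Extension φ

      ∑φ : Carrier → Carrier
      ∑φ x = ∑ p (λ k → γ.⟦ φ.⟦ coordinate k x ⟧ ⟧ * ζ ^ k)

      φ-coordinate-cong : ∀ k x {f} → γ.⟦ f ⟧ ≈ Tr (x * ζ̄ ^ k) → γ.⟦ φ.⟦ coordinate k x ⟧ ⟧ ≈ γ.⟦ φ.⟦ f ⟧ ⟧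
      φ-coordinate-cong k x eq = γ.⟦⟧-cong (φ.⟦⟧-cong (γ.hom-injective (trans (γ-coordinate k x) (sym eq))))

      lift-fun : Carrier → Carrier
      lift-fun x = 1/p * ∑φ x

      lift-cong : ∀ {x y} → x ≈ y → lift-fun x ≈ lift-fun y
      lift-cong {x} {y} x≈y = *-congˡ (∑-cong′ p λ k → *-congʳ
        (φ-coordinate-cong k x (trans (γ-coordinate k y) (Tr-cong (*-congʳ (sym x≈y))))))

      lift-+ : ∀ x y → lift-fun (x + y) ≈ lift-fun x + lift-fun y
      lift-+ x y = begin
        1/p * ∑φ (x + y)             ≈⟨ *-congˡ (∑-cong′ p λ k → trans (*-congʳ (additive k)) (distribʳ _ _ _)) ⟩
        1/p * ∑ p (λ k → γ.⟦ φ.⟦ coordinate k x ⟧ ⟧ * ζ ^ k + γ.⟦ φ.⟦ coordinate k y ⟧ ⟧ * ζ ^ k)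
                                     ≈⟨ *-congˡ (∑-+ p (λ k → γ.⟦ φ.⟦ coordinate k x ⟧ ⟧ * ζ ^ k) (λ k → γ.⟦ φ.⟦ coordinate k y ⟧ ⟧ * ζ ^ k)) ⟩
        1/p * (∑φ x + ∑φ y)          ≈⟨ distribˡ 1/p (∑φ x) (∑φ y) ⟩
        1/p * ∑φ x + 1/p * ∑φ y      ∎
        where
        additive : ∀ k → γ.⟦ φ.⟦ coordinate k (x + y) ⟧ ⟧ ≈ γ.⟦ φ.⟦ coordinate k x ⟧ ⟧ + γ.⟦ φ.⟦ coordinate k y ⟧ ⟧
        additive k = trans (φ-coordinate-cong k (x + y) (trans (γ.+-homo _ _)
          (trans (+-cong (γ-coordinate k x) (γ-coordinate k y)) (trans (sym (Tr-+ _ _)) (Tr-cong (sym (distribʳ (ζ̄ ^ k) x y)))))))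
          (trans (γ.⟦⟧-cong (φ.+-homo _ _)) (γ.+-homo _ _))

      -- The coordinates of b ζⁿ are b times the integers Tr(ζⁿ⁻ᵏ), which φ fixes. Hence φ(b) comes
      -- out of the sum, and the inversion formula for ζⁿ reassembles the rest.
      lift-term : ∀ b n → lift-fun (γ.⟦ b ⟧ * ζ ^ n) ≈ γ.⟦ φ.⟦ b ⟧ ⟧ * ζ ^ n
      lift-term b n = begin
        1/p * ∑φ (γ.⟦ b ⟧ * ζ ^ n)                                        ≈⟨ *-congˡ (∑-cong′ p term-k) ⟩
        1/p * ∑ p (λ k → γ.⟦ φ.⟦ b ⟧ ⟧ * (Tr (ζ ^ n * ζ̄ ^ k) * ζ ^ k))    ≈⟨ *-congˡ (*-∑ p γ.⟦ φ.⟦ b ⟧ ⟧ (λ k → Tr (ζ ^ n * ζ̄ ^ k) * ζ ^ k)) ⟨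
        1/p * (γ.⟦ φ.⟦ b ⟧ ⟧ * ∑ p (λ k → Tr (ζ ^ n * ζ̄ ^ k) * ζ ^ k))    ≈⟨ *-congˡ (*-congˡ (p*x≈∑Tr (ζ ^ n))) ⟨
        1/p * (γ.⟦ φ.⟦ b ⟧ ⟧ * (nat p * ζ ^ n))                           ≈⟨ solve 4 (λ w b p z → w :* (b :* (p :* z)) := b :* (w :* (p :* z))) _ _ _ _ ⟩
        γ.⟦ φ.⟦ b ⟧ ⟧ * (1/p * (nat p * ζ ^ n))                           ≈⟨ *-congˡ (1/p*[p*x] (ζ ^ n)) ⟩
        γ.⟦ φ.⟦ b ⟧ ⟧ * ζ ^ n                                             ∎
        where
        integer-trace : ∀ k → ∃[ z ] Tr (ζ ^ n * ζ̄ ^ k) ≈ int z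
        integer-trace k with Tr-ζ^ (n ℕ.+ m ℕ.* k)
        ... | z , eq = z , trans (Tr-cong (trans (*-congˡ (^-assocʳ ζ m k)) (^-+ ζ n (m ℕ.* k)))) eq
        term-k : ∀ k → γ.⟦ φ.⟦ coordinate k (γ.⟦ b ⟧ * ζ ^ n) ⟧ ⟧ * ζ ^ k ≈ γ.⟦ φ.⟦ b ⟧ ⟧ * (Tr (ζ ^ n * ζ̄ ^ k) * ζ ^ k)
        term-k k with integer-trace k
        ... | z , eq = begin
          γ.⟦ φ.⟦ coordinate k (γ.⟦ b ⟧ * ζ ^ n) ⟧ ⟧ * ζ ^ k   ≈⟨ *-congʳ (φ-coordinate-cong k (γ.⟦ b ⟧ * ζ ^ n) (begin
            γ.⟦ b F.* F.int z ⟧                    ≈⟨ γ.*-homo b (F.int z) ⟩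
            γ.⟦ b ⟧ * int z                        ≈⟨ *-congˡ eq ⟨
            γ.⟦ b ⟧ * Tr (ζ ^ n * ζ̄ ^ k)           ≈⟨ Tr-γ* b (ζ ^ n * ζ̄ ^ k) ⟨
            Tr (γ.⟦ b ⟧ * (ζ ^ n * ζ̄ ^ k))         ≈⟨ Tr-cong (*-assoc _ _ _) ⟨
            Tr (γ.⟦ b ⟧ * ζ ^ n * ζ̄ ^ k)           ∎)) ⟩
          γ.⟦ φ.⟦ b F.* F.int z ⟧ ⟧ * ζ ^ k                    ≈⟨ *-congʳ (trans (γ.⟦⟧-cong (φ.*-homo b (F.int z))) (γ.*-homo _ _)) ⟩
          γ.⟦ φ.⟦ b ⟧ ⟧ * γ.⟦ φ.⟦ F.int z ⟧ ⟧ * ζ ^ k          ≈⟨ *-congʳ (*-congˡ (trans (γ.⟦⟧-cong (Embedding.hom-int ιF ιF φ z)) (sym eq))) ⟩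
          γ.⟦ φ.⟦ b ⟧ ⟧ * Tr (ζ ^ n * ζ̄ ^ k) * ζ ^ k           ≈⟨ *-assoc _ _ _ ⟩
          γ.⟦ φ.⟦ b ⟧ ⟧ * (Tr (ζ ^ n * ζ̄ ^ k) * ζ ^ k)         ∎

      lift-γ : ∀ b → lift-fun γ.⟦ b ⟧ ≈ γ.⟦ φ.⟦ b ⟧ ⟧
      lift-γ b = trans (lift-cong (sym (*-identityʳ _))) (trans (lift-term b 0) (*-identityʳ _))

      lift-* : ∀ x y → lift-fun (x * y) ≈ lift-fun x * lift-fun y
      lift-* x y = go (L≡F[ζ] x) (L≡F[ζ] y)
        where
        go : ∀ {x y} → F[ζ] x → F[ζ] y → lift-fun (x * y) ≈ lift-fun x * lift-fun y
        go (plus u v eq) w = trans (lift-cong (trans (*-congʳ eq) (distribʳ _ _ _))) (trans (lift-+ _ _)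
          (trans (+-cong (go u w) (go v w)) (sym (trans (*-congʳ (trans (lift-cong eq) (lift-+ _ _))) (distribʳ _ _ _)))))
        go u@(term _ _ _) (plus v w eq) = trans (lift-cong (trans (*-congˡ eq) (distribˡ _ _ _))) (trans (lift-+ _ _)
          (trans (+-cong (go u v) (go u w)) (sym (trans (*-congˡ (trans (lift-cong eq) (lift-+ _ _))) (distribˡ _ _ _)))))
        go {x} {y} (term b i eq) (term b′ j eq′) = begin
          lift-fun (x * y)                                      ≈⟨ lift-cong (trans (*-cong eq eq′) regroup) ⟩
          lift-fun (γ.⟦ b F.* b′ ⟧ * ζ ^ (i ℕ.+ j))             ≈⟨ lift-term (b F.* b′) (i ℕ.+ j) ⟩
          γ.⟦ φ.⟦ b F.* b′ ⟧ ⟧ * ζ ^ (i ℕ.+ j)                  ≈⟨ *-congʳ (γ.⟦⟧-cong (φ.*-homo b b′)) ⟩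
          γ.⟦ φ.⟦ b ⟧ F.* φ.⟦ b′ ⟧ ⟧ * ζ ^ (i ℕ.+ j)            ≈⟨ regroup ⟨
          (γ.⟦ φ.⟦ b ⟧ ⟧ * ζ ^ i) * (γ.⟦ φ.⟦ b′ ⟧ ⟧ * ζ ^ j)    ≈⟨ *-cong (trans (lift-cong eq) (lift-term b i)) (trans (lift-cong eq′) (lift-term b′ j)) ⟨
          lift-fun x * lift-fun y                               ∎
          where
          regroup : ∀ {b b′} → (γ.⟦ b ⟧ * ζ ^ i) * (γ.⟦ b′ ⟧ * ζ ^ j) ≈ γ.⟦ b F.* b′ ⟧ * ζ ^ (i ℕ.+ j)
          regroup {b} {b′} = trans (solve 4 (λ a b c d → (a :* b) :* (c :* d) := (a :* c) :* (b :* d)) _ _ _ _)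
            (*-cong (sym (γ.*-homo b b′)) (^-+ ζ i j))

      lift-1 : lift-fun 1# ≈ 1#
      lift-1 = trans (lift-cong (sym γ.1#-homo)) (trans (lift-γ F.1#) (trans (γ.⟦⟧-cong φ.1#-homo) γ.1#-homo))

      lift : Extension L L
      lift = ringMap⇒ₑ lift-fun lift-cong lift-+ lift-* lift-1

      lift-ζ : lift-fun ζ ≈ ζ
      lift-ζ = begin
        lift-fun ζ                     ≈⟨ lift-cong (trans (*-cong γ.1#-homo (*-identityʳ ζ)) (*-identityˡ ζ)) ⟨
        lift-fun (γ.⟦ F.1# ⟧ * ζ ^ 1)  ≈⟨ lift-term F.1# 1 ⟩
        γ.⟦ φ.⟦ F.1# ⟧ ⟧ * ζ ^ 1       ≈⟨ *-cong (trans (γ.⟦⟧-cong φ.1#-homo) γ.1#-homo) (*-identityʳ ζ) ⟩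
        1# * ζ                         ≈⟨ *-identityˡ ζ ⟩
        ζ                              ∎

    σ^ₑ : ℕ → Extension L L
    σ^ₑ i = lift Galois.σ ^ₑ i

    module σ^ i = Extension (σ^ₑ i)
    module σ^-hom i = Embedding ι ι (σ^ₑ i)

    σ^ : ℕ → Carrier → Carrier
    σ^ i = σ^.⟦_⟧ i

    σ^-γ : ∀ i f → σ^ i γ.⟦ f ⟧ ≈ γ.⟦ Galois.σ^ i f ⟧
    σ^-γ zero    f = refl
    σ^-γ (suc i) f = trans (σ^.⟦⟧-cong 1 (σ^-γ i f)) (lift-γ Galois.σ (Galois.σ^ i f))

    σ^-ζ : ∀ i → σ^ i ζ ≈ ζ
    σ^-ζ zero    = refl
    σ^-ζ (suc i) = trans (σ^.⟦⟧-cong 1 (σ^-ζ i)) (lift-ζ Galois.σ)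

    σ^-+ : ∀ i j x → σ^ (i ℕ.+ j) x ≈ σ^ i (σ^ j x)
    σ^-+ i j x = reflexive (^ₑ-+ (lift Galois.σ) i j x)

    σᵖ≈id : ∀ x → σ^ p x ≈ x
    σᵖ≈id = ext (σ^ₑ p) idₑ (λ f → trans (σ^-γ p f) (γ.⟦⟧-cong (Galois.σᵖ≈id f))) (σ^-ζ p)

    στ-comm : ∀ i j x → σ^ i (τ^ j x) ≈ τ^ j (σ^ i x)
    στ-comm i j = ext (σ^ₑ i ∘ₑ τ^ₑ j) (τ^ₑ j ∘ₑ σ^ₑ i)
      (λ f → trans (σ^.⟦⟧-cong i (τ^-γ j f)) (trans (σ^-γ i f) (sym (trans (τ^.⟦⟧-cong j (σ^-γ i f)) (τ^-γ j _)))))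
      (begin
        σ^ i (τ^ j ζ)          ≈⟨ σ^.⟦⟧-cong i (τ^-ζ j) ⟩
        σ^ i (ζ ^ (e ℕ.^ j))   ≈⟨ σ^-hom.hom-^ i ζ (e ℕ.^ j) ⟩
        σ^ i ζ ^ (e ℕ.^ j)     ≈⟨ ^-congˡ (e ℕ.^ j) (σ^-ζ i) ⟩
        ζ ^ (e ℕ.^ j)          ≈⟨ τ^-ζ j ⟨
        τ^ j ζ                 ≈⟨ τ^.⟦⟧-cong j (σ^-ζ i) ⟨
        τ^ j (σ^ i ζ)          ∎)

    -- If σ fixes x, then it fixes the coordinates of x, as it fixes ζ and commutes with τ. Elements
    -- of F fixed by σ are rational, so the inversion formula expresses x in ζ with rational
    -- coefficients.
    σ-fixed∈K : ∀ {x} → σ^ 1 x ≈ x → Image κ x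
    σ-fixed∈K {x} σx≈x = in-image 1/p-in (∑-in p (λ k → *-in (coordinate-in k) (ζ^-in k)))
      where
      *-in : ∀ {x y} → Image κ x → Image κ y → Image κ (x * y)
      *-in (a , eq) (b , eq′) = a K.* b , trans (κ.*-homo a b) (*-cong eq eq′)
      ∑-in : ∀ n {f : ℕ → Carrier} → (∀ k → Image κ (f k)) → Image κ (∑ n f)
      ∑-in zero    _  = K.0# , κ.0#-homo
      ∑-in (suc n) im with im 0 | ∑-in n (im ∘ suc)
      ... | a , eq | b , eq′ = a K.+ b , trans (κ.+-homo a b) (+-cong eq eq′)
      rational-in : ∀ {x} → Image ι x → Image κ x
      rational-in (r , eq) = Extension.⟦_⟧ ιK r , trans (κ.hom-ι r) eq
      ζ^-in : ∀ k → Image κ (ζ ^ k)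
      ζ^-in k = ζ′ K.^ k , κ.hom-^ ζ′ k
      coordinate-fixed : ∀ k → Galois.σ^ 1 (coordinate k x) F.≈ coordinate k x
      coordinate-fixed k = γ.hom-injective (begin
        γ.⟦ Galois.σ^ 1 (coordinate k x) ⟧         ≈⟨ σ^-γ 1 (coordinate k x) ⟨
        σ^ 1 γ.⟦ coordinate k x ⟧                  ≈⟨ σ^.⟦⟧-cong 1 (γ-coordinate k x) ⟩
        σ^ 1 (Tr (x * ζ̄ ^ k))                      ≈⟨ σ^-hom.hom-∑ 1 m (λ i → τ^ i (x * ζ̄ ^ k)) ⟩
        ∑ m (λ i → σ^ 1 (τ^ i (x * ζ̄ ^ k)))        ≈⟨ ∑-cong′ m (λ i → στ-comm 1 i (x * ζ̄ ^ k)) ⟩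
        Tr (σ^ 1 (x * ζ̄ ^ k))                      ≈⟨ Tr-cong (trans (σ^.*-homo 1 x (ζ̄ ^ k)) (*-cong σx≈x
                                                       (trans (σ^-hom.hom-^ 1 ζ̄ k) (^-congˡ k (trans (σ^-hom.hom-^ 1 ζ m) (^-congˡ m (σ^-ζ 1))))))) ⟩
        Tr (x * ζ̄ ^ k)                             ≈⟨ γ-coordinate k x ⟨
        γ.⟦ coordinate k x ⟧                       ∎)
      coordinate-in : ∀ k → Image κ (Tr (x * ζ̄ ^ k))
      coordinate-in k = F-rational (γ-coordinate k x) (fixed⇒rational (coordinate-fixed k))
        where
        F-rational : ∀ {f y} → γ.⟦ f ⟧ ≈ y → Image ιF f → Image κ y
        F-rational eq (r , eq′) = rational-in (r , trans (γ.⟦⟧-cong eq′) eq)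
      1/p-in : Image κ 1/p
      1/p-in with nat-inverse p 0<p
      ... | r , eq = rational-in (r , *-cancelˡ (nat≉0 p 0<p) (trans eq (sym p*1/p≈1)))
      in-image : Image κ 1/p → Image κ (∑ p (λ k → Tr (x * ζ̄ ^ k) * ζ ^ k)) → Image κ x
      in-image u v with *-in u v
      ... | a , eq = a , trans eq (trans (*-congˡ (sym (p*x≈∑Tr x))) (1/p*[p*x] x))

    στ-fixed∈ℚ : ∀ {x} → σ^ 1 x ≈ x → τ^ 1 x ≈ x → Image ι x
    στ-fixed∈ℚ {x} σx≈x τx≈x = from (τ-fixed∈F τx≈x)
      where
      from : Image γ x → Image ι x
      from (f , γf≈x) = rational (fixed⇒rational (γ.hom-injective
        (trans (sym (σ^-γ 1 f)) (trans (σ^.⟦⟧-cong 1 γf≈x) (trans σx≈x (sym γf≈x))))))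
        where
        rational : Image ιF f → Image ι x
        rational (r , eq) = r , trans (γ.⟦⟧-cong eq) γf≈x

  -- Norms from L to K, the map Φ, and p-th powers.

  module GaloisGroup where
    open CyclotomicAction
    open Structure
    open Lifting

    K-fixed : (φ : Extension L L) → Extension.⟦_⟧ φ ζ ≈ ζ → ∀ x → Extension.⟦_⟧ φ κ.⟦ x ⟧ ≈ κ.⟦ x ⟧
    K-fixed φ φζ≈ζ x = go (K-generated x)
      where
      module φ = Extension φ
      go : ∀ {x} → Adjoin ιK (Field._≈_ K ζ′) x → φ.⟦ κ.⟦ x ⟧ ⟧ ≈ κ.⟦ x ⟧
      go (base r)    = trans (φ.⟦⟧-cong (κ.hom-ι r)) (trans (Embedding.hom-ι ι ι φ r) (sym (κ.hom-ι r)))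
      go (gen eq)    = trans (φ.⟦⟧-cong (sym (κ.⟦⟧-cong eq))) (trans φζ≈ζ (κ.⟦⟧-cong eq))
      go (add u v)   = trans (φ.⟦⟧-cong (κ.+-homo _ _)) (trans (φ.+-homo _ _) (trans (+-cong (go u) (go v)) (sym (κ.+-homo _ _))))
      go (neg u)     = trans (φ.⟦⟧-cong (κ.-‿homo _)) (trans (φ.-‿homo _) (trans (-‿cong (go u)) (sym (κ.-‿homo _))))
      go (mul u v)   = trans (φ.⟦⟧-cong (κ.*-homo _ _)) (trans (φ.*-homo _ _) (trans (*-cong (go u) (go v)) (sym (κ.*-homo _ _))))
      go (resp eq u) = trans (φ.⟦⟧-cong (sym (κ.⟦⟧-cong eq))) (trans (go u) (κ.⟦⟧-cong eq))
      go (inv {x} {y} u eq) = *-cancelˡ (invertible⇒≉0 κxκy≈1) (begin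
        κ.⟦ x ⟧ * φ.⟦ κ.⟦ y ⟧ ⟧           ≈⟨ *-congʳ (go u) ⟨
        φ.⟦ κ.⟦ x ⟧ ⟧ * φ.⟦ κ.⟦ y ⟧ ⟧     ≈⟨ φ.*-homo _ _ ⟨
        φ.⟦ κ.⟦ x ⟧ * κ.⟦ y ⟧ ⟧           ≈⟨ trans (φ.⟦⟧-cong κxκy≈1) φ.1#-homo ⟩
        1#                                ≈⟨ κxκy≈1 ⟨
        κ.⟦ x ⟧ * κ.⟦ y ⟧                 ∎)
        where
        κxκy≈1 : κ.⟦ x ⟧ * κ.⟦ y ⟧ ≈ 1#
        κxκy≈1 = trans (sym (κ.*-homo _ _)) (trans (κ.⟦⟧-cong eq) κ.1#-homo)

    σ^-inverse : ∀ {i} → i ≤ p → ∀ x → σ^ i (σ^ (p ∸ i) x) ≈ x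
    σ^-inverse {i} i≤p x = trans (sym (σ^-+ i (p ∸ i) x))
      (trans (reflexive (≡.cong (λ n → σ^ n x) (ℕ.m+[n∸m]≡n i≤p))) (σᵖ≈id x))

    σ-gal : Fin p → Gal κ
    σ-gal i = record
      { ⟦_⟧               = σ^ (toℕ i)
      ; isRingIsomorphism = record
        { isRingMonomorphism = record
          { isRingHomomorphism = σ^.isRingHomomorphism (toℕ i)
          ; injective          = σ^-hom.hom-injective (toℕ i)
          }
        ; surjective = λ y → σ^ (p ∸ toℕ i) y , λ eq → trans (σ^.⟦⟧-cong (toℕ i) eq) (σ^-inverse (ℕ.<⇒≤ (Fin.toℕ<n i)) y)
        }
      ; fixes             = K-fixed (σ^ₑ (toℕ i)) (σ^-ζ (toℕ i))
      }

    σ^γ-injective : ∀ {i j} → i < p → j < p → (∀ f → σ^ i γ.⟦ f ⟧ ≈ σ^ j γ.⟦ f ⟧) → i ≡ j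
    σ^γ-injective {i} {j} i<p j<p eq = compare (ℕ.<-cmp i j)
      where
      eqF : ∀ f → Galois.σ^ i f F.≈ Galois.σ^ j f
      eqF f = γ.hom-injective (trans (sym (σ^-γ i f)) (trans (eq f) (σ^-γ j f)))
      compare : Tri.Tri (i < j) (i ≡ j) (j < i) → i ≡ j
      compare (Tri.tri< i<j _ _) = contradiction eqF (Galois.σⁱ≉σʲ i<j j<p)
      compare (Tri.tri≈ _ i≡j _) = i≡j
      compare (Tri.tri> _ _ j<i) = contradiction (λ f → F.sym (eqF f)) (Galois.σⁱ≉σʲ j<i i<p)

    -- σ⁰, …, σᵖ⁻¹ and ρ are p + 1 embeddings of F, so two of them coincide.
    σ-gal-surjective : ∀ (ρ : Gal κ) → ∃[ i ] (∀ x → σ^ (toℕ i) x ≈ Gal.⟦ ρ ⟧ x)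
    σ-gal-surjective ρ = from (Coincidence.embeddings-coincide ιF ι (IsCyclicOfDegree.degree F-cyclic) χ)
      where
      ρₑ : Extension L L
      ρₑ = gal⇒ₑ ρ
      select : ∀ {n} → Dec (n < p) → Extension F L
      select {n} (yes _) = σ^ₑ n ∘ₑ γ
      select     (no _)  = ρₑ ∘ₑ γ
      χ : ℕ → Extension F L
      χ n = select (n ℕ.<? p)
      χ-< : ∀ n → n < p → ∀ f → Extension.⟦_⟧ (χ n) f ≈ σ^ n γ.⟦ f ⟧
      χ-< n n<p f = go (n ℕ.<? p)
        where
        go : (d : Dec (n < p)) → Extension.⟦_⟧ (select d) f ≈ σ^ n γ.⟦ f ⟧
        go (yes _)   = refl
        go (no n≮p)  = contradiction n<p n≮p
      χ-p : ∀ n → ¬ (n < p) → ∀ f → Extension.⟦_⟧ (χ n) f ≈ Gal.⟦ ρ ⟧ γ.⟦ f ⟧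
      χ-p n n≮p f = go (n ℕ.<? p)
        where
        go : (d : Dec (n < p)) → Extension.⟦_⟧ (select d) f ≈ Gal.⟦ ρ ⟧ γ.⟦ f ⟧
        go (yes n<p) = contradiction n<p n≮p
        go (no _)    = refl
      from : ∃[ i ] ∃[ j ] i < j × j ≤ p × (∀ f → Extension.⟦_⟧ (χ i) f ≈ Extension.⟦_⟧ (χ j) f) →
             ∃[ i ] (∀ x → σ^ (toℕ {p} i) x ≈ Gal.⟦ ρ ⟧ x)
      from (i , j , i<j , j≤p , eq) = split (j ℕ.<? p)
        where
        i<p : i < p
        i<p = ℕ.<-≤-trans i<j j≤p
        split : Dec (j < p) → ∃[ i ] (∀ x → σ^ (toℕ {p} i) x ≈ Gal.⟦ ρ ⟧ x)
        split (yes j<p) = contradiction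
          (σ^γ-injective i<p j<p λ f → trans (sym (χ-< i i<p f)) (trans (eq f) (χ-< j j<p f))) (ℕ.<⇒≢ i<j)
        split (no j≮p)  = Fin.fromℕ< i<p , λ x → trans (reflexive (≡.cong (λ n → σ^ n x) (Fin.toℕ-fromℕ< i<p)))
          (ext (σ^ₑ i) ρₑ (λ f → trans (sym (χ-< i i<p f)) (trans (eq f) (χ-p j j≮p f)))
            (trans (σ^-ζ i) (sym (Gal.fixes ρ ζ′))) x)

    N : Carrier → Carrier
    N x = ∏ p (λ i → σ^ i x)

    N-isNorm : ∀ x → IsNorm κ x (N x)
    N-isNorm x = p , record
      { to        = σ-gal
      ; cong      = λ { ≡.refl x → refl }
      ; bijective = (λ eq → Fin.toℕ-injective (σ^γ-injective (Fin.toℕ<n _) (Fin.toℕ<n _) (λ f → eq γ.⟦ f ⟧)))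
                  , λ ρ → proj₁ (σ-gal-surjective ρ) , λ { ≡.refl → proj₂ (σ-gal-surjective ρ) }
      } , reflexive (∏≡product p (λ i → σ^ i x))

    open Induced γ κ p e ζ′ τ using (Φ)

    weight : ℕ → ℕ
    weight i = e ℕ.^ (p ∸ 2 ∸ i)

    Φ≈∏ : ∀ x → Φ x ≈ ∏ m (λ i → τ^ i x ^ weight i)
    Φ≈∏ x = sym (trans (∏-cong′ m (λ i → ^-congˡ (weight i) (reflexive (^ₑ-fold (gal⇒ₑ τ) i x))))
      (reflexive (∏≡product m (λ i → fold x (Gal.⟦_⟧ τ) i ^ weight i))))

    Φ-cong : ∀ {x y} → x ≈ y → Φ x ≈ Φ y
    Φ-cong {x} {y} eq = trans (Φ≈∏ x) (trans (∏-cong′ m (λ i → ^-congˡ (weight i) (τ^.⟦⟧-cong i eq))) (sym (Φ≈∏ y)))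

    Φ-* : ∀ x y → Φ (x * y) ≈ Φ x * Φ y
    Φ-* x y = trans (Φ≈∏ (x * y)) (trans
      (∏-cong′ m (λ i → trans (^-congˡ (weight i) (τ^.*-homo i x y)) (^-distrib-* _ _ (weight i))))
      (trans (∏-* m (λ i → τ^ i x ^ weight i) (λ i → τ^ i y ^ weight i)) (sym (*-cong (Φ≈∏ x) (Φ≈∏ y)))))

    Φ-^ : ∀ x n → Φ (x ^ n) ≈ Φ x ^ n
    Φ-^ x n = trans (Φ≈∏ (x ^ n)) (trans
      (∏-cong′ m (λ i → trans (^-congˡ (weight i) (τ^-hom.hom-^ i x n)) (^-comm _ n (weight i))))
      (trans (sym (∏-^ m n (λ i → τ^ i x ^ weight i))) (^-congˡ n (sym (Φ≈∏ x)))))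

    Φ-≉0 : ∀ {x} → x ≉ 0# → Φ x ≉ 0#
    Φ-≉0 {x} x≉0 eq = ∏-≉0 m (λ i _ → ^-≉0 (weight i) (τ^-hom.hom-≉0 i x≉0)) (trans (sym (Φ≈∏ x)) eq)

    -- As τⁱ(ζ) is ζ to the power eⁱ, the weights make all m factors equal to ζ to the power eᵖ⁻².
    -- Here the matching of τ and e is decisive: the total exponent is prime to p.
    Φζ : Φ ζ ≈ ζ ^ (e ℕ.^ (p ∸ 2) ℕ.* m)
    Φζ = begin
      Φ ζ                                    ≈⟨ Φ≈∏ ζ ⟩
      ∏ m (λ i → τ^ i ζ ^ weight i)          ≈⟨ ∏-cong m (λ i i<m → trans (^-congˡ (weight i) (τ^-ζ i)) (trans (^-assocʳ ζ (e ℕ.^ i) (weight i))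
                                                  (reflexive (≡.cong (ζ ^_) (≡.trans (≡.sym (ℕ.^-distribˡ-+-* e i (p ∸ 2 ∸ i)))
                                                    (≡.cong (e ℕ.^_) (ℕ.m+[n∸m]≡n (bound i<m)))))))) ⟩
      ∏ m (λ _ → ζ ^ (e ℕ.^ (p ∸ 2)))        ≈⟨ ∏-const m _ ⟩
      (ζ ^ (e ℕ.^ (p ∸ 2))) ^ m              ≈⟨ ^-assocʳ ζ (e ℕ.^ (p ∸ 2)) m ⟩
      ζ ^ (e ℕ.^ (p ∸ 2) ℕ.* m)              ∎
      where
      bound : ∀ {i} → i < m → i ≤ p ∸ 2
      bound {i} i<m = ≡.subst (i ≤_) (ℕ.∸-+-assoc p 1 1) (ℕ.<⇒≤pred i<m)

    Power : Carrier → Set _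
    Power = IsNonzeroPower L p

    Power-resp : ∀ {x y} → x ≈ y → Power x → Power y
    Power-resp eq (z , z#0 , eq′) = z , z#0 , trans (sym eq) eq′

    ^-Power : ∀ {x} → x ≉ 0# → Power (x ^ p)
    ^-Power {x} x≉0 = x , ≉⇒# x≉0 , refl

    Power-* : ∀ {x y} → Power x → Power y → Power (x * y)
    Power-* (z , z#0 , eq) (w , w#0 , eq′) = z * w , x#0y#0→xy#0 z#0 w#0 ,
      trans (*-cong eq eq′) (sym (^-distrib-* z w p))

    Power-/ : ∀ {x y} → Power x → Power (x * y) → Power y
    Power-/ {x} {y} (z , z#0 , eq) (w , w#0 , eq′) = v * w , x#0y#0→xy#0 (≉⇒# v≉0) w#0 , *-cancelˡ (^-≉0 p z≉0) (begin
      z ^ p * y                ≈⟨ trans (*-congʳ (sym eq)) eq′ ⟩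
      w ^ p                    ≈⟨ trans (*-congʳ (trans (^-congˡ p zv≈1) (1^n≈1 p))) (*-identityˡ _) ⟨
      (z * v) ^ p * w ^ p      ≈⟨ *-congʳ (^-distrib-* z v p) ⟩
      z ^ p * v ^ p * w ^ p    ≈⟨ trans (*-assoc _ _ _) (*-congˡ (sym (^-distrib-* v w p))) ⟩
      z ^ p * (v * w) ^ p      ∎)
      where
      z≉0 : z ≉ 0#
      z≉0 = #⇒≉ z#0
      v : Carrier
      v = proj₁ (inverse z≉0)
      zv≈1 : z * v ≈ 1#
      zv≈1 = proj₂ (inverse z≉0)
      v≉0 : v ≉ 0#
      v≉0 = invertible⇒≉0 (trans (*-comm v z) zv≈1)

  -- The case in which L is generated by a primitive p²-th root of unity.

  module CyclotomicCase where
    open CyclotomicAction using (ζⁿ≈1)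
    open GaloisGroup
    open Induced γ κ p e ζ′ τ

    -- The p-th power of ω is a primitive p-th root of unity, so ζ = (ωᵖ)ʲ = (ωʲ)ᵖ for some j, and Φ
    -- commutes with powers.
    Φζ-Power : IsCyclotomic ι (p ℕ.^ 2) → Power (Φ ζ)
    Φζ-Power (ω , (ω^p²≈1 , ω-primitive) , _) = from (RootOfUnity.root ωᵖ-primitive 0<p ζⁿ≈1)
      where
      ωᵖ-primitive : IsPrimitiveRootOfUnity L p (ω ^ p)
      ωᵖ-primitive = trans (^-assocʳ ω p p) (trans (reflexive (≡.cong (ω ^_) (≡.cong (p ℕ.*_) (≡.sym (ℕ.*-identityʳ p))))) ω^p²≈1) ,
        λ i 0<i i<p eq → ω-primitive (p ℕ.* i) (ℕ.*-mono-< 0<p 0<i)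
          (ℕ.*-monoʳ-< p (≡.subst (i <_) (≡.sym (ℕ.*-identityʳ p)) i<p)) (trans (sym (^-assocʳ ω p i)) eq)
      from : ∃[ j ] ζ ≈ (ω ^ p) ^ j → Power (Φ ζ)
      from (j , eq) = Power-resp (sym (trans (Φ-cong (trans eq (^-comm ω p j))) (Φ-^ (ω ^ j) p)))
        (^-Power (Φ-≉0 (^-≉0 j ω≉0)))
        where
        ω≉0 : ω ≉ 0#
        ω≉0 = RootOfUnity.ζ≉0 {p ℕ.^ 2} (ω^p²≈1 , ω-primitive) (ℕ.m^n>0 p 2)

    heisenberg⇔semidirect : IsCyclotomic ι (p ℕ.^ 2) → ∀ x → InducesHeisenberg x ⇔ InducesSemidirect x
    heisenberg⇔semidirect cyclotomic x = mk⇔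
      (λ (N , norm , ¬pow) → N , norm , λ pow → ¬pow (Power-/ Φζ-pow (Power-resp (Φ-* ζ N) pow)))
      (λ (N , norm , ¬pow) → N , norm , λ pow → ¬pow (Power-resp (sym (Φ-* ζ N)) (Power-* Φζ-pow pow)))
      where Φζ-pow = Φζ-Power cyclotomic

  -- Traces from L to ℚ as a criterion for integrality.

  module Traces where
    open CyclotomicAction
    open Structure
    open Lifting

    Trσ : Carrier → Carrier
    Trσ x = ∑ p (λ i → σ^ i x)

    Trσ-fixed : ∀ x → σ^ 1 (Trσ x) ≈ Trσ x
    Trσ-fixed x = trans (σ^-hom.hom-∑ 1 p (λ i → σ^ i x)) (∑-cycle p (λ i → σ^ i x) (σᵖ≈id x))

    TrL : Carrier → Carrier
    TrL x = Tr (Trσ x)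

    TrL-rational : ∀ x → Image ι (TrL x)
    TrL-rational x = στ-fixed∈ℚ
      (trans (σ^-hom.hom-∑ 1 m (λ j → τ^ j (Trσ x))) (∑-cong′ m (λ j → trans (στ-comm 1 j (Trσ x)) (τ^.⟦⟧-cong j (Trσ-fixed x)))))
      (τ^-Tr 1 (L≡F[ζ] (Trσ x)))

    TrL-cong : ∀ {x y} → x ≈ y → TrL x ≈ TrL y
    TrL-cong eq = Tr-cong (∑-cong′ p λ i → σ^.⟦⟧-cong i eq)

    TrL-+ : ∀ x y → TrL (x + y) ≈ TrL x + TrL y
    TrL-+ x y = trans (Tr-cong (trans (∑-cong′ p (λ i → σ^.+-homo i x y)) (∑-+ p (λ i → σ^ i x) (λ i → σ^ i y)))) (Tr-+ _ _)

    TrL-rational* : ∀ {r} x → Image ι r → TrL (r * x) ≈ r * TrL x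
    TrL-rational* {r} x (s , eq) = begin
      Tr (Trσ (r * x))         ≈⟨ Tr-cong (trans (∑-cong′ p (λ i → trans (σ^.*-homo i r x) (*-congʳ (fixed (σ^ₑ i))))) (sym (*-∑ p r (λ i → σ^ i x)))) ⟩
      Tr (r * Trσ x)           ≈⟨ trans (∑-cong′ m (λ j → trans (τ^.*-homo j r (Trσ x)) (*-congʳ (fixed (τ^ₑ j))))) (sym (*-∑ m r (λ j → τ^ j (Trσ x)))) ⟩
      r * Tr (Trσ x)           ∎
      where
      fixed : (φ : Extension L L) → Extension.⟦_⟧ φ r ≈ r
      fixed φ = trans (Extension.⟦⟧-cong φ (sym eq)) (trans (Embedding.hom-ι ι ι φ s) eq)

    int-rational : ∀ z → Image ι (int z)
    int-rational z = fromℤ z , refl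

    TrL-one : TrL 1# ≈ nat (m ℕ.* p)
    TrL-one = begin
      Tr (Trσ 1#)                  ≈⟨ Tr-cong (trans (∑-cong′ p σ^.1#-homo) (trans (∑-const p 1#) (*-identityʳ _))) ⟩
      ∑ m (λ j → τ^ j (nat p))     ≈⟨ ∑-cong′ m (λ j → τ^-hom.hom-int j (+ p)) ⟩
      ∑ m (λ _ → nat p)            ≈⟨ ∑-const m (nat p) ⟩
      nat m * nat p                ≈⟨ nat-* m p ⟨
      nat (m ℕ.* p)                ∎

    TrL-of-rational : ∀ {x} → Image ι x → TrL x ≈ nat (m ℕ.* p) * x
    TrL-of-rational {x} r = trans (TrL-cong (sym (*-identityʳ x))) (trans (TrL-rational* 1# r) (trans (*-congˡ TrL-one) (*-comm _ _)))

    TrL-bounded : ℕ → Carrier → Set ℓ₁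
    TrL-bounded M x = Integer (nat M * TrL x)

    bounded-int* : ∀ {M x} z → TrL-bounded M x → TrL-bounded M (int z * x)
    bounded-int* {M} {x} z u = integer-resp (sym (trans (*-congˡ (TrL-rational* x (int-rational z)))
      (solve 3 (λ m z t → m :* (z :* t) := z :* (m :* t)) (nat M) (int z) (TrL x)))) (integer-* (integer-int z) u)

    bounded-+ : ∀ {M x y} → TrL-bounded M x → TrL-bounded M y → TrL-bounded M (x + y)
    bounded-+ u v = integer-resp (sym (trans (*-congˡ (TrL-+ _ _)) (distribˡ _ _ _))) (integer-+ u v)

    bounded-resp : ∀ {M x y} → x ≈ y → TrL-bounded M x → TrL-bounded M y
    bounded-resp eq = integer-resp (*-congˡ (TrL-cong eq))

    span-bounded : ∀ {ℓ} {G : Carrier → Set ℓ} {M} → (∀ {g} → G g → TrL-bounded M g) → ∀ {x} → ℤSpan G x → TrL-bounded M x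
    span-bounded {M = M} G-bounded (gen z Gg eq)  = bounded-resp (sym eq) (bounded-int* {M} z (G-bounded Gg))
    span-bounded {M = M} G-bounded (plus u v eq)  = bounded-resp (sym eq)
      (bounded-+ {M} (span-bounded G-bounded u) (span-bounded G-bounded v))

    -- The trace of the rational number xᵏ is m p xᵏ. So M m p is a common denominator of all powers
    -- of x, and `bounded-powers⇒integer` applies.
    rational⇒integer : ∀ {ℓ} (P : Carrier → Set ℓ) → (∀ {x y} → P x → P y → P (x * y)) →
      ∀ {M} → 0 < M → (∀ {x} → P x → TrL-bounded M x) → ∀ {x} → P x → Image ι x → Integer x
    rational⇒integer P P-* {M} 0<M P-bounded {x} Px x∈ℚ =
      bounded-powers⇒integer (ℕ.*-mono-< 0<M (ℕ.*-mono-< 0<m 0<p)) x∈ℚ bounded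
      where
      x^-rational : ∀ k → Image ι (x ^ k)
      x^-rational zero    = ℚ.1ℚ , Extension.1#-homo ι
      x^-rational (suc k) = proj₁ x∈ℚ ℚ.* proj₁ (x^-rational k) ,
        trans (Extension.*-homo ι _ _) (*-cong (proj₂ x∈ℚ) (proj₂ (x^-rational k)))
      -- P is not assumed to contain 1, so the powers start with x itself; the exponent 0 is treated
      -- separately in `bounded`.
      P-^ : ∀ k → ∃[ y ] P y × y ≈ x ^ suc k
      P-^ zero    = x , Px , sym (*-identityʳ x)
      P-^ (suc k) with P-^ k
      ... | y , Py , eq = x * y , P-* Px Py , *-congˡ eq
      bounded : ∀ k → Integer (nat (M ℕ.* (m ℕ.* p)) * x ^ k)
      bounded zero    = integer-* (integer-int _) (+ 1 , sym int-1)
      bounded (suc k) = integer-resp (trans (*-congˡ (TrL-of-rational (x^-rational (suc k))))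
        (trans (sym (*-assoc _ _ _)) (*-congʳ (sym (nat-* M (m ℕ.* p)))))) (bounded-resp {M} (proj₂ (proj₂ (P-^ k))) (P-bounded (proj₁ (proj₂ (P-^ k)))))

  -- A p-th root ω of ζ is moved by σ.

  module Ramification (ω : Carrier) (ωᵖ≈ζ : ω ^ p ≈ ζ) where
    open CyclotomicAction
    open Structure
    open Lifting
    open Traces

    p*p : ℕ
    p*p = p ℕ.^ 2

    p²≡p*p : p*p ≡ p ℕ.* p
    p²≡p*p = ≡.cong (p ℕ.*_) (ℕ.*-identityʳ p)

    0<p*p : 0 < p*p
    0<p*p = ℕ.m^n>0 p 2

    ω^[p*q] : ∀ q → ω ^ (p ℕ.* q) ≈ ζ ^ q
    ω^[p*q] q = trans (sym (^-assocʳ ω p q)) (^-congˡ q ωᵖ≈ζ)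

    ω-primitive : IsPrimitiveRootOfUnity L p*p ω
    ω-primitive = trans (ω^[p*q] (p ℕ.* 1)) (trans (reflexive (≡.cong (ζ ^_) (ℕ.*-identityʳ p))) ζⁿ≈1) , nontrivial
      where
      nontrivial : ∀ k → 0 < k → k < p*p → ω ^ k ≉ 1#
      nontrivial k 0<k k<p*p ωᵏ≈1 = from (ζ^≈1⇒∣ (trans (sym (^-congˡ k ωᵖ≈ζ)) (trans (^-comm ω p k) (trans (^-congˡ p ωᵏ≈1) (1^n≈1 p)))))
        where
        from : p ∣ k → _
        from (divides q eq) = from′ (ζ^≈1⇒∣ (trans (sym (ω^[p*q] q)) (trans (reflexive (≡.cong (ω ^_) (≡.trans (ℕ.*-comm p q) (≡.sym eq)))) ωᵏ≈1)))
          where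
          from′ : p ∣ q → _
          from′ p∣q = ℕ.<⇒≱ k<p*p (∣⇒≤ {{ℕ.>-nonZero 0<k}} (≡.subst₂ _∣_ (≡.sym p²≡p*p) (≡.sym eq) (*-pres-∣ p∣q (divides 1 (≡.sym (ℕ.*-identityˡ p))))))

    module ω-root = RootOfUnity ω-primitive 0<p*p

    ω≉0 : ω ≉ 0#
    ω≉0 = ω-root.ζ≉0

    IsPowerOfω : Carrier → Set ℓ₁
    IsPowerOfω x = ∃[ n ] x ≈ ω ^ n

    ℤ[ω] : Carrier → Set (c ⊔ ℓ₁)
    ℤ[ω] = ℤSpan IsPowerOfω

    ℤ[ω]-* : ∀ {x y} → ℤ[ω] x → ℤ[ω] y → ℤ[ω] (x * y)
    ℤ[ω]-* = span-* λ (i , eq) (j , eq′) → span-gen (i ℕ.+ j , trans (*-cong eq eq′) (^-+ ω i j))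

    ℤ[ω]-ω^ : ∀ n → ℤ[ω] (ω ^ n)
    ℤ[ω]-ω^ n = span-gen (n , refl)

    ℤ[ω]-0 : ℤ[ω] 0#
    ℤ[ω]-0 = gen (+ 0) {ω ^ 0} (0 , refl) (sym (trans (*-congʳ int-0) (zeroˡ _)))

    ω-traces : ∃[ M ] 0 < M × (∀ (i : Fin p*p) → TrL-bounded M (ω ^ toℕ i))
    ω-traces = common-multiple p*p (λ i M → TrL-bounded M (ω ^ toℕ i))
      (λ i d k → denominator-multiple k d (TrL (ω ^ toℕ i))) (λ i → denominator (TrL-rational (ω ^ toℕ i)))

    -- The powers of ω repeat with period p², so a common denominator of finitely many traces bounds
    -- the traces of the whole ring.
    ℤ[ω]-integer : ∀ {x} → ℤ[ω] x → Image ι x → Integer x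
    ℤ[ω]-integer = rational⇒integer ℤ[ω] ℤ[ω]-* (proj₁ (proj₂ ω-traces)) (span-bounded {M = proj₁ ω-traces} λ (n , eq) →
      bounded-resp {proj₁ ω-traces} (sym (trans eq (reduce n))) (proj₂ (proj₂ ω-traces) (Fin.fromℕ< (m%n<n n p*p))))
      where
      instance _ = ℕ.>-nonZero 0<p*p
      reduce : ∀ n → ω ^ n ≈ ω ^ toℕ (Fin.fromℕ< (m%n<n n p*p))
      reduce n = begin
        ω ^ n                                           ≡⟨ ≡.cong (ω ^_) (m≡m%n+[m/n]*n n p*p) ⟩
        ω ^ (n % p*p ℕ.+ n / p*p ℕ.* p*p)               ≈⟨ ^-+ ω (n % p*p) (n / p*p ℕ.* p*p) ⟨
        ω ^ (n % p*p) * ω ^ (n / p*p ℕ.* p*p)           ≈⟨ *-congˡ (trans (sym (^-assocʳ ω (n / p*p) p*p)) (ω-root.[ζ^i]ⁿ≈1 (n / p*p))) ⟩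
        ω ^ (n % p*p) * 1#                              ≈⟨ *-identityʳ _ ⟩
        ω ^ (n % p*p)                                   ≡⟨ ≡.cong (ω ^_) (Fin.toℕ-fromℕ< (m%n<n n p*p)) ⟨
        ω ^ toℕ (Fin.fromℕ< (m%n<n n p*p))              ∎

    infix 4 _≼_ _~_
    _≼_ : Carrier → Carrier → Set (c ⊔ ℓ₁)
    x ≼ y = ∃[ s ] ℤ[ω] s × y ≈ x * s

    _~_ : Carrier → Carrier → Set (c ⊔ ℓ₁)
    x ~ y = x ≼ y × y ≼ x

    ≼-trans : ∀ {x y z} → x ≼ y → y ≼ z → x ≼ z
    ≼-trans (s , s∈ , eq) (t , t∈ , eq′) = s * t , ℤ[ω]-* s∈ t∈ , trans eq′ (trans (*-congʳ eq) (*-assoc _ _ _))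

    ≼-* : ∀ {x y u v} → x ≼ y → u ≼ v → x * u ≼ y * v
    ≼-* (s , s∈ , eq) (t , t∈ , eq′) = s * t , ℤ[ω]-* s∈ t∈ ,
      trans (*-cong eq eq′) (solve 4 (λ x s u t → (x :* s) :* (u :* t) := (x :* u) :* (s :* t)) _ s _ t)

    ≼-reflexive : ∀ {x y} → x ≈ y → x ≼ y
    ≼-reflexive eq = 1# , ℤ[ω]-ω^ 0 , trans (sym eq) (sym (*-identityʳ _))

    ~-trans : ∀ {x y z} → x ~ y → y ~ z → x ~ z
    ~-trans (a , b) (c , d) = ≼-trans a c , ≼-trans d b

    ~-sym : ∀ {x y} → x ~ y → y ~ x
    ~-sym (a , b) = b , a

    ~-reflexive : ∀ {x y} → x ≈ y → x ~ y
    ~-reflexive eq = ≼-reflexive eq , ≼-reflexive (sym eq)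

    ~-∏ : ∀ n {f : ℕ → Carrier} {y} → (∀ i → i < n → f i ~ y) → ∏ n f ~ y ^ n
    ~-∏ zero    f~y = ~-reflexive refl
    ~-∏ (suc n) f~y = ≼-* (proj₁ (f~y 0 (s≤s z≤n))) (proj₁ ih) , ≼-* (proj₂ (f~y 0 (s≤s z≤n))) (proj₂ ih)
      where ih = ~-∏ n λ i i<n → f~y (suc i) (s≤s i<n)

    ~-^ : ∀ n {x y} → x ~ y → x ^ n ~ y ^ n
    ~-^ n x~y = ~-trans (~-reflexive (sym (∏-const n _))) (~-∏ n λ _ _ → x~y)

    -- The quotient is the geometric sum 1 + x + ... + xᵏ⁻¹. Consequently 1 - x and 1 - y are
    -- associates whenever each of x and y is a power of the other.
    1-x≼1-xᵏ : ∀ {x y k} → IsPowerOfω x → y ≈ x ^ k → 1# - x ≼ 1# - y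
    1-x≼1-xᵏ {x} {y} {k} (n , x≈ωⁿ) eq = ∑ k (x ^_) , span-∑ k ℤ[ω]-0 powers , trans (+-congˡ (-‿cong eq)) (sym (geometric x k))
      where
      powers : ∀ i → ℤ[ω] (x ^ i)
      powers i = span-resp (sym (trans (^-congˡ i x≈ωⁿ) (^-assocʳ ω n i))) (ℤ[ω]-ω^ (n ℕ.* i))

    d : Carrier
    d = 1# - ω

    ω-is-power : IsPowerOfω ω
    ω-is-power = 1 , sym (*-identityʳ ω)

    conjugate-power : ∀ j → IsPowerOfω (τ^ j ω)
    conjugate-power j = ω-root.root (trans (sym (τ^-hom.hom-^ j ω p*p)) (trans (τ^.⟦⟧-cong j ω-root.ζⁿ≈1) (τ^.1#-homo j)))

    -- Each τʲ(ω) is a power of ω. Conversely, if the complementary power of τ maps ω to ωᶜ, then τᵐ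
    -- = id gives ω = τʲ(ω)ᶜ.
    conjugate~ : ∀ j → j < m → 1# - τ^ j ω ~ d
    conjugate~ j j<m = 1-x≼1-xᵏ {k = proj₁ (conjugate-power (m ∸ j))} (conjugate-power j) (begin
        ω                                              ≈⟨ τᵐ≈id ω ⟨
        τ^ m ω                                         ≡⟨ ≡.cong (λ n → τ^ n ω) (ℕ.m+[n∸m]≡n (ℕ.<⇒≤ j<m)) ⟨
        τ^ (j ℕ.+ (m ∸ j)) ω                           ≈⟨ τ^-+ j (m ∸ j) ω ⟩
        τ^ j (τ^ (m ∸ j) ω)                            ≈⟨ τ^.⟦⟧-cong j (proj₂ (conjugate-power (m ∸ j))) ⟩
        τ^ j (ω ^ proj₁ (conjugate-power (m ∸ j)))     ≈⟨ τ^-hom.hom-^ j ω (proj₁ (conjugate-power (m ∸ j))) ⟩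
        τ^ j ω ^ proj₁ (conjugate-power (m ∸ j))       ∎)
      , 1-x≼1-xᵏ {k = proj₁ (conjugate-power j)} ω-is-power (proj₂ (conjugate-power j))

    -- With ζ = ωᵖ the root ω ζᵏ is ω to the power 1 + p k. In the other direction (ω ζᵏ)ᵖ = ζ, so
    -- the exponent 1 + p (p - k) leads back to ω.
    [ωζᵏ]~ : ∀ k → k < p → 1# - ω * ζ ^ k ~ d
    [ωζᵏ]~ k k<p = 1-x≼1-xᵏ {k = suc (p ℕ.* (p ∸ k))} (suc (p ℕ.* k) , *-congˡ (sym (ω^[p*q] k))) (sym (begin
        ω * ζ ^ k * (ω * ζ ^ k) ^ (p ℕ.* (p ∸ k))      ≈⟨ *-congˡ (^-assocʳ (ω * ζ ^ k) p (p ∸ k)) ⟨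
        ω * ζ ^ k * ((ω * ζ ^ k) ^ p) ^ (p ∸ k)        ≈⟨ *-congˡ (^-congˡ (p ∸ k) (trans (^-distrib-* ω (ζ ^ k) p)
                                                            (trans (*-cong ωᵖ≈ζ ([ζ^i]ⁿ≈1 k)) (*-identityʳ ζ)))) ⟩
        ω * ζ ^ k * ζ ^ (p ∸ k)                        ≈⟨ trans (*-assoc _ _ _) (*-congˡ (^-+ ζ k (p ∸ k))) ⟩
        ω * ζ ^ (k ℕ.+ (p ∸ k))                        ≈⟨ *-congˡ (trans (reflexive (≡.cong (ζ ^_) (ℕ.m+[n∸m]≡n (ℕ.<⇒≤ k<p)))) ζⁿ≈1) ⟩
        ω * 1#                                         ≈⟨ *-identityʳ ω ⟩
        ω                                              ∎))
      , 1-x≼1-xᵏ {k = suc (p ℕ.* k)} ω-is-power (*-congˡ (sym (ω^[p*q] k)))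

    ζ-is-power : ∀ n → IsPowerOfω (ζ ^ n)
    ζ-is-power n = p ℕ.* n , sym (ω^[p*q] n)

    [ζᵏ]~ : ∀ k → k < m → 1# - ζ ^ suc k ~ 1# - ζ
    [ζᵏ]~ k k<m = 1-x≼1-xᵏ {k = proj₁ back} (ζ-is-power (suc k)) (proj₂ back) ,
      1-x≼1-xᵏ {k = suc k} (p , sym ωᵖ≈ζ) refl
      where
      k+1<p : suc k < p
      k+1<p = ℕ.<-≤-trans (s≤s k<m) (ℕ.≤-reflexive 1+m≡p)
      back : ∃[ j ] ζ ≈ (ζ ^ suc k) ^ j
      back = ζ-power-generates (λ p∣k+1 → ℕ.<⇒≱ k+1<p (∣⇒≤ p∣k+1))

    ζ-primitive′ : IsPrimitiveRootOfUnity L (suc m) ζ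
    ζ-primitive′ = ≡.subst (λ n → IsPrimitiveRootOfUnity L n ζ) (≡.sym 1+m≡p) ζ-primitive

    -- Evaluating ∏(1 - t ζᵏ) = 1 - tᵖ at t = ω factors 1 - ζ into p associates of 1 - ω.
    1-ζ~ : 1# - ζ ~ d ^ p
    1-ζ~ = ~-trans (~-reflexive (begin
      1# - ζ                                    ≈⟨ +-congˡ (-‿cong ωᵖ≈ζ) ⟨
      1# - ω ^ p                                ≡⟨ ≡.cong (λ n → 1# - ω ^ n) 1+m≡p ⟨
      1# - ω ^ suc m                            ≈⟨ Cyclotomic.∏[1-tζᵏ] ζ-primitive′ ω ⟨
      ∏ (suc m) (λ k → 1# - ω * ζ ^ k)          ≡⟨ ≡.cong (λ n → ∏ n (λ k → 1# - ω * ζ ^ k)) 1+m≡p ⟩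
      ∏ p (λ k → 1# - ω * ζ ^ k)                ∎)) (~-∏ p [ωζᵏ]~)

    p~ : nat p ~ (d ^ p) ^ m
    p~ = ~-trans (~-reflexive (trans (reflexive (≡.cong nat (≡.sym 1+m≡p))) (sym (Cyclotomic.∏[1-ζᵏ] ζ-primitive′))))
      (~-trans (~-∏ m [ζᵏ]~) (~-^ m 1-ζ~))

    a : Carrier
    a = ∏ m (λ j → 1# - τ^ j ω)

    -- Both sides are associates of (1 - ω) to the power m p: each of the m factors of a is an
    -- associate of 1 - ω, and p is the product of the m elements 1 - ζᵏ.
    aᵖ~p : a ^ p ~ nat p
    aᵖ~p = ~-trans (~-^ p (~-∏ m conjugate~)) (~-trans (~-reflexive (^-comm d m p)) (~-sym p~))

    ℤ[ω]-∏ : ∀ n {f : ℕ → Carrier} → (∀ j → ℤ[ω] (f j)) → ℤ[ω] (∏ n f)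
    ℤ[ω]-∏ zero    u = ℤ[ω]-ω^ 0
    ℤ[ω]-∏ (suc n) u = ℤ[ω]-* (u 0) (ℤ[ω]-∏ n (u ∘ suc))

    ℤ[ω]-a : ℤ[ω] a
    ℤ[ω]-a = ℤ[ω]-∏ m λ j → plus (ℤ[ω]-ω^ 0) (gen (ℤ.- + 1) (conjugate-power j)
      (sym (trans (*-congʳ (trans (int-neg (+ 1)) (-‿cong int-1)))
        (solve 1 (λ x → (:- con (+ 1)) :* x := :- x) (τ^ j ω))))) refl

    rational-quotient : ∀ {x y s} → x ≉ 0# → Image ι x → Image ι y → y ≈ x * s → Image ι s
    rational-quotient {x} {y} {s} x≉0 (q , ιq≈x) (r , ιr≈y) y≈xs = u ℚ.* r , (begin
      ι.⟦ u ℚ.* r ⟧           ≈⟨ trans (ι.*-homo u r) (*-congˡ (trans ιr≈y y≈xs)) ⟩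
      ι.⟦ u ⟧ * (x * s)       ≈⟨ solve 3 (λ u x s → u :* (x :* s) := (x :* u) :* s) ι.⟦ u ⟧ x s ⟩
      (x * ι.⟦ u ⟧) * s       ≈⟨ *-congʳ (trans (*-congʳ (sym ιq≈x)) ιq*ιu≈1) ⟩
      1# * s                  ≈⟨ *-identityˡ s ⟩
      s                       ∎)
      where
      q-inverse : ∃[ u ] ι.⟦ q ⟧ * ι.⟦ u ⟧ ≈ 1#
      q-inverse = ι-inverse q λ q≡0 → x≉0 (trans (sym ιq≈x) (trans (ι.⟦⟧-cong q≡0) ι.0#-homo))
      u = proj₁ q-inverse
      ιq*ιu≈1 = proj₂ q-inverse

    -- If σ fixed ω, then a would be an integer with p ~ aᵖ, so p would divide a and pᵖ would divide p.
    σω≉ω : σ^ 1 ω ≉ ω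
    σω≉ω σω≈ω = ℕ.<⇒≱ (n<b^n 1<p p) (∣⇒≤ (∣-trans (^-∣-mono p p∣A) Aᵖ∣p))
      where
      a-rational : Image ι a
      a-rational = στ-fixed∈ℚ
        (trans (σ^-hom.hom-∏ 1 m (λ j → 1# - τ^ j ω)) (∏-cong′ m λ j → trans (σ^-hom.hom-- 1 1# (τ^ j ω))
          (+-cong (σ^.1#-homo 1) (-‿cong (trans (στ-comm 1 j ω) (τ^.⟦⟧-cong j σω≈ω))))))
        (trans (τ^-hom.hom-∏ 1 m (λ j → 1# - τ^ j ω)) (trans (∏-cong′ m λ j → trans (τ^-hom.hom-- 1 1# (τ^ j ω))
          (+-congʳ (τ^.1#-homo 1))) (∏-cycle m (λ j → 1# - τ^ j ω) (+-congˡ (-‿cong (τᵐ≈id ω))))))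
      a-integer : Integer a
      a-integer = ℤ[ω]-integer ℤ[ω]-a a-rational
      A : ℤ
      A = proj₁ a-integer
      aᵖ≈ : a ^ p ≈ int (A ℤ.^ p)
      aᵖ≈ = trans (^-congˡ p (proj₂ a-integer)) (sym (int-^ A p))
      divides-in-ℤ : ∀ {x y u v} → x ≈ int u → y ≈ int v → x ≉ 0# → x ≼ y → ℤ.∣ u ∣ ∣ ℤ.∣ v ∣
      divides-in-ℤ {u = u} {v} x≈u y≈v x≉0 (s , s∈ , y≈xs) = divides ℤ.∣ w ∣
        (≡.trans (≡.cong ℤ.∣_∣ v≡u*w) (≡.trans (ℤ.abs-* u w) (ℕ.*-comm ℤ.∣ u ∣ ℤ.∣ w ∣)))
        where
        s-integer : Integer s
        s-integer = ℤ[ω]-integer s∈ (rational-quotient x≉0 (fromℤ u , sym x≈u) (fromℤ v , sym y≈v) y≈xs)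
        w = proj₁ s-integer
        v≡u*w : v ≡ u ℤ.* w
        v≡u*w = int-injective (trans (sym y≈v) (trans y≈xs (trans (*-cong x≈u (proj₂ s-integer)) (sym (int-* u w)))))
      p≉0 : nat p ≉ 0#
      p≉0 = nat≉0 p 0<p
      aᵖ≉0 : a ^ p ≉ 0#
      aᵖ≉0 eq = p≉0 (trans (proj₂ (proj₂ (proj₁ aᵖ~p))) (trans (*-congʳ eq) (zeroˡ _)))
      Aᵖ∣p : ℤ.∣ A ∣ ℕ.^ p ∣ p
      Aᵖ∣p = ≡.subst (_∣ p) (abs-^ A p) (divides-in-ℤ {v = + p} aᵖ≈ refl aᵖ≉0 (proj₁ aᵖ~p))
      p∣A : p ∣ ℤ.∣ A ∣
      p∣A = prime∣^⇒∣ p-prime ℤ.∣ A ∣ p (≡.subst (p ∣_) (abs-^ A p) (divides-in-ℤ {u = + p} refl aᵖ≈ p≉0 (proj₂ aᵖ~p)))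

  -- A p-th root of ζ generates L over ℚ.

  module Generation (ω : Carrier) (ωᵖ≈ζ : ω ^ p ≈ ζ) where
    open CyclotomicAction
    open Structure
    open Lifting
    open Traces using (Trσ; Trσ-fixed)
    open Ramification ω ωᵖ≈ζ using (ω-primitive; ω≉0; σω≉ω)

    Adjoin-ω : Carrier → Set _
    Adjoin-ω = Adjoin ι (ω ≈_)

    rational-in : ∀ {x} → Image ι x → Adjoin-ω x
    rational-in (r , eq) = resp eq (base r)

    ω^-in : ∀ n → Adjoin-ω (ω ^ n)
    ω^-in zero    = rational-in (ℚ.1ℚ , Extension.1#-homo ι)
    ω^-in (suc n) = mul (gen refl) (ω^-in n)

    ∑-in : ∀ n {f : ℕ → Carrier} → (∀ i → Adjoin-ω (f i)) → Adjoin-ω (∑ n f)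
    ∑-in zero    u = rational-in (ℚ.0ℚ , Extension.0#-homo ι)
    ∑-in (suc n) u = add (u 0) (∑-in n (u ∘ suc))

    K-in : ∀ {x} → Image κ x → Adjoin-ω x
    K-in (k , eq) = resp eq (go (K-generated k))
      where
      go : ∀ {x} → Adjoin ιK (Field._≈_ K ζ′) x → Adjoin-ω κ.⟦ x ⟧
      go (base r)     = rational-in (r , sym (κ.hom-ι r))
      go (gen eq)     = resp (trans ωᵖ≈ζ (κ.⟦⟧-cong eq)) (ω^-in p)
      go (add u v)    = resp (sym (κ.+-homo _ _)) (add (go u) (go v))
      go (neg u)      = resp (sym (κ.-‿homo _)) (neg (go u))
      go (mul u v)    = resp (sym (κ.*-homo _ _)) (mul (go u) (go v))
      go (inv u eq)   = inv (go u) (trans (sym (κ.*-homo _ _)) (trans (κ.⟦⟧-cong eq) κ.1#-homo))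
      go (resp eq u)  = resp (κ.⟦⟧-cong eq) (go u)

    ω̄ : Carrier
    ω̄ = proj₁ (inverse ω≉0)

    ωω̄≈1 : ω * ω̄ ≈ 1#
    ωω̄≈1 = proj₂ (inverse ω≉0)

    σⁱω̄-inverse : ∀ i → σ^ i ω * σ^ i ω̄ ≈ 1#
    σⁱω̄-inverse i = trans (sym (σ^.*-homo i _ _)) (trans (σ^.⟦⟧-cong i ωω̄≈1) (σ^.1#-homo i))

    σω-root : ∃[ k ] σ^ 1 ω * ω̄ ≈ ζ ^ k
    σω-root = root (begin
      (σ^ 1 ω * ω̄) ^ p      ≈⟨ ^-distrib-* _ _ p ⟩
      σ^ 1 ω ^ p * ω̄ ^ p    ≈⟨ *-congʳ (trans (sym (σ^-hom.hom-^ 1 ω p)) (trans (σ^.⟦⟧-cong 1 ωᵖ≈ζ) (trans (σ^-ζ 1) (sym ωᵖ≈ζ)))) ⟩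
      ω ^ p * ω̄ ^ p         ≈⟨ trans (sym (^-distrib-* ω ω̄ p)) (trans (^-congˡ p ωω̄≈1) (1^n≈1 p)) ⟩
      1#                    ∎)

    k : ℕ
    k = proj₁ σω-root

    σω≈ωζᵏ : σ^ 1 ω ≈ ω * ζ ^ k
    σω≈ωζᵏ = begin
      σ^ 1 ω              ≈⟨ trans (*-congˡ ωω̄≈1) (*-identityʳ _) ⟨
      σ^ 1 ω * (ω * ω̄)    ≈⟨ solve 3 (λ s w v → s :* (w :* v) := w :* (s :* v)) _ ω ω̄ ⟩
      ω * (σ^ 1 ω * ω̄)    ≈⟨ *-congˡ (proj₂ σω-root) ⟩
      ω * ζ ^ k           ∎

    σⁱω≈ωζᵏⁱ : ∀ i → σ^ i ω ≈ ω * ζ ^ (k ℕ.* i)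
    σⁱω≈ωζᵏⁱ zero    = sym (trans (*-congˡ (reflexive (≡.cong (ζ ^_) (ℕ.*-zeroʳ k)))) (*-identityʳ ω))
    σⁱω≈ωζᵏⁱ (suc i) = begin
      σ^ 1 (σ^ i ω)                      ≈⟨ trans (σ^.⟦⟧-cong 1 (σⁱω≈ωζᵏⁱ i)) (σ^.*-homo 1 _ _) ⟩
      σ^ 1 ω * σ^ 1 (ζ ^ (k ℕ.* i))      ≈⟨ *-cong σω≈ωζᵏ (trans (σ^-hom.hom-^ 1 ζ (k ℕ.* i)) (^-congˡ (k ℕ.* i) (σ^-ζ 1))) ⟩
      ω * ζ ^ k * ζ ^ (k ℕ.* i)          ≈⟨ trans (*-assoc _ _ _) (*-congˡ (^-+ ζ k (k ℕ.* i))) ⟩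
      ω * ζ ^ (k ℕ.+ k ℕ.* i)            ≡⟨ ≡.cong (λ n → ω * ζ ^ n) (ℕ.*-suc k i) ⟨
      ω * ζ ^ (k ℕ.* suc i)              ∎

    -- An equality would make p divide k i. But p ∣ k would mean that σ fixes ω, and i is too small
    -- to be a multiple of p.
    σⁱω≉ω : ∀ {i} → 0 < i → i < p → σ^ i ω ≉ ω
    σⁱω≉ω {i} 0<i i<p eq = cases (euclidsLemma k i p-prime (ζ^≈1⇒∣ (*-cancelˡ ω≉0
      (trans (sym (σⁱω≈ωζᵏⁱ i)) (trans eq (sym (*-identityʳ ω)))))))
      where
      cases : p ∣ k ⊎ p ∣ i → _
      cases (inj₁ p∣k) = σω≉ω (trans σω≈ωζᵏ (trans (*-congˡ (∣⇒ζ^≈1 p∣k)) (*-identityʳ ω)))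
      cases (inj₂ p∣i) = ℕ.<⇒≱ i<p (∣⇒≤ {{ℕ.>-nonZero 0<i}} p∣i)

    p*y≈∑Trσ : ∀ y → nat p * y ≈ ∑ p (λ k → Trσ (y * ω̄ ^ k) * ω ^ k)
    p*y≈∑Trσ = fourier 0<p σ^ (λ i → σ^.*-homo i _ _) (λ _ → refl) σ^.1#-homo ωω̄≈1 root′
      λ i 0<i i<p eq → σⁱω≉ω 0<i i<p (sym (*-cancelˡ (σⁱω̄≉0 i) (trans eq (sym (trans (*-comm _ _) (σⁱω̄-inverse i))))))
      where
      σⁱω̄≉0 : ∀ i → σ^ i ω̄ ≉ 0#
      σⁱω̄≉0 i = invertible⇒≉0 (trans (*-comm _ _) (σⁱω̄-inverse i))
      root′ : ∀ i → (σ^ i ω̄ * ω) ^ p ≈ 1#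
      root′ i = begin
        (σ^ i ω̄ * ω) ^ p               ≈⟨ ^-distrib-* _ ω p ⟩
        σ^ i ω̄ ^ p * ω ^ p             ≈⟨ *-congˡ (trans ωᵖ≈ζ (trans (sym (σ^-ζ i)) (trans (σ^.⟦⟧-cong i (sym ωᵖ≈ζ)) (σ^-hom.hom-^ i ω p)))) ⟩
        σ^ i ω̄ ^ p * σ^ i ω ^ p        ≈⟨ ^-distrib-* _ _ p ⟨
        (σ^ i ω̄ * σ^ i ω) ^ p          ≈⟨ trans (^-congˡ p (trans (*-comm _ _) (σⁱω̄-inverse i))) (1^n≈1 p) ⟩
        1#                             ∎

    -- The resolvent coefficients in `p*y≈∑Trσ` are traces along σ, hence fixed by σ and so in K;
    -- and K lies in ℚ(ω) because ζ = ωᵖ.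
    generated : GeneratedBy ι (ω ≈_)
    generated y = resp (1/p*[p*x] y) (mul 1/p-in (resp (sym (p*y≈∑Trσ y))
      (∑-in p λ k → mul (K-in (σ-fixed∈K (Trσ-fixed (y * ω̄ ^ k)))) (ω^-in k))))
      where
      1/p-in : Adjoin-ω 1/p
      1/p-in = inv (base (fromℤ (+ p))) p*1/p≈1

    cyclotomic : IsCyclotomic ι (p ℕ.^ 2)
    cyclotomic = ω , ω-primitive , generated

  -- The case in which L is not the p²-th cyclotomic field.

  module NonCyclotomicCase where
    open CyclotomicAction
    open GaloisGroup
    open Induced γ κ p e ζ′ τ

    p∤e : ¬ (p ∣ e)
    p∤e p∣e = ℕ.<⇒≢ 1<p (≡.sym (proj₁ e-primitive (p∣e , divides 1 (≡.sym (ℕ.*-identityˡ p)))))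

    p∤exponent : ¬ (p ∣ e ℕ.^ (p ∸ 2) ℕ.* m)
    p∤exponent p∣ = cases (euclidsLemma (e ℕ.^ (p ∸ 2)) m p-prime p∣)
      where
      cases : p ∣ e ℕ.^ (p ∸ 2) ⊎ p ∣ m → ⊥
      cases (inj₁ p∣e^) = p∤e (prime∣^⇒∣ p-prime e (p ∸ 2) p∣e^)
      cases (inj₂ p∣m)  = ℕ.<⇒≱ m<p (∣⇒≤ {{ℕ.>-nonZero 0<m}} p∣m)

    -- Φ(ζ) is a power of ζ with exponent prime to p, so ζ is in turn a j-th power of it. If Φ(ζ) =
    -- zᵖ, this makes zʲ a p-th root of ζ.
    Φζ-Power⇒cyclotomic : Power (Φ ζ) → IsCyclotomic ι (p ℕ.^ 2)
    Φζ-Power⇒cyclotomic (z , _ , Φζ≈zᵖ) = Generation.cyclotomic (z ^ j) (begin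
      (z ^ j) ^ p                                ≈⟨ ^-comm z j p ⟩
      (z ^ p) ^ j                                ≈⟨ ^-congˡ j (trans (sym Φζ≈zᵖ) Φζ) ⟩
      (ζ ^ (e ℕ.^ (p ∸ 2) ℕ.* m)) ^ j            ≈⟨ proj₂ (ζ-power-generates p∤exponent) ⟨
      ζ                                          ∎)
      where
      j : ℕ
      j = proj₁ (ζ-power-generates p∤exponent)

    -- The goal for N is a negation, so Φ(ζ N) may be assumed to be a p-th power before the negated
    -- hypothesis is applied. Then Φ(N) cannot be one as well, since the quotient Φ(ζ) would be one
    -- too.
    semidirect : ¬ IsCyclotomic ι (p ℕ.^ 2) → ∀ x → x # 0# → ¬ InducesHeisenberg x → InducesSemidirect x
    semidirect ¬cyclotomic x x#0 ¬heisenberg = N x , N-isNorm x , λ Φ[ζN]-power →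
      ¬heisenberg (N x , N-isNorm x , λ ΦN-power → ¬cyclotomic (Φζ-Power⇒cyclotomic
        (Power-/ ΦN-power (Power-resp (trans (Φ-* ζ (N x)) (*-comm _ _)) Φ[ζN]-power))))

  -- A Galois-stable order of L.

  module Order where
    open CyclotomicAction
    open Structure
    open Lifting
    open Traces
    private
      module S = SemiringSum semiring
      module B = Basis (IsCyclicOfDegree.degree F-cyclic)
      instance
        m-nonZero : ℕ.NonZero m
        m-nonZero = ℕ.>-nonZero 0<m

    b : Fin p → Carrier
    b i = γ.⟦ B.basis i ⟧

    IsGenerating : Carrier → Set ℓ₁
    IsGenerating x = ∃[ i ] ∃[ j ] x ≈ b i * ζ ^ j

    -- The generators with all exponents j are dependent, but ζᵖ = 1 leaves only finitely many of
    -- them. Their span is stable under multiplication by ζ, so structure constants are needed for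
    -- the basis of F alone.
    Λ : Carrier → Set (c ⊔ ℓ₁)
    Λ = ℤSpan IsGenerating

    Λ-0 : Λ 0#
    Λ-0 = gen (+ 0) {b i * ζ ^ 0} (i , 0 , refl) (sym (trans (*-congʳ int-0) (zeroˡ _)))
      where i = Fin.fromℕ< 0<p

    Λ-multiple : ∀ x d k → Λ (nat d * x) → Λ (nat (k ℕ.* d) * x)
    Λ-multiple x d k u = span-resp (trans (sym (*-assoc _ _ _)) (*-congʳ (sym (nat-* k d)))) (span-int* (+ k) u)

    F-basis-expansion : ∀ {f} (r : Fin p → ℚ) → f F.≈ F.sum (λ k → Extension.⟦_⟧ ιF (r k) F.* B.basis k) →
                        γ.⟦ f ⟧ ≈ sum {p} (λ k → ι.⟦ r k ⟧ * b k)
    F-basis-expansion {f} r eq = begin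
      γ.⟦ f ⟧                                                        ≈⟨ γ.⟦⟧-cong eq ⟩
      γ.⟦ F.sum (λ k → Extension.⟦_⟧ ιF (r k) F.* B.basis k) ⟧        ≈⟨ γ.hom-sum {p} (λ k → Extension.⟦_⟧ ιF (r k) F.* B.basis k) ⟩
      sum {p} (λ k → γ.⟦ Extension.⟦_⟧ ιF (r k) F.* B.basis k ⟧)      ≈⟨ S.sum-cong-≋ {p} (λ k → γ.*-homo (Extension.⟦_⟧ ιF (r k)) (B.basis k)) ⟩
      sum {p} (λ k → ι.⟦ r k ⟧ * b k)                                ∎

    Λ-combination : ∀ {x} (q : Fin p → Carrier) (z : Fin p → ℤ) d n → x ≈ sum {p} (λ k → q k * b k) →
                    (∀ k → nat d * q k ≈ int (z k)) → Λ (nat d * (x * ζ ^ n))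
    Λ-combination {x} q z d n x≈ dq≈z = span-resp (sym expansion)
      (span-sum {n = p} Λ-0 λ k → gen (z k) {b k * ζ ^ n} (k , n , refl) refl)
      where
      expansion : nat d * (x * ζ ^ n) ≈ sum {p} (λ k → int (z k) * (b k * ζ ^ n))
      expansion = begin
        nat d * (x * ζ ^ n)                                ≈⟨ *-congˡ (trans (*-congʳ x≈) (*-comm _ _)) ⟩
        nat d * (ζ ^ n * sum {p} (λ k → q k * b k))        ≈⟨ *-assoc _ _ _ ⟨
        nat d * ζ ^ n * sum {p} (λ k → q k * b k)          ≈⟨ S.*-distribˡ-sum {p} (nat d * ζ ^ n) (λ k → q k * b k) ⟩
        sum {p} (λ k → nat d * ζ ^ n * (q k * b k))        ≈⟨ S.sum-cong-≋ {p} (λ k → trans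
          (solve 4 (λ d z r b → d :* z :* (r :* b) := (d :* r) :* (b :* z)) (nat d) (ζ ^ n) (q k) (b k)) (*-congʳ (dq≈z k))) ⟩
        sum {p} (λ k → int (z k) * (b k * ζ ^ n))          ∎

    Λ-clear-term : ∀ f n → ∃[ d ] 0 < d × Λ (nat d * (γ.⟦ f ⟧ * ζ ^ n))
    Λ-clear-term f n = from (B.spanning f)
      where
      from : (∃[ r ] f F.≈ F.sum (λ k → Extension.⟦_⟧ ιF (r k) F.* B.basis k)) → ∃[ d ] 0 < d × Λ (nat d * (γ.⟦ f ⟧ * ζ ^ n))
      from (r , eq) = clear (common-multiple p (λ k d → Integer (nat d * ι.⟦ r k ⟧))
        (λ k d j → denominator-multiple j d ι.⟦ r k ⟧) (λ k → denominator (r k , refl)))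
        where
        clear : (∃[ d ] 0 < d × (∀ k → Integer (nat d * ι.⟦ r k ⟧))) → ∃[ d ] 0 < d × Λ (nat d * (γ.⟦ f ⟧ * ζ ^ n))
        clear (d , 0<d , z) = d , 0<d , Λ-combination (λ k → ι.⟦ r k ⟧) (λ k → proj₁ (z k)) d n (F-basis-expansion r eq) (λ k → proj₂ (z k))

    Λ-clear : ∀ x → ∃[ d ] 0 < d × Λ (nat d * x)
    Λ-clear x = go (L≡F[ζ] x)
      where
      go : ∀ {x} → F[ζ] x → ∃[ d ] 0 < d × Λ (nat d * x)
      go (term f n eq) = proj₁ t , proj₁ (proj₂ t) , span-resp (*-congˡ (sym eq)) (proj₂ (proj₂ t))
        where t = Λ-clear-term f n
      go (plus {x} {y} u v eq) = proj₁ s ℕ.* proj₁ t , ℕ.*-mono-< (proj₁ (proj₂ s)) (proj₁ (proj₂ t)) ,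
        plus (≡.subst (λ d → Λ (nat d * x)) (ℕ.*-comm (proj₁ t) (proj₁ s)) (Λ-multiple x (proj₁ s) (proj₁ t) (proj₂ (proj₂ s))))
             (Λ-multiple y (proj₁ t) (proj₁ s) (proj₂ (proj₂ t)))
             (trans (*-congˡ eq) (distribˡ _ _ _))
        where
        s = go u
        t = go v

    structure-constants : ∃[ D ] 0 < D × (∀ i j → Λ (nat D * (b i * b j)))
    structure-constants = common-multiple₂ p p (λ i j d → Λ (nat d * (b i * b j))) (λ i j d k → Λ-multiple (b i * b j) d k)
      λ i j → Λ-clear (b i * b j)

    D : ℕ
    D = proj₁ structure-constants

    Λ-ζ^ : ∀ n {x} → Λ x → Λ (x * ζ ^ n)
    Λ-ζ^ n (gen z (i , j , eq) eq′) = gen z (i , j ℕ.+ n , refl) (trans (*-congʳ (trans eq′ (*-congˡ eq)))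
      (trans (solve 4 (λ z b s t → (z :* (b :* s)) :* t := z :* (b :* (s :* t))) _ _ _ _) (*-congˡ (*-congˡ (^-+ ζ j n)))))
    Λ-ζ^ n (plus u v eq) = plus (Λ-ζ^ n u) (Λ-ζ^ n v) (trans (*-congʳ eq) (distribʳ _ _ _))

    Λ-* : ∀ {x y} → Λ x → Λ y → Λ (nat D * (x * y))
    Λ-* = span-bilinear (nat D) λ (i , j , eq) (i′ , j′ , eq′) → span-resp
      (sym (trans (*-congˡ (*-cong eq eq′)) (trans (solve 5 (λ d b s b′ t → d :* ((b :* s) :* (b′ :* t)) := d :* (b :* b′) :* (s :* t)) (nat D) _ _ _ _)
        (*-congˡ (^-+ ζ j j′)))))
      (Λ-ζ^ (j ℕ.+ j′) (proj₂ (proj₂ structure-constants) i i′))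

    -- The lattice Λ is closed under multiplication up to D, so ℤ + D Λ is a ring.
    R : Carrier → Set (c ⊔ ℓ₁)
    R x = ∃[ n ] ∃[ v ] Λ v × x ≈ int n + nat D * v

    R-resp : ∀ {x y} → x ≈ y → R x → R y
    R-resp eq (n , v , v∈ , eq′) = n , v , v∈ , trans (sym eq) eq′

    R-+ : ∀ {x y} → R x → R y → R (x + y)
    R-+ (n , v , v∈ , eq) (n′ , v′ , v′∈ , eq′) = n ℤ.+ n′ , v + v′ , plus v∈ v′∈ refl ,
      trans (+-cong eq eq′) (trans (solve 5 (λ n n′ d v v′ → (n :+ d :* v) :+ (n′ :+ d :* v′) := (n :+ n′) :+ d :* (v :+ v′)) _ _ _ _ _)
        (+-congʳ (sym (int-+ n n′))))

    R-* : ∀ {x y} → R x → R y → R (x * y)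
    R-* (n , v , v∈ , eq) (n′ , v′ , v′∈ , eq′) = n ℤ.* n′ , int n * v′ + int n′ * v + nat D * (v * v′) ,
      plus (plus (span-int* n v′∈) (span-int* n′ v∈) refl) (Λ-* v∈ v′∈) refl ,
      trans (*-cong eq eq′) (trans (solve 5 (λ n n′ d v v′ →
        (n :+ d :* v) :* (n′ :+ d :* v′) := n :* n′ :+ d :* (n :* v′ :+ n′ :* v :+ d :* (v :* v′))) (int n) (int n′) (nat D) v v′)
        (+-congʳ (sym (int-* n n′))))

    R-int : ∀ z → R (int z)
    R-int z = z , 0# , Λ-0 , sym (trans (+-congˡ (zeroʳ _)) (+-identityʳ _))

    R-DΛ : ∀ {x} → Λ x → R (nat D * x)
    R-DΛ {x} u = + 0 , x , u , sym (trans (+-congʳ int-0) (+-identityˡ _))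

    R-clear : ∀ x → ∃[ d ] 0 < d × R (nat d * x)
    R-clear x = D ℕ.* proj₁ u , ℕ.*-mono-< (proj₁ (proj₂ structure-constants)) (proj₁ (proj₂ u)) ,
      R-resp (trans (sym (*-assoc _ _ _)) (*-congʳ (sym (nat-* D (proj₁ u))))) (R-DΛ (proj₂ (proj₂ u)))
      where u = Λ-clear x

    generator-traces : ∃[ M ] 0 < M × (∀ i (j : Fin p) → TrL-bounded M (b i * ζ ^ toℕ j))
    generator-traces = common-multiple₂ p p (λ i j M → TrL-bounded M (b i * ζ ^ toℕ j))
      (λ i j d k → denominator-multiple k d (TrL (b i * ζ ^ toℕ j))) (λ i j → denominator (TrL-rational (b i * ζ ^ toℕ j)))

    M : ℕ
    M = proj₁ generator-traces

    Λ-bounded : ∀ {x} → Λ x → TrL-bounded M x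
    Λ-bounded = span-bounded {M = M} λ (i , j , eq) →
      bounded-resp {M} (sym (trans eq (*-congˡ (trans (ζ^-% j) (reflexive (≡.cong (ζ ^_) (≡.sym (Fin.toℕ-fromℕ< (m%n<n j p)))))))))
        (proj₂ (proj₂ generator-traces) i (Fin.fromℕ< (m%n<n j p)))

    R-bounded : ∀ {x} → R x → TrL-bounded M x
    R-bounded (n , v , v∈ , eq) = bounded-resp {M} (sym eq) (bounded-+ {M}
      (bounded-resp {M} (*-identityʳ _) (bounded-int* {M} n (integer-* (integer-int (+ M)) (+ (m ℕ.* p) , TrL-one))))
      (bounded-int* {M} (+ D) (Λ-bounded v∈)))

    conj : ℕ → ℕ → Carrier → Carrier
    conj i j x = σ^ i (τ^ j x)

    conj-% : ∀ i j x → conj i j x ≈ conj (i % p) (j % m) x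
    conj-% i j x = trans (Iterates.iterate-% (lift Galois.σ) p σᵖ≈id i _) (σ^.⟦⟧-cong (i % p) (Iterates.iterate-% (gal⇒ₑ τ) m τᵐ≈id j x))

    -- The basis of F is arbitrary, so the ring R need not be mapped to itself by the automorphisms.
    -- The elements all of whose conjugates lie in R form a subring that is.
    stable : Carrier → Set (c ⊔ ℓ₁)
    stable x = ∀ i j → R (conj i j x)

    -- By periodicity only p m conjugates have to be brought into R, so one common multiple of their
    -- denominators suffices.
    stable-clear : ∀ x → ∃[ d ] 0 < d × stable (nat d * x)
    stable-clear x = proj₁ common , proj₁ (proj₂ common) , λ i j → R-resp (sym (begin
        conj i j (nat d * x)                         ≈⟨ trans (σ^.⟦⟧-cong i (τ^.*-homo j _ _)) (σ^.*-homo i _ _) ⟩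
        conj i j (nat d) * conj i j x                ≈⟨ *-congʳ (trans (σ^.⟦⟧-cong i (τ^-hom.hom-int j (+ d))) (σ^-hom.hom-int i (+ d))) ⟩
        nat d * conj i j x                           ≈⟨ *-congˡ (trans (conj-% i j x) (reflexive (≡.sym (≡.cong₂ (λ i j → conj i j x)
                                                          (Fin.toℕ-fromℕ< (m%n<n i p)) (Fin.toℕ-fromℕ< (m%n<n j m)))))) ⟩
        nat d * conj (toℕ (Fin.fromℕ< (m%n<n i p))) (toℕ (Fin.fromℕ< (m%n<n j m))) x   ∎))
      (proj₂ (proj₂ common) (Fin.fromℕ< (m%n<n i p)) (Fin.fromℕ< (m%n<n j m)))
      where
      common : ∃[ d ] 0 < d × (∀ (i : Fin p) (j : Fin m) → R (nat d * conj (toℕ i) (toℕ j) x))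
      common = common-multiple₂ p m (λ i j d → R (nat d * conj (toℕ i) (toℕ j) x))
        (λ i j d k u → R-resp (trans (sym (*-assoc _ _ _)) (*-congʳ (sym (nat-* k d)))) (R-* (R-int (+ k)) u))
        (λ i j → R-clear (conj (toℕ i) (toℕ j) x))
      d : ℕ
      d = proj₁ common

    action : AbelianAction L ι
    action = record
      { σ        = lift Galois.σ
      ; τ        = gal⇒ₑ τ
      -- The period of σ is `suc m`, which is p; that of τ is `suc (m ∸ 1)`, which is m.
      ; s        = m
      ; t        = m ∸ 1
      ; σ-period = ≡.subst (λ n → ∀ x → σ^ n x ≈ x) (≡.sym 1+m≡p) σᵖ≈id
      ; τ-period = ≡.subst (λ n → ∀ x → τ^ n x ≈ x) (≡.sym (ℕ.m+[n∸m]≡n 0<m)) τᵐ≈id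
      ; στ-comm  = στ-comm
      ; fixed∈ℚ  = στ-fixed∈ℚ
      }

    integralRing : IntegralRing L ι action
    integralRing = record
      { 𝒪         = stable
      ; 𝒪-resp    = λ eq u i j → R-resp (σ^.⟦⟧-cong i (τ^.⟦⟧-cong j eq)) (u i j)
      ; 𝒪-+       = λ u v i j → R-resp (sym (trans (σ^.⟦⟧-cong i (τ^.+-homo j _ _)) (σ^.+-homo i _ _))) (R-+ (u i j) (v i j))
      ; 𝒪-*       = *-stable
      ; 𝒪-int     = λ z i j → R-resp (sym (trans (σ^.⟦⟧-cong i (τ^-hom.hom-int j z)) (σ^-hom.hom-int i z))) (R-int z)
      ; 𝒪-σ       = λ k u i j → R-resp (trans (σ^-+ i k _) (σ^.⟦⟧-cong i (στ-comm k j _))) (u (i ℕ.+ k) j)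
      ; 𝒪-τ       = λ k u i j → R-resp (σ^.⟦⟧-cong i (τ^-+ j k _)) (u i (j ℕ.+ k))
      ; 𝒪-integer = rational⇒integer stable *-stable (proj₁ (proj₂ generator-traces)) (λ u → R-bounded (u 0 0))
      ; 𝒪-clear   = stable-clear
      }
      where
      *-stable : ∀ {x y} → stable x → stable y → stable (x * y)
      *-stable u v i j = R-resp (sym (trans (σ^.⟦⟧-cong i (τ^.*-homo j _ _)) (σ^.*-homo i _ _))) (R-* (u i j) (v i j))

  -- Elements that induce both kinds of extension.

  module BothCase where
    open CyclotomicAction
    open Structure using (τ^-ζ^)
    open Lifting
    open GaloisGroup
    open NonCyclotomicCase using (p∤e)
    open Order using (action; integralRing)
    open SimplePrimes L ι action integralRing
    open Induced γ κ p e ζ′ τ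
    private
      module O = IntegralRing integralRing
      module G = Norms L ι action

    -- Oddness of p enters here: it ensures that τ moves ζ.
    1<m : 1 < m
    1<m = ℕ.≤∧≢⇒< 0<m λ 1≡m → p-odd (divides 1 (≡.trans (≡.sym 1+m≡p) (≡.cong suc (≡.sym 1≡m))))

    α : F.Carrier
    α = proj₁ (Galois.moved 1<p)

    σα≉α : Galois.σ^ 1 α F.≉ α
    σα≉α = proj₂ (Galois.moved 1<p)

    α≉0 : α F.≉ F.0#
    α≉0 α≈0 = σα≉α (F.trans (Extension.⟦⟧-cong (Galois.σ ^ₑ 1) α≈0) (F.trans (Extension.0#-homo (Galois.σ ^ₑ 1)) (F.sym α≈0)))

    -- An i with 0 < i < p is prime to p, and σᵖ = id. By Bézout an element fixed by σⁱ would be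
    -- fixed by σ, while α is not.
    σⁱα≉α : ∀ {i} → 0 < i → i < p → Galois.σ^ i α F.≉ α
    σⁱα≉α {i} 0<i i<p σⁱα≈α = from (Coprimality.coprime-Bézout (Coprimality.sym (prime⇒coprime p-prime {{ℕ.>-nonZero 0<i}} i<p)))
      where
      multiple : ∀ {d} → Galois.σ^ d α F.≈ α → ∀ k → Galois.σ^ (k ℕ.* d) α F.≈ α
      multiple         eq zero    = F.refl
      multiple {d} eq (suc k) = F.trans (F.reflexive (^ₑ-+ Galois.σ d (k ℕ.* d) α))
        (F.trans (Extension.⟦⟧-cong (Galois.σ ^ₑ d) (multiple eq k)) eq)
      combine : ∀ a b → 1 ℕ.+ a ≡ b → Galois.σ^ a α F.≈ α → Galois.σ^ b α F.≈ α → ⊥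
      combine a b ≡.refl eq eq′ = σα≉α (F.trans (Extension.⟦⟧-cong (Galois.σ ^ₑ 1) (F.sym eq)) eq′)
      from : Bézout.Identity 1 i p → ⊥
      from (Bézout.+- k l eq) = combine (l ℕ.* p) (k ℕ.* i) eq (multiple (Galois.σᵖ≈id α) l) (multiple σⁱα≈α k)
      from (Bézout.-+ k l eq) = combine (k ℕ.* i) (l ℕ.* p) eq (multiple σⁱα≈α k) (multiple (Galois.σᵖ≈id α) l)

    -- A primitive element of L: powers of σ move α and fix ζ, powers of τ fix α and move ζ, and
    -- `αζ≉τσ` treats the mixed automorphisms. A multiple of it in the order becomes the ξ of the
    -- prime construction.
    αζ : Carrier
    αζ = γ.⟦ α ⟧ * ζ

    αζ≉σ : ∀ i → i < m → αζ ≉ σ^ (suc i) αζ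
    αζ≉σ i i<m eq = σⁱα≉α (s≤s z≤n) (ℕ.<-≤-trans (s≤s i<m) (ℕ.≤-reflexive 1+m≡p))
      (γ.hom-injective (*-cancelˡ ζ≉0 (begin
        ζ * γ.⟦ Galois.σ^ (suc i) α ⟧             ≈⟨ *-comm _ _ ⟩
        γ.⟦ Galois.σ^ (suc i) α ⟧ * ζ             ≈⟨ *-cong (σ^-γ (suc i) α) (σ^-ζ (suc i)) ⟨
        σ^ (suc i) γ.⟦ α ⟧ * σ^ (suc i) ζ         ≈⟨ σ^.*-homo (suc i) _ _ ⟨
        σ^ (suc i) αζ                             ≈⟨ eq ⟨
        αζ                                        ≈⟨ *-comm _ _ ⟩
        ζ * γ.⟦ α ⟧                               ∎)))

    -- The ratio of τʲ(ζ) and ζ is a nontrivial p-th root of unity, so it is not fixed by τ, unlike the elements of F.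
    ratio-not-in-F : ∀ j → j < m ∸ 1 → ∀ {f g} → γ.⟦ f ⟧ ≉ 0# → γ.⟦ g ⟧ ≉ 0# → γ.⟦ f ⟧ * ζ ≉ γ.⟦ g ⟧ * τ^ (suc j) ζ
    ratio-not-in-F j j<t {f} {g} f≉0 g≉0 eq = τⁱζ≉ζ {1} (s≤s z≤n) 1<m (begin
        τ^ 1 ζ                      ≈⟨ τ^.⟦⟧-cong 1 (proj₂ generator) ⟩
        τ^ 1 (v ^ k)                ≈⟨ τ^-hom.hom-^ 1 v k ⟩
        τ^ 1 v ^ k                  ≈⟨ ^-congˡ k τv≈v ⟩
        v ^ k                       ≈⟨ proj₂ generator ⟨
        ζ                           ∎)
      where
      u v : Carrier
      a : ℕ
      a = e ℕ.^ suc j ℕ.+ m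
      u = τ^ (suc j) ζ
      v = ζ ^ a
      v≈uζ̄ : v ≈ u * ζ̄
      v≈uζ̄ = trans (sym (^-+ ζ (e ℕ.^ suc j) m)) (*-congʳ (sym (τ^-ζ (suc j))))
      vζ≈u : v * ζ ≈ u
      vζ≈u = trans (*-congʳ v≈uζ̄) (trans (*-assoc u ζ̄ ζ) (trans (*-congˡ (trans (*-comm ζ̄ ζ) ζζ̄≈1)) (*-identityʳ u)))
      f≈gv : γ.⟦ f ⟧ ≈ γ.⟦ g ⟧ * v
      f≈gv = *-cancelˡ ζ≉0 (begin
        ζ * γ.⟦ f ⟧               ≈⟨ trans (*-comm _ _) eq ⟩
        γ.⟦ g ⟧ * u               ≈⟨ *-congˡ vζ≈u ⟨
        γ.⟦ g ⟧ * (v * ζ)         ≈⟨ solve 3 (λ g v z → g :* (v :* z) := z :* (g :* v)) γ.⟦ g ⟧ v ζ ⟩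
        ζ * (γ.⟦ g ⟧ * v)         ∎)
      τv≈v : τ^ 1 v ≈ v
      τv≈v = *-cancelˡ g≉0 (begin
        γ.⟦ g ⟧ * τ^ 1 v          ≈⟨ *-congʳ (τ^-γ 1 g) ⟨
        τ^ 1 γ.⟦ g ⟧ * τ^ 1 v     ≈⟨ τ^.*-homo 1 _ _ ⟨
        τ^ 1 (γ.⟦ g ⟧ * v)        ≈⟨ τ^.⟦⟧-cong 1 f≈gv ⟨
        τ^ 1 γ.⟦ f ⟧              ≈⟨ trans (τ^-γ 1 f) f≈gv ⟩
        γ.⟦ g ⟧ * v               ∎)
      p∤a : ¬ (p ∣ a)
      p∤a p∣a = τⁱζ≉ζ (s≤s z≤n) (ℕ.<-≤-trans (s≤s j<t) (ℕ.≤-reflexive (ℕ.m+[n∸m]≡n 0<m)))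
        (trans (sym vζ≈u) (trans (*-congʳ (∣⇒ζ^≈1 p∣a)) (*-identityˡ ζ)))
      generator : ∃[ k ] ζ ≈ v ^ k
      generator = ζ-power-generates p∤a
      k = proj₁ generator

    αζ≉τσ : ∀ j → j < m ∸ 1 → ∀ i → αζ ≉ τ^ (suc j) (σ^ i αζ)
    αζ≉τσ j j<t i eq = ratio-not-in-F j j<t {α} {Galois.σ^ i α} (γ.hom-≉0 α≉0)
      (γ.hom-≉0 (Embedding.hom-≉0 ιF ιF (Galois.σ ^ₑ i) α≉0)) (trans eq (begin
        τ^ (suc j) (σ^ i αζ)                              ≈⟨ τ^.⟦⟧-cong (suc j) (trans (σ^.*-homo i _ _) (*-cong (σ^-γ i α) (σ^-ζ i))) ⟩
        τ^ (suc j) (γ.⟦ Galois.σ^ i α ⟧ * ζ)              ≈⟨ trans (τ^.*-homo (suc j) _ _) (*-congʳ (τ^-γ (suc j) _)) ⟩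
        γ.⟦ Galois.σ^ i α ⟧ * τ^ (suc j) ζ                ∎))

    scaled-distinct : ∀ {d} → 0 < d → (φ : Extension L L) → αζ ≉ Extension.⟦_⟧ φ αζ → nat d * αζ ≉ Extension.⟦_⟧ φ (nat d * αζ)
    scaled-distinct {d} 0<d φ αζ≉ eq = αζ≉ (*-cancelˡ (nat≉0 d 0<d)
      (trans eq (trans (Extension.*-homo φ _ _) (*-congʳ (Embedding.hom-int ι ι φ (+ d))))))

    prime-element : SimplePrime
    prime-element = from (O.𝒪-clear αζ)
      where
      from : ∃[ d ] 0 < d × O.𝒪 (nat d * αζ) → SimplePrime
      from (d , 0<d , ξ∈) = Existence.simplePrime (nat d * αζ) ξ∈
        (λ i i<m → scaled-distinct 0<d (σ^ₑ (suc i)) (αζ≉σ i i<m))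
        (λ j j<t i _ → scaled-distinct 0<d (τ^ₑ (suc j) ∘ₑ σ^ₑ i) (αζ≉τσ j j<t i)) 0<m

    module AtPrime (P : SimplePrime) where
      open SimplePrime P
      open PrimeIdeal L ι action integralRing q q-prime x
      open Ideal L ι action integralRing q x
      open Valuation L ι action integralRing q q-prime x unramified z Norm≈qz q∤z
      open Unramified unramified
      open Ring L ι action integralRing

      -- The cofactor of x to the power `weight 0` in Φ(N x). It is built from conjugates of x other
      -- than x, all of them units modulo J, so it leaves the valuation at `weight 0`.
      U : Carrier
      U = G.Nσ/ x ^ weight 0 * ∏ (m ∸ 1) (λ j → τ^ (suc j) (G.Nσ x) ^ weight (suc j))

      N≈Nσ : N x ≈ G.Nσ x
      N≈Nσ = reflexive (≡.cong (λ n → ∏ n (λ i → σ^ i x)) (≡.sym 1+m≡p))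

      ΦN≈ : Φ (N x) ≈ x ^ weight 0 * U
      ΦN≈ = begin
        Φ (N x)                                                      ≈⟨ trans (Φ-cong N≈Nσ) (Φ≈∏ (G.Nσ x)) ⟩
        ∏ m (λ j → τ^ j (G.Nσ x) ^ weight j)                         ≡⟨ ≡.cong (λ n → ∏ n (λ j → τ^ j (G.Nσ x) ^ weight j)) (ℕ.m+[n∸m]≡n 0<m) ⟨
        (x * G.Nσ/ x) ^ weight 0 * ∏ (m ∸ 1) (λ j → τ^ (suc j) (G.Nσ x) ^ weight (suc j))
                                                                     ≈⟨ trans (*-congʳ (^-distrib-* x (G.Nσ/ x) (weight 0))) (*-assoc _ _ _) ⟩
        x ^ weight 0 * U                                             ∎

      Nσ/∈ : O.𝒪 (G.Nσ/ x)
      Nσ/∈ = 𝒪-∏ m λ i → O.𝒪-σ (suc i) x∈𝒪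

      τNσ∈ : ∀ j → O.𝒪 (τ^ (suc j) (G.Nσ x))
      τNσ∈ j = O.𝒪-τ (suc j) (𝒪-Nσ x∈𝒪)

      U∈ : O.𝒪 U
      U∈ = O.𝒪-* (𝒪-^ (weight 0) Nσ/∈) (𝒪-∏ (m ∸ 1) λ j → 𝒪-^ (weight (suc j)) (τNσ∈ j))

      U∉J : ¬ J U
      U∉J = ∉J-* unramified (𝒪-^ (weight 0) Nσ/∈) (𝒪-∏ (m ∸ 1) λ j → 𝒪-^ (weight (suc j)) (τNσ∈ j))
        (∉J-^ unramified (weight 0) Nσ/∈ (Good⇒∉J unramified (Good-∏ q-prime m good-σ)))
        (∉J-∏ unramified (m ∸ 1) (λ j → 𝒪-^ (weight (suc j)) (τNσ∈ j)) λ j j<t → ∉J-^ unramified (weight (suc j)) (τNσ∈ j) λ j′ →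
          Good⇒∉J unramified (Good-∏ q-prime (suc m) (good-τ j j<t)) (J-resp (τ^-hom.hom-∏ (suc j) (suc m) (λ i → σ^ i x)) j′))

      p∤weight : ¬ (p ∣ weight 0)
      p∤weight = p∤e ∘ prime∣^⇒∣ p-prime e (p ∸ 2)

      p²∤ : ¬ (p ℕ.* p ∣ weight 0 ℕ.* p)
      p²∤ = p∤weight ∘ *-cancelʳ-∣ p

      -- c need not lie in 𝒪, so the valuation argument is applied to a p-th power.
      not-Power : ∀ {c} → c ^ p ≈ 1# → ¬ Power (Φ (c * N x))
      not-Power {c} cᵖ≈1 (w , w#0 , eq) = not-power {p ℕ.* p} {weight 0 ℕ.* p} {U ^ p} p²∤ (𝒪-^ p U∈) (∉J-^ unramified p U∈ U∉J) (#⇒≉ w#0) (begin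
        w ^ (p ℕ.* p)                           ≈⟨ trans (sym (^-assocʳ w p p)) (^-congˡ p (trans (sym eq) (Φ-* c (N x)))) ⟩
        (Φ c * Φ (N x)) ^ p                     ≈⟨ ^-distrib-* _ _ p ⟩
        Φ c ^ p * Φ (N x) ^ p                   ≈⟨ *-cong (trans (sym (Φ-^ c p)) (trans (Φ-cong cᵖ≈1) Φ-1)) (^-congˡ p ΦN≈) ⟩
        1# * (x ^ weight 0 * U) ^ p             ≈⟨ trans (*-identityˡ _) (trans (^-distrib-* _ U p) (*-congʳ (^-assocʳ x (weight 0) p))) ⟩
        x ^ (weight 0 ℕ.* p) * U ^ p            ∎)
        where
        Φ-1 : Φ 1# ≈ 1#
        Φ-1 = trans (Φ≈∏ 1#) (∏-one m λ i _ → trans (^-congˡ (weight i) (τ^.1#-homo i)) (1^n≈1 (weight i)))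

      -- The factor gᵖ changes Φ(N x) only by a p-th power. The integers g start at 1, so all values
      -- are nonzero, and distinct g have distinct p-th powers.
      f : ℕ → Carrier
      f n = x * nat (suc n) ^ p

      g≉0 : ∀ n → nat (suc n) ≉ 0#
      g≉0 n = nat≉0 (suc n) (s≤s z≤n)

      N-f : ∀ n → N (f n) ≈ N x * N (nat (suc n)) ^ p
      N-f n = begin
        ∏ p (λ i → σ^ i (x * nat (suc n) ^ p))                          ≈⟨ ∏-cong′ p (λ i → trans (σ^.*-homo i _ _) (*-congˡ (σ^-hom.hom-^ i (nat (suc n)) p))) ⟩
        ∏ p (λ i → σ^ i x * σ^ i (nat (suc n)) ^ p)                     ≈⟨ ∏-* p (λ i → σ^ i x) (λ i → σ^ i (nat (suc n)) ^ p) ⟩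
        N x * ∏ p (λ i → σ^ i (nat (suc n)) ^ p)                        ≈⟨ *-congˡ (∏-^ p p (λ i → σ^ i (nat (suc n)))) ⟨
        N x * N (nat (suc n)) ^ p                                       ∎

      f-not-Power : ∀ n {c} → c ^ p ≈ 1# → ¬ Power (Φ (c * N (f n)))
      f-not-Power n {c} cᵖ≈1 pow = not-Power cᵖ≈1 (Power-/ (^-Power (Φ-≉0 (∏-≉0 p λ i _ → σ^-hom.hom-≉0 i (g≉0 n))))
        (Power-resp (trans (Φ-cong (trans (*-congˡ (N-f n)) (solve 3 (λ c a b → c :* (a :* b) := b :* (c :* a)) c (N x) _)))
          (trans (Φ-* _ (c * N x)) (*-congʳ (Φ-^ (N (nat (suc n))) p)))) pow))

      f-injective : Injective _≡_ _≈_ f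
      f-injective {i} {j} eq = ℕ.suc-injective (power-injective (nat-injective
        (trans (nat-^ (suc i) p) (trans (*-cancelˡ x≉0 eq) (sym (nat-^ (suc j) p))))))
        where
        power-injective : ∀ {a b} → a ℕ.^ p ≡ b ℕ.^ p → a ≡ b
        power-injective {a} {b} eq with ℕ.<-cmp a b
        ... | Tri.tri< a<b _ _ = contradiction eq (ℕ.<⇒≢ (ℕ.^-monoˡ-< p a<b))
        ... | Tri.tri≈ _ a≡b _ = a≡b
        ... | Tri.tri> _ _ b<a = contradiction (≡.sym eq) (ℕ.<⇒≢ (ℕ.^-monoˡ-< p b<a))

      infinitely-many : Σ[ f ∈ (ℕ → Carrier) ] (Injective _≡_ _≈_ f ×
        (∀ n → f n # 0# × InducesHeisenberg (f n) × InducesSemidirect (f n)))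
      infinitely-many = f , f-injective , λ n → ≉⇒# (*-≉0 x≉0 (^-≉0 p (g≉0 n)))
        , (N (f n) , N-isNorm (f n) , λ pow → f-not-Power n (1^n≈1 p) (Power-resp (Φ-cong (sym (*-identityˡ _))) pow))
        , (N (f n) , N-isNorm (f n) , f-not-Power n ζⁿ≈1)

    infinitely-many-both : Σ[ f ∈ (ℕ → Carrier) ] (Injective _≡_ _≈_ f ×
      (∀ n → f n # 0# × InducesHeisenberg (f n) × InducesSemidirect (f n)))
    infinitely-many-both = AtPrime.infinitely-many prime-element

theorem4p3 :
  ∀ {c ℓ₁ ℓ₂} (p : ℕ) → Prime p → 2 ∤ p →
  (F K L : Field c ℓ₁ ℓ₂) →
  (ιF : Extension ℚ-field F) → IsCyclicOfDegree ιF p →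
  (ιK : Extension ℚ-field K) (ζ : Field.Carrier K) →
  IsPrimitiveRootOfUnity K p ζ → GeneratedBy ιK (Field._≈_ K ζ) →
  (γ : Extension F L) (κ : Extension K L) → GeneratedBy γ (Image κ) →
  (τ : Gal γ) → IsGenerator γ τ →
  (e : ℕ) → IsPrimitiveRootModulo p e →
  let
    open Field L
    open Extension κ using (⟦_⟧)
    open Induced γ κ p e ζ τ
    ιL = γ ∘ₑ ιF
  in
  Gal.⟦ τ ⟧ ⟦ ζ ⟧ ≈ ⟦ ζ ⟧ ^ e →
  (IsCyclotomic ιL (p ℕ.^ 2) →
     ∀ x → x # 0# → InducesHeisenberg x ⇔ InducesSemidirect x)
  × (¬ IsCyclotomic ιL (p ℕ.^ 2) →
     ∀ x → x # 0# → ¬ InducesHeisenberg x → InducesSemidirect x)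
  × (Σ[ f ∈ (ℕ → Carrier) ] (Injective _≡_ _≈_ f ×
     (∀ n → f n # 0# × InducesHeisenberg (f n) × InducesSemidirect (f n))))
theorem4p3 {c} {ℓ₁} {ℓ₂} p p-prime p-odd F K L ιF F-cyclic ιK ζ ζ-primitive K-generated γ κ L-generated τ _ e e-primitive τζ≈ζᵉ =
  (λ cyclotomic x _ → CyclotomicCase.heisenberg⇔semidirect S cyclotomic x) , NonCyclotomicCase.semidirect S , BothCase.infinitely-many-both S
  where
  S : Setup c ℓ₁ ℓ₂
  S = record
    { p = p ; p-prime = p-prime ; p-odd = p-odd ; F = F ; K = K ; L = L
    ; ιF = ιF ; F-cyclic = F-cyclic ; ιK = ιK ; ζ′ = ζ ; ζ′-primitive = ζ-primitive ; K-generated = K-generated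
    ; γ = γ ; κ = κ ; L-generated = L-generated ; τ = τ ; e = e ; e-primitive = e-primitive ; τζ≈ζᵉ = τζ≈ζᵉ
    }
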